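{- There exist two algorithms $\mathcal{A}$ and $\mathcal{B}$ with the following properties. For every computable function $f:\mathbb{N}\to\mathbb{N}$ (given to the algorithms by a description, e.g. a Turing machine computing $f$), the algorithm $\mathcal{A}$ on input $f$ returns a positive integer $m(f)$, and for every integer $n\geq m(f)$ the algorithm $\mathcal{B}$ on input $f$ and $n$ halts and returns a system $S\subseteq E_n$ such that $S$ is consistent over the integers (i.e. some $(x_1,\ldots,x_n)\in\mathbb{Z}^n$ satisfies all equations of $S$) and every integer tuple $(x_1,\ldots,x_n)\in\mathbb{Z}^n$ that solves $S$ satisfies $x_1=f(n)$.
   Context: For a positive integer $n$, $E_n$ denotes the finite set of equations in the variables $x_1,\ldots,x_n$ $$E_n=\{x_i=1,\ x_i+x_j=x_k,\ x_i\cdot x_j=x_k:\ i,j,k\in\{1,\ldots,n\}\}.$$ A system $S\subseteq E_n$ is a finite set of such equations; a tuple $(x_1,\ldots,x_n)$ solves $S$ if it satisfies every equation in $S$. $\mathbb{N}=\{0,1,2,\ldots\}$. -}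

module Defs where

open import Data.Nat using (ℕ; zero; suc; _<_)
open import Data.Fin using (Fin)
open import Data.Vec using (Vec; []; _∷_; lookup)
open import Data.Product using (Σ; _×_)
open import Data.List using (List)
open import Data.List.Relation.Unary.All using (All)
open import Data.Integer using (ℤ; _+_; _*_; 1ℤ)
open import Relation.Binary.PropositionalEquality using (_≡_)

-- Descriptions of computable functions: codes of partial recursive
-- functions of arity k (a standard Turing-complete model).

data PR : ℕ → Set where
  Zr   : ∀ {k} → PR k
  Sc   : PR 1
  Pj   : ∀ {k} → Fin k → PR k
  Cmp  : ∀ {k l} → PR l → Vec (PR k) l → PR k
  Rec  : ∀ {k} → PR k → PR (suc (suc k)) → PR (suc k)
  Mu   : ∀ {k} → PR (suc k) → PR k

mutual
  data _⟨_⟩⇓_ : ∀ {k} → PR k → Vec ℕ k → ℕ → Set where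
    ev-Z   : ∀ {k} {xs : Vec ℕ k} → Zr ⟨ xs ⟩⇓ 0
    ev-S   : ∀ {x} → Sc ⟨ x ∷ [] ⟩⇓ suc x
    ev-P   : ∀ {k} {i : Fin k} {xs} → Pj i ⟨ xs ⟩⇓ lookup xs i
    ev-C   : ∀ {k l} {g : PR l} {hs : Vec (PR k) l} {xs ys y} →
             hs ⟨ xs ⟩⇓* ys → g ⟨ ys ⟩⇓ y → Cmp g hs ⟨ xs ⟩⇓ y
    ev-R0  : ∀ {k} {f : PR k} {g xs y} →
             f ⟨ xs ⟩⇓ y → Rec f g ⟨ 0 ∷ xs ⟩⇓ y
    ev-RS  : ∀ {k} {f : PR k} {g xs n r y} →
             Rec f g ⟨ n ∷ xs ⟩⇓ r → g ⟨ n ∷ r ∷ xs ⟩⇓ y →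
             Rec f g ⟨ suc n ∷ xs ⟩⇓ y
    ev-M   : ∀ {k} {g : PR (suc k)} {xs y} →
             g ⟨ y ∷ xs ⟩⇓ 0 →
             (∀ z → z < y → Σ ℕ (λ v → g ⟨ z ∷ xs ⟩⇓ suc v)) →
             Mu g ⟨ xs ⟩⇓ y

  data _⟨_⟩⇓*_ : ∀ {k l} → Vec (PR k) l → Vec ℕ k → Vec ℕ l → Set where
    ev-[] : ∀ {k} {xs : Vec ℕ k} → [] ⟨ xs ⟩⇓* []
    ev-∷  : ∀ {k l} {h : PR k} {hs : Vec (PR k) l} {xs y ys} →
            h ⟨ xs ⟩⇓ y → hs ⟨ xs ⟩⇓* ys → (h ∷ hs) ⟨ xs ⟩⇓* (y ∷ ys)

Computes : PR 1 → (ℕ → ℕ) → Set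
Computes c f = ∀ n → c ⟨ n ∷ [] ⟩⇓ f n

-- Equations of E_n (variables indexed by Fin n; Fin 0 ↦ x₁).

data Equation (n : ℕ) : Set where
  one : Fin n → Equation n
  add : Fin n → Fin n → Fin n → Equation n
  mul : Fin n → Fin n → Fin n → Equation n

System : ℕ → Set
System n = List (Equation n)

Holds : ∀ {n} → (Fin n → ℤ) → Equation n → Set
Holds x (one i)     = x i ≡ 1ℤ
Holds x (add i j k) = x i + x j ≡ x k
Holds x (mul i j k) = x i * x j ≡ x k

Solves : ∀ {n} → (Fin n → ℤ) → System n → Set
Solves x S = All (Holds x) S

-- Algorithms are Agda functions (hence computable); possibly
-- non-halting algorithms are modelled with a fuel argument:
-- output `just v` at fuel k means "halts within k steps with v".

{-# OPTIONS --safe #-}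
-- The graph of a recursive function is Diophantine (Matiyasevich, Robinson, Davis, Putnam).
-- For n = 8h + r the equation "y = f(8h + r)" then becomes a system in the ring operations
-- whose number of variables is a constant plus about n/4, hence at most n for large n.
--
-- Powers are Diophantine by way of the Lucas sequences α(n+2) = b α(n+1) - α(n); binomial
-- coefficients are digits of powers of 1 + X, and factorials are quotients of powers by
-- binomial coefficients.  A bounded quantifier ∀ i < n is removed by working modulo
-- C(K!² - 1, n), a product of n pairwise coprime moduli without prime factors up to K:
-- one number codes one witness for each i, and the congruence K!² - 1 ≡ i recovers i.
-- Primitive recursion and minimisation need only bounded quantifiers and Gödel's β.
-- Over ℤ, x ≥ 0 is expressed by x being a sum of four rational squares.
module Submission where


-- Two obstacles shape the proof. Under a bounded quantifier a coded witness `a` is known only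
-- modulo something, so "the witness is at most u" has to become a divisibility. A prime p dividing
-- C(a, u+1) divides a(a-1)...(a-u), hence a is congruent to one of 0, ..., u modulo p. Decoding
-- therefore works modulo primes, and large ones, so that a congruence between small values is an
-- equality; coding by Chinese remainders works with pairwise coprime moduli coprime to (u+1)!. The
-- factors of C(K!² - 1, n) serve both ends: any prime factor of a modulus can be used for decoding,
-- and their product is a binomial coefficient, hence already Diophantine. The other obstacle is the
-- budget of n variables. A unary numeral costs two variables per unit, so the numeral of n itself
-- would not fit. Dividing n by any constant above 2 and multiplying back leaves, for large n,
-- enough room for the part of the system that depends on f alone; 8 is a comfortable choice.

-- Existential formulas over ℕ and Diophantine relations.

module Formulas where
  open import Data.Nat using (ℕ; zero; suc; _+_; _*_; _<_; _≤_)
  open import Data.Nat.Properties using (m≤m+n; m≤n⇒∃[o]m+o≡n)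
  open import Data.Fin using (Fin; zero; suc)
  open import Data.Vec using (Vec; []; _∷_; lookup; map; tabulate)
  open import Data.Vec.Properties using (lookup-map)
  open import Data.Product using (∃; _×_; _,_)
  open import Function using (_∘_)
  open import Relation.Binary.PropositionalEquality using (_≡_; refl; sym; trans; cong; cong₂; subst)

  infixl 6 _⊕_
  infixl 7 _⊗_
  infix  4 _≐_ _⊨_
  infixr 3 _∧_

  data Tm (k : ℕ) : Set where
    var     : Fin k → Tm k
    𝟘 𝟙     : Tm k
    _⊕_ _⊗_ : Tm k → Tm k → Tm k

  data Fo (k : ℕ) : Set where
    _≐_ : Tm k → Tm k → Fo k
    _∧_ : Fo k → Fo k → Fo k
    ex  : Fo (suc k) → Fo k

  ⟦_⟧ : ∀ {k} → Tm k → Vec ℕ k → ℕ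
  ⟦ var i ⟧ v = lookup v i
  ⟦ 𝟘 ⟧     v = 0
  ⟦ 𝟙 ⟧     v = 1
  ⟦ s ⊕ t ⟧ v = ⟦ s ⟧ v + ⟦ t ⟧ v
  ⟦ s ⊗ t ⟧ v = ⟦ s ⟧ v * ⟦ t ⟧ v

  _⊨_ : ∀ {k} → Vec ℕ k → Fo k → Set
  v ⊨ (s ≐ t) = ⟦ s ⟧ v ≡ ⟦ t ⟧ v
  v ⊨ (φ ∧ ψ) = (v ⊨ φ) × (v ⊨ ψ)
  v ⊨ (ex φ)  = ∃ λ x → (x ∷ v) ⊨ φ

  evals : ∀ {k l} → Vec (Tm l) k → Vec ℕ l → Vec ℕ k
  evals σ v = map (λ t → ⟦ t ⟧ v) σ

  renT : ∀ {k l} → (Fin k → Fin l) → Tm k → Tm l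
  renT f (var i) = var (f i)
  renT f 𝟘       = 𝟘
  renT f 𝟙       = 𝟙
  renT f (s ⊕ t) = renT f s ⊕ renT f t
  renT f (s ⊗ t) = renT f s ⊗ renT f t

  ⟦renT⟧ : ∀ {k l} (f : Fin k → Fin l) {v w} → (∀ i → lookup w (f i) ≡ lookup v i) →
           ∀ t → ⟦ renT f t ⟧ w ≡ ⟦ t ⟧ v
  ⟦renT⟧ f e (var i) = e i
  ⟦renT⟧ f e 𝟘       = refl
  ⟦renT⟧ f e 𝟙       = refl
  ⟦renT⟧ f e (s ⊕ t) = cong₂ _+_ (⟦renT⟧ f e s) (⟦renT⟧ f e t)
  ⟦renT⟧ f e (s ⊗ t) = cong₂ _*_ (⟦renT⟧ f e s) (⟦renT⟧ f e t)

  evals-ren : ∀ {k l m} (f : Fin l → Fin m) {v w} → (∀ i → lookup w (f i) ≡ lookup v i) →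
              (σ : Vec (Tm l) k) → evals (map (renT f) σ) w ≡ evals σ v
  evals-ren f e []      = refl
  evals-ren f e (t ∷ σ) = cong₂ _∷_ (⟦renT⟧ f e t) (evals-ren f e σ)

  vars : ∀ {k l} → (Fin k → Fin l) → Vec (Tm l) k
  vars f = tabulate (var ∘ f)

  evals-vars : ∀ {k l} (f : Fin k → Fin l) (v : Vec ℕ k) {w} →
               (∀ i → lookup w (f i) ≡ lookup v i) → evals (vars f) w ≡ v
  evals-vars f []      e = refl
  evals-vars f (x ∷ v) e = cong₂ _∷_ (e zero) (evals-vars (f ∘ suc) v (e ∘ suc))

  subT : ∀ {k l} → Vec (Tm l) k → Tm k → Tm l
  subT σ (var i) = lookup σ i
  subT σ 𝟘       = 𝟘
  subT σ 𝟙       = 𝟙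
  subT σ (s ⊕ t) = subT σ s ⊕ subT σ t
  subT σ (s ⊗ t) = subT σ s ⊗ subT σ t

  ⟦subT⟧ : ∀ {k l} (σ : Vec (Tm l) k) v t → ⟦ subT σ t ⟧ v ≡ ⟦ t ⟧ (evals σ v)
  ⟦subT⟧ σ v (var i) = sym (lookup-map i (λ t → ⟦ t ⟧ v) σ)
  ⟦subT⟧ σ v 𝟘       = refl
  ⟦subT⟧ σ v 𝟙       = refl
  ⟦subT⟧ σ v (s ⊕ t) = cong₂ _+_ (⟦subT⟧ σ v s) (⟦subT⟧ σ v t)
  ⟦subT⟧ σ v (s ⊗ t) = cong₂ _*_ (⟦subT⟧ σ v s) (⟦subT⟧ σ v t)

  lift : ∀ {k l} → Vec (Tm l) k → Vec (Tm (suc l)) (suc k)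
  lift σ = var zero ∷ map (renT suc) σ

  sub : ∀ {k l} → Vec (Tm l) k → Fo k → Fo l
  sub σ (s ≐ t) = subT σ s ≐ subT σ t
  sub σ (φ ∧ ψ) = sub σ φ ∧ sub σ ψ
  sub σ (ex φ)  = ex (sub (lift σ) φ)

  evals-lift : ∀ {k l} (σ : Vec (Tm l) k) {v x} → evals (lift σ) (x ∷ v) ≡ x ∷ evals σ v
  evals-lift σ = cong (_ ∷_) (evals-ren suc (λ _ → refl) σ)

  ⊨sub : ∀ {k l} (σ : Vec (Tm l) k) φ {v} → v ⊨ sub σ φ → evals σ v ⊨ φ
  ⊨sub σ (s ≐ t) {v} e  = trans (sym (⟦subT⟧ σ v s)) (trans e (⟦subT⟧ σ v t))
  ⊨sub σ (φ ∧ ψ) (p , q) = ⊨sub σ φ p , ⊨sub σ ψ q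
  ⊨sub σ (ex φ) (x , p)  = x , subst (_⊨ φ) (evals-lift σ) (⊨sub (lift σ) φ p)

  sub⊨ : ∀ {k l} (σ : Vec (Tm l) k) φ {v} → evals σ v ⊨ φ → v ⊨ sub σ φ
  sub⊨ σ (s ≐ t) {v} e  = trans (⟦subT⟧ σ v s) (trans e (sym (⟦subT⟧ σ v t)))
  sub⊨ σ (φ ∧ ψ) (p , q) = sub⊨ σ φ p , sub⊨ σ ψ q
  sub⊨ σ (ex φ) (x , p)  = x , sub⊨ (lift σ) φ (subst (_⊨ φ) (sym (evals-lift σ)) p)

  -- The formula is data and not a mere existence claim: bounded quantifiers are eliminated by
  -- recursion over it, and its size enters the threshold m(f).
  record Dio {k : ℕ} (R : Vec ℕ k → Set) : Set where
    constructor dio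
    field
      fo       : Fo k
      sound    : ∀ v → v ⊨ fo → R v
      complete : ∀ v → R v → v ⊨ fo

  open Dio public

  infixr 3 _∧D_

  eqD : ∀ {k} (s t : Tm k) → Dio (λ v → ⟦ s ⟧ v ≡ ⟦ t ⟧ v)
  eqD s t = dio (s ≐ t) (λ _ p → p) (λ _ p → p)

  _∧D_ : ∀ {k} {R Q : Vec ℕ k → Set} → Dio R → Dio Q → Dio (λ v → R v × Q v)
  d ∧D e = dio (fo d ∧ fo e)
               (λ v (p , q) → sound d v p , sound e v q)
               (λ v (p , q) → complete d v p , complete e v q)

  exD : ∀ {k} {R : Vec ℕ (suc k) → Set} → Dio R → Dio (λ v → ∃ λ x → R (x ∷ v))
  exD d = dio (ex (fo d)) (λ v (x , p) → x , sound d (x ∷ v) p)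
                          (λ v (x , p) → x , complete d (x ∷ v) p)

  -- Composition with terms, permutation and weakening of arguments all go through this combinator,
  -- so each basic relation is treated once, on a vector of exactly its own arguments.
  subD : ∀ {k l} {R : Vec ℕ k → Set} → Dio R → (σ : Vec (Tm l) k) → Dio (λ v → R (evals σ v))
  subD d σ = dio (sub σ (fo d)) (λ v p → sound d (evals σ v) (⊨sub σ (fo d) p))
                                (λ v p → sub⊨ σ (fo d) (complete d (evals σ v) p))

  mapD : ∀ {k} {R Q : Vec ℕ k → Set} → (∀ v → R v → Q v) → (∀ v → Q v → R v) → Dio R → Dio Q
  mapD f g d = dio (fo d) (λ v p → f v (sound d v p)) (λ v q → complete d v (g v q))

  ⟦wk⟧ : ∀ {k} (t : Tm k) {v x} → ⟦ renT suc t ⟧ (x ∷ v) ≡ ⟦ t ⟧ v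
  ⟦wk⟧ t = ⟦renT⟧ suc (λ _ → refl) t

  leD : ∀ {k} (s t : Tm k) → Dio (λ v → ⟦ s ⟧ v ≤ ⟦ t ⟧ v)
  leD s t = dio (ex (renT suc s ⊕ var zero ≐ renT suc t))
    (λ v (x , e) → subst (_ ≤_) (trans (cong (_+ x) (sym (⟦wk⟧ s))) (trans e (⟦wk⟧ t))) (m≤m+n _ x))
    (λ v p → let (x , e) = m≤n⇒∃[o]m+o≡n p in
             x , trans (cong (_+ x) (⟦wk⟧ s)) (trans e (sym (⟦wk⟧ t))))

  ltD : ∀ {k} (s t : Tm k) → Dio (λ v → ⟦ s ⟧ v < ⟦ t ⟧ v)
  ltD s t = leD (𝟙 ⊕ s) t

  num : ∀ {k} → ℕ → Tm k
  num zero    = 𝟘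
  num (suc n) = 𝟙 ⊕ num n

  ⟦num⟧ : ∀ {k} n (v : Vec ℕ k) → ⟦ num n ⟧ v ≡ n
  ⟦num⟧ zero    v = refl
  ⟦num⟧ (suc n) v = cong suc (⟦num⟧ n v)

-- Congruences of integers, and their expression over ℕ.

module Congruences where
  open Formulas
  open import Data.Nat as ℕ using (ℕ; zero; suc)
  import Data.Nat.Properties as ℕ
  import Data.Nat.Divisibility as ℕ
  import Data.Nat.DivMod as ℕ
  import Data.Nat.Coprimality as C
  open import Data.Nat.GCD using (module Bézout)
  open import Data.Integer hiding (suc; pred)
  open import Data.Integer.Properties
  open import Data.Integer.DivMod using (_%ℕ_; _/ℕ_; a≡a%ℕn+[a/ℕn]*n)
  open import Data.Integer.Divisibility.Signed
  open import Data.Integer.Tactic.RingSolver using (solve-∀)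
  open import Data.Fin using (zero; suc; #_)
  open import Data.Vec using (Vec; []; _∷_)
  open import Data.Product using (∃; _,_; proj₁; proj₂)
  open import Data.Sum using (inj₁; inj₂)
  open import Relation.Binary.PropositionalEquality

  infix 4 _≈_[_]

  -- Wrapped in a record so that x and y can be inferred; they cannot be recovered from the integer
  -- `x - y`.
  record _≈_[_] (x y m : ℤ) : Set where
    constructor mk
    field dvd : m ∣ x - y

  open _≈_[_] public

  ≈-reflexive : ∀ {m x y} → x ≡ y → x ≈ y [ m ]
  ≈-reflexive {m} {x} refl = mk (subst (m ∣_) (sym (+-inverseʳ x)) (divides 0ℤ refl))

  ≈-refl : ∀ {m x} → x ≈ x [ m ]
  ≈-refl = ≈-reflexive refl

  ≈-sym : ∀ {m x y} → x ≈ y [ m ] → y ≈ x [ m ]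
  ≈-sym {m} {x} {y} (mk p) = mk (subst (m ∣_) (eq x y) (∣m⇒∣-m p))
    where
    eq : ∀ x y → - (x - y) ≡ y - x
    eq = solve-∀

  ≈-trans : ∀ {m x y z} → x ≈ y [ m ] → y ≈ z [ m ] → x ≈ z [ m ]
  ≈-trans {m} {x} {y} {z} (mk p) (mk q) = mk (subst (m ∣_) (eq x y z) (∣m∣n⇒∣m+n p q))
    where
    eq : ∀ x y z → (x - y) + (y - z) ≡ x - z
    eq = solve-∀

  ≈-+ : ∀ {m x y z w} → x ≈ y [ m ] → z ≈ w [ m ] → x + z ≈ y + w [ m ]
  ≈-+ {m} {x} {y} {z} {w} (mk p) (mk q) = mk (subst (m ∣_) (eq x y z w) (∣m∣n⇒∣m+n p q))
    where
    eq : ∀ x y z w → (x - y) + (z - w) ≡ (x + z) - (y + w)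
    eq = solve-∀

  ≈-neg : ∀ {m x y} → x ≈ y [ m ] → - x ≈ - y [ m ]
  ≈-neg {m} {x} {y} (mk p) = mk (subst (m ∣_) (eq x y) (∣m⇒∣-m p))
    where
    eq : ∀ x y → - (x - y) ≡ (- x) - (- y)
    eq = solve-∀

  ≈-- : ∀ {m x y z w} → x ≈ y [ m ] → z ≈ w [ m ] → x - z ≈ y - w [ m ]
  ≈-- p q = ≈-+ p (≈-neg q)

  ≈-* : ∀ {m x y z w} → x ≈ y [ m ] → z ≈ w [ m ] → x * z ≈ y * w [ m ]
  ≈-* {m} {x} {y} {z} {w} (mk p) (mk q) =
    mk (subst (m ∣_) (eq x y z w) (∣m∣n⇒∣m+n (∣m⇒∣m*n z p) (∣n⇒∣m*n y q)))
    where
    eq : ∀ x y z w → (x - y) * z + y * (z - w) ≡ x * z - y * w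
    eq = solve-∀

  ≈-weaken : ∀ {m n x y} → n ∣ m → x ≈ y [ m ] → x ≈ y [ n ]
  ≈-weaken p (mk q) = mk (∣-trans p q)

  ∣⇒≈0 : ∀ {m x} → m ∣ x → x ≈ 0ℤ [ m ]
  ∣⇒≈0 {m} {x} p = mk (subst (m ∣_) (sym (+-identityʳ x)) p)

  ≈0⇒∣ : ∀ {m x} → x ≈ 0ℤ [ m ] → m ∣ x
  ≈0⇒∣ {m} {x} (mk p) = subst (m ∣_) (+-identityʳ x) p

  ∣⇒∣ℕ : ∀ {m n} → + m ∣ + n → m ℕ.∣ n
  ∣⇒∣ℕ p = ∣⇒∣ᵤ p

  ∣ℕ⇒∣ : ∀ {m n} → m ℕ.∣ n → + m ∣ + n
  ∣ℕ⇒∣ p = ∣ᵤ⇒∣ p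

  ∣∧<⇒≡0 : ∀ {m n} → m ℕ.∣ n → n ℕ.< m → n ≡ 0
  ∣∧<⇒≡0 {m} {zero}  d l = refl
  ∣∧<⇒≡0 {m} {suc n} d l with () ← ℕ.<-irrefl refl (ℕ.<-≤-trans l (ℕ.∣⇒≤ d))

  private
    ≤-case : ∀ {m x y} → x ℕ.≤ y → y ℕ.< m → + y ≈ + x [ + m ] → x ≡ y
    ≤-case {m} {x} {y} x≤y y<m (mk p) with ℕ.m≤n⇒∃[o]m+o≡n x≤y
    ... | o , refl = sym (trans (cong (x ℕ.+_) (∣∧<⇒≡0 (∣⇒∣ℕ (subst (+ m ∣_) (eq (+ x) (+ o)) p)) (ℕ.≤-<-trans (ℕ.m≤n+m o x) y<m))) (ℕ.+-identityʳ x))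
      where
      eq : ∀ x o → (x + o) - x ≡ o
      eq = solve-∀

  ≈∧<⇒≡ : ∀ {m x y} → x ℕ.< m → y ℕ.< m → + x ≈ + y [ + m ] → x ≡ y
  ≈∧<⇒≡ {m} {x} {y} x<m y<m p with ℕ.≤-total x y
  ... | inj₁ x≤y = ≤-case x≤y y<m (≈-sym p)
  ... | inj₂ y≤x = sym (≤-case y≤x x<m p)

  -- The quotient of x - y by m may have either sign. A multiple of m on each side covers both cases
  -- by one equation over ℕ, which is what `modD` uses.
  ≈⇒ℕ : ∀ {m x y} → + x ≈ + y [ + m ] → ∃ λ e → ∃ λ e′ → x ℕ.+ m ℕ.* e ≡ y ℕ.+ m ℕ.* e′
  ≈⇒ℕ {m} {x} {y} (mk (divides (+ q) e)) = 0 , q , +-injective (begin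
      + (x ℕ.+ m ℕ.* 0)  ≡⟨ cong (λ z → + (x ℕ.+ z)) (ℕ.*-zeroʳ m) ⟩
      + (x ℕ.+ 0)        ≡⟨ cong +_ (ℕ.+-identityʳ x) ⟩
      + x                ≡⟨ eq (+ x) (+ y) ⟩
      + y + (+ x - + y)  ≡⟨ cong (_+_ (+ y)) e ⟩
      + y + + q * + m    ≡⟨ cong (_+_ (+ y)) (trans (*-comm (+ q) (+ m)) (sym (pos-* m q))) ⟩
      + (y ℕ.+ m ℕ.* q)  ∎)
    where
    open ≡-Reasoning
    eq : ∀ x y → x ≡ y + (x - y)
    eq = solve-∀
  ≈⇒ℕ {m} {x} {y} (mk (divides -[1+ q ] e)) = suc q , 0 , +-injective (begin
      + (x ℕ.+ m ℕ.* suc q)                ≡⟨ cong (_+_ (+ x)) (pos-* m (suc q)) ⟩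
      + x + + m * + suc q                  ≡⟨ eq (+ x) (+ y) _ ⟩
      (+ x - + y) + + m * + suc q + + y    ≡⟨ cong (λ z → z + + m * + suc q + + y) e ⟩
      -[1+ q ] * + m + + m * + suc q + + y ≡⟨ eq′ (+ suc q) (+ m) (+ y) ⟩
      + y                                  ≡⟨ cong +_ (sym (ℕ.+-identityʳ y)) ⟩
      + (y ℕ.+ 0)                          ≡⟨ cong (λ z → + (y ℕ.+ z)) (sym (ℕ.*-zeroʳ m)) ⟩
      + (y ℕ.+ m ℕ.* 0)                    ∎)
    where
    open ≡-Reasoning
    eq : ∀ x y z → x + z ≡ (x - y) + z + y
    eq = solve-∀
    eq′ : ∀ q m y → - q * m + m * q + y ≡ y
    eq′ = solve-∀

  ℕ⇒≈ : ∀ {m x y} e e′ → x ℕ.+ m ℕ.* e ≡ y ℕ.+ m ℕ.* e′ → + x ≈ + y [ + m ]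
  ℕ⇒≈ {m} {x} {y} e e′ p = mk (divides (+ e′ - + e) (begin
      + x - + y                                         ≡⟨ eq (+ x) (+ y) (+ m) (+ e) (+ e′) ⟩
      (+ x + + m * + e) - (+ y + + m * + e′) + (+ e′ - + e) * + m
        ≡⟨ cong (λ z → z - (+ y + + m * + e′) + (+ e′ - + e) * + m) p′ ⟩
      (+ y + + m * + e′) - (+ y + + m * + e′) + (+ e′ - + e) * + m
        ≡⟨ eq′ (+ y + + m * + e′) _ ⟩
      (+ e′ - + e) * + m                                ∎))
    where
    open ≡-Reasoning
    p′ : + x + + m * + e ≡ + y + + m * + e′
    p′ = trans (cong (_+_ (+ x)) (sym (pos-* m e))) (trans (cong +_ p) (cong (_+_ (+ y)) (pos-* m e′)))
    eq : ∀ x y m e e′ → x - y ≡ (x + m * e) - (y + m * e′) + (e′ - e) * m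
    eq = solve-∀
    eq′ : ∀ x z → x - x + z ≡ z
    eq′ = solve-∀

  ≡+*⇒≈ : ∀ {m x y} e → x ≡ y ℕ.+ m ℕ.* e → + x ≈ + y [ + m ]
  ≡+*⇒≈ {m} {x} e p = ℕ⇒≈ 0 e (trans (cong (x ℕ.+_) (ℕ.*-zeroʳ m)) (trans (ℕ.+-identityʳ x) p))

  %-≈ : ∀ x m .{{_ : ℕ.NonZero m}} → + x ≈ + (x ℕ.% m) [ + m ]
  %-≈ x m = ≡+*⇒≈ (x ℕ./ m) (trans (ℕ.m≡m%n+[m/n]*n x m) (cong (x ℕ.% m ℕ.+_) (ℕ.*-comm (x ℕ./ m) m)))

  ModR : Vec ℕ 3 → Set
  ModR (m ∷ x ∷ y ∷ []) = + x ≈ + y [ + m ]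

  modD : Dio ModR
  modD = mapD (λ { (m ∷ x ∷ y ∷ []) (e , e′ , p) → ℕ⇒≈ e′ e p })
              (λ { (m ∷ x ∷ y ∷ []) p → let (e , e′ , q) = ≈⇒ℕ p in e′ , e , q })
              (exD (exD (eqD (var (# 3) ⊕ var (# 2) ⊗ var (# 0)) (var (# 4) ⊕ var (# 2) ⊗ var (# 1)))))

  -- Bézout gives an inverse y of v modulo u; then e is the residue of -zy modulo u, taken so that e
  -- is natural.
  solve-linear : ∀ u v .{{_ : ℕ.NonZero u}} → C.Coprime u v → ∀ z → ∃ λ e → z + + (v ℕ.* e) ≈ 0ℤ [ + u ]
  solve-linear u v cop z = e , ≈-trans (≈-+ (≈-refl {x = z}) ve≈) (≈-reflexive (+-inverseʳ z))
    where
    inverse : Bézout.Identity 1 u v → ∃ λ y → + v * y ≈ 1ℤ [ + u ]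
    inverse (Bézout.+- x y eq) = - (+ y) , mk (divides (- (+ x)) (begin
        + v * - (+ y) - 1ℤ          ≡⟨ e₁ (+ v) (+ y) ⟩
        - (1ℤ + + y * + v)          ≡⟨ cong (λ t → - (1ℤ + t)) (sym (pos-* y v)) ⟩
        - (+ (1 ℕ.+ y ℕ.* v))       ≡⟨ cong (λ t → - (+ t)) eq ⟩
        - (+ (x ℕ.* u))             ≡⟨ cong -_ (pos-* x u) ⟩
        - (+ x * + u)               ≡⟨ neg-distribˡ-* (+ x) (+ u) ⟩
        - (+ x) * + u               ∎))
      where
      open ≡-Reasoning
      e₁ : ∀ v y → v * - y - 1ℤ ≡ - (1ℤ + y * v)
      e₁ = solve-∀
    inverse (Bézout.-+ x y eq) = + y , mk (divides (+ x) (begin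
        + v * + y - 1ℤ              ≡⟨ cong (_- 1ℤ) (trans (*-comm (+ v) (+ y)) (sym (pos-* y v))) ⟩
        + (y ℕ.* v) - 1ℤ            ≡⟨ cong (λ t → + t - 1ℤ) (sym eq) ⟩
        (1ℤ + + (x ℕ.* u)) - 1ℤ     ≡⟨ e₁ _ ⟩
        + (x ℕ.* u)                 ≡⟨ pos-* x u ⟩
        + x * + u                   ∎))
      where
      open ≡-Reasoning
      e₁ : ∀ t → (1ℤ + t) - 1ℤ ≡ t
      e₁ = solve-∀
    y = proj₁ (inverse (C.coprime-Bézout cop))
    w = - z * y
    e = w %ℕ u
    e≈ : + e ≈ w [ + u ]
    e≈ = ≈-sym (mk (divides (w /ℕ u) (trans (cong (_- + e) (a≡a%ℕn+[a/ℕn]*n w u)) (eq (+ e) _))))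
      where
      eq : ∀ e t → (e + t) - e ≡ t
      eq = solve-∀
    ve≈ : + (v ℕ.* e) ≈ - z [ + u ]
    ve≈ = ≈-trans (≈-reflexive (pos-* v e)) (≈-trans (≈-* (≈-refl {x = + v}) e≈)
          (≈-trans (≈-reflexive (eq (+ v) z y)) (≈-trans (≈-* (≈-refl {x = - z}) (proj₂ (inverse (C.coprime-Bézout cop)))) (≈-reflexive (*-identityʳ (- z))))))
      where
      eq : ∀ v z y → v * (- z * y) ≡ - z * (v * y)
      eq = solve-∀

-- Lucas sequences: Pell equation, divisibility, periodicity.

module LucasSequence where
  open Formulas
  open Congruences
  open import Data.Nat as ℕ using (ℕ; zero; suc; s≤s; z≤n; NonZero)
  import Data.Nat.Properties as ℕ
  import Data.Nat.Divisibility as ℕ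
  import Data.Nat.DivMod as ℕ
  import Data.Nat.Coprimality as C
  import Data.Nat.Tactic.RingSolver as ℕ
  open import Data.Nat.Induction using (<-wellFounded)
  open import Induction.WellFounded using (Acc; acc)
  open import Data.Integer hiding (suc; pred; NonZero)
  open import Data.Integer.Properties
  open import Data.Integer.Divisibility.Signed
  open import Data.Integer.Tactic.RingSolver using (solve-∀)
  open import Data.Fin using (zero; suc; #_)
  open import Data.Product using (∃; _×_; _,_; proj₁; proj₂)
  open import Data.Sum using (_⊎_; inj₁; inj₂)
  open import Data.Empty using (⊥-elim)
  open import Relation.Binary.Definitions using (tri<; tri≈; tri>)
  open import Relation.Binary.PropositionalEquality

  -- α c is the Lucas sequence with α(n+2) = (c+2) α(n+1) - α(n), and δ its
  -- sequence of differences; written this way no subtraction is needed.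
  α δ : ℕ → ℕ → ℕ
  α c zero    = 0
  α c (suc n) = α c n ℕ.+ δ c n
  δ c zero    = 1
  δ c (suc n) = δ c n ℕ.+ c ℕ.* α c (suc n)

  α-rec : ∀ c n → α c (2 ℕ.+ n) ℕ.+ α c n ≡ (2 ℕ.+ c) ℕ.* α c (1 ℕ.+ n)
  α-rec c n = eq c (α c n) (δ c n)
    where
    eq : ∀ c a d → ((a ℕ.+ d) ℕ.+ (d ℕ.+ c ℕ.* (a ℕ.+ d))) ℕ.+ a ≡ (2 ℕ.+ c) ℕ.* (a ℕ.+ d)
    eq = ℕ.solve-∀

  α-pell : ∀ c n → α c (suc n) ℕ.* α c (suc n) ℕ.+ α c n ℕ.* α c n
                 ≡ 1 ℕ.+ (2 ℕ.+ c) ℕ.* α c (suc n) ℕ.* α c n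
  α-pell c n = trans (eq₁ (α c n) (δ c n)) (trans (cong (ℕ._+ (2 ℕ.* α c n ℕ.* α c n ℕ.+ 2 ℕ.* α c n ℕ.* δ c n)) (δ² n)) (eq₂ c (α c n) (δ c n)))
    where
    eq₁ : ∀ a d → (a ℕ.+ d) ℕ.* (a ℕ.+ d) ℕ.+ a ℕ.* a ≡ d ℕ.* d ℕ.+ (2 ℕ.* a ℕ.* a ℕ.+ 2 ℕ.* a ℕ.* d)
    eq₁ = ℕ.solve-∀
    eq₂ : ∀ c a d → (1 ℕ.+ c ℕ.* a ℕ.* (a ℕ.+ d)) ℕ.+ (2 ℕ.* a ℕ.* a ℕ.+ 2 ℕ.* a ℕ.* d)
                  ≡ 1 ℕ.+ (2 ℕ.+ c) ℕ.* (a ℕ.+ d) ℕ.* a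
    eq₂ = ℕ.solve-∀
    eq₃ : ∀ c a d → (d ℕ.+ c ℕ.* a) ℕ.* (d ℕ.+ c ℕ.* a) ≡ d ℕ.* d ℕ.+ (2 ℕ.* c ℕ.* a ℕ.* d ℕ.+ c ℕ.* a ℕ.* (c ℕ.* a))
    eq₃ = ℕ.solve-∀
    eq₄ : ∀ c a d → (1 ℕ.+ c ℕ.* a ℕ.* (a ℕ.+ d)) ℕ.+ (2 ℕ.* c ℕ.* (a ℕ.+ d) ℕ.* d ℕ.+ c ℕ.* (a ℕ.+ d) ℕ.* (c ℕ.* (a ℕ.+ d)))
                  ≡ 1 ℕ.+ c ℕ.* (a ℕ.+ d) ℕ.* ((a ℕ.+ d) ℕ.+ (d ℕ.+ c ℕ.* (a ℕ.+ d)))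
    eq₄ = ℕ.solve-∀
    -- The same norm identity in the pair (α, δ), where it can be carried through the induction.
    δ² : ∀ n → δ c n ℕ.* δ c n ≡ 1 ℕ.+ c ℕ.* α c n ℕ.* α c (suc n)
    δ² zero    = cong (λ z → 1 ℕ.+ z ℕ.* 1) (sym (ℕ.*-zeroʳ c))
    δ² (suc n) = trans (eq₃ c (α c (suc n)) (δ c n)) (trans (cong (ℕ._+ (2 ℕ.* c ℕ.* α c (suc n) ℕ.* δ c n ℕ.+ c ℕ.* α c (suc n) ℕ.* (c ℕ.* α c (suc n)))) (δ² n)) (eq₄ c (α c n) (δ c n)))

  δ>0 : ∀ c n → 1 ℕ.≤ δ c n
  δ>0 c zero    = s≤s z≤n
  δ>0 c (suc n) = ℕ.≤-trans (δ>0 c n) (ℕ.m≤m+n _ _)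

  α<α : ∀ c n → α c n ℕ.< α c (suc n)
  α<α c n = subst (ℕ._≤ α c (suc n)) (ℕ.+-comm (α c n) 1) (ℕ.+-monoʳ-≤ (α c n) (δ>0 c n))

  α-mono : ∀ c {m n} → m ℕ.≤ n → α c m ℕ.≤ α c n
  α-mono c {m} p with ℕ.m≤n⇒∃[o]m+o≡n p
  ... | o , refl = go o
    where
    go : ∀ o → α c m ℕ.≤ α c (m ℕ.+ o)
    go zero    = ℕ.≤-reflexive (cong (α c) (sym (ℕ.+-identityʳ m)))
    go (suc o) = ℕ.≤-trans (go o) (subst (λ z → α c (m ℕ.+ o) ℕ.≤ α c z) (sym (ℕ.+-suc m o)) (ℕ.<⇒≤ (α<α c (m ℕ.+ o))))

  α-mono-< : ∀ c {m n} → m ℕ.< n → α c m ℕ.< α c n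
  α-mono-< c {m} p = ℕ.<-≤-trans (α<α c m) (α-mono c p)

  n≤α : ∀ c n → n ℕ.≤ α c n
  n≤α c zero    = z≤n
  n≤α c (suc n) = ℕ.≤-<-trans (n≤α c n) (α<α c n)

  -- For c = 0 the recurrence is α(n+2) = 2α(n+1) - α(n). Since c ≡ 0 modulo c, this will give
  -- α_c(n) ≡ n modulo c, the link between value and index.
  α0 : ∀ n → α 0 n ≡ n
  α0 zero    = refl
  α0 (suc n) = trans (cong₂ ℕ._+_ (α0 n) (δ0 n)) (ℕ.+-comm n 1)
    where
    δ0 : ∀ n → δ 0 n ≡ 1
    δ0 zero    = refl
    δ0 (suc n) = trans (ℕ.+-identityʳ _) (δ0 n)

  -- Vieta descent. With b = c + 2, the equation is quadratic in x; its other root z satisfies x + z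
  -- = by and xz = y² - 1, so (y, z) is a smaller solution, and the recurrence leads back from it to
  -- x.
  pell-descent : ∀ c x y → y ℕ.< x → x ℕ.* x ℕ.+ y ℕ.* y ≡ 1 ℕ.+ (2 ℕ.+ c) ℕ.* x ℕ.* y →
                 ∃ λ n → (x ≡ α c (suc n)) × (y ≡ α c n)
  pell-descent c x y = go x y (<-wellFounded y)
    where
    go : ∀ x y → Acc ℕ._<_ y → y ℕ.< x → x ℕ.* x ℕ.+ y ℕ.* y ≡ 1 ℕ.+ (2 ℕ.+ c) ℕ.* x ℕ.* y →
         ∃ λ n → (x ≡ α c (suc n)) × (y ≡ α c n)
    go x zero _ _ e = 0 , ℕ.m*n≡1⇒m≡1 x x (trans (sym (ℕ.+-identityʳ _)) (trans e (cong suc (ℕ.*-zeroʳ ((2 ℕ.+ c) ℕ.* x))))) , refl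
    go x@(suc _) y@(suc _) (acc rec) y<x e with ℕ.m≤n⇒∃[o]m+o≡n x≤by
      where
      x≤by : x ℕ.≤ (2 ℕ.+ c) ℕ.* y
      x≤by = ℕ.*-cancelˡ-≤ x (ℕ.+-cancelˡ-≤ 1 _ _ (begin
        1 ℕ.+ x ℕ.* x                  ≤⟨ ℕ.+-monoˡ-≤ (x ℕ.* x) (ℕ.*-mono-≤ {1} {y} {1} {y} (s≤s z≤n) (s≤s z≤n)) ⟩
        y ℕ.* y ℕ.+ x ℕ.* x            ≡⟨ ℕ.+-comm (y ℕ.* y) _ ⟩
        x ℕ.* x ℕ.+ y ℕ.* y            ≡⟨ e ⟩
        1 ℕ.+ (2 ℕ.+ c) ℕ.* x ℕ.* y    ≡⟨ cong suc (eq c x y) ⟩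
        1 ℕ.+ x ℕ.* ((2 ℕ.+ c) ℕ.* y)  ∎))
        where
        open ℕ.≤-Reasoning
        eq : ∀ c x y → (2 ℕ.+ c) ℕ.* x ℕ.* y ≡ x ℕ.* ((2 ℕ.+ c) ℕ.* y)
        eq = ℕ.solve-∀
    ... | z , by≡ = suc (proj₁ ih) , x≡ , proj₁ (proj₂ ih)
      where
      y² : y ℕ.* y ≡ 1 ℕ.+ x ℕ.* z
      y² = ℕ.+-cancelˡ-≡ (x ℕ.* x) _ _ (trans e (trans (cong suc (trans (eq c x y) (cong (x ℕ.*_) (sym by≡)))) (eq′ x z)))
        where
        eq : ∀ c x y → (2 ℕ.+ c) ℕ.* x ℕ.* y ≡ x ℕ.* ((2 ℕ.+ c) ℕ.* y)
        eq = ℕ.solve-∀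
        eq′ : ∀ x z → 1 ℕ.+ x ℕ.* (x ℕ.+ z) ≡ x ℕ.* x ℕ.+ (1 ℕ.+ x ℕ.* z)
        eq′ = ℕ.solve-∀
      z<y : z ℕ.< y
      z<y = ℕ.≰⇒> λ y≤z → ℕ.<-irrefl refl (begin-strict
        y ℕ.* y        ≤⟨ ℕ.*-mono-≤ (ℕ.<⇒≤ y<x) y≤z ⟩
        x ℕ.* z        <⟨ ℕ.n<1+n _ ⟩
        1 ℕ.+ x ℕ.* z  ≡⟨ sym y² ⟩
        y ℕ.* y        ∎)
        where open ℕ.≤-Reasoning
      e′ : y ℕ.* y ℕ.+ z ℕ.* z ≡ 1 ℕ.+ (2 ℕ.+ c) ℕ.* y ℕ.* z
      e′ = trans (cong (ℕ._+ z ℕ.* z) y²) (trans (eq x z) (cong (λ t → 1 ℕ.+ t ℕ.* z) by≡))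
        where
        eq : ∀ x z → 1 ℕ.+ x ℕ.* z ℕ.+ z ℕ.* z ≡ 1 ℕ.+ (x ℕ.+ z) ℕ.* z
        eq = ℕ.solve-∀
      ih = go y z (rec z<y) z<y e′
      x≡ : x ≡ α c (2 ℕ.+ proj₁ ih)
      x≡ = ℕ.+-cancelʳ-≡ z _ _ (trans by≡ (trans (cong ((2 ℕ.+ c) ℕ.*_) (proj₁ (proj₂ ih)))
             (trans (sym (α-rec c (proj₁ ih))) (cong (α c (2 ℕ.+ proj₁ ih) ℕ.+_) (sym (proj₂ (proj₂ ih)))))))

  pell-solution : ∀ c x y → x ℕ.* x ℕ.+ y ℕ.* y ≡ 1 ℕ.+ (2 ℕ.+ c) ℕ.* x ℕ.* y → ∃ λ n → x ≡ α c n
  pell-solution c x y e with ℕ.<-cmp y x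
  ... | tri< y<x _ _ = let (n , p , _) = pell-descent c x y y<x e in suc n , p
  ... | tri> _ _ x<y = let (n , _ , p) = pell-descent c y x x<y (trans (ℕ.+-comm (y ℕ.* y) _) (trans e (cong suc (eq c x y)))) in n , p
    where
    eq : ∀ c x y → (2 ℕ.+ c) ℕ.* x ℕ.* y ≡ (2 ℕ.+ c) ℕ.* y ℕ.* x
    eq = ℕ.solve-∀
  -- For x = y the equation would be 2x² = 1 + bx² with b ≥ 2.
  ... | tri≈ _ refl _ = ⊥-elim (ℕ.<-irrefl (trans e (eq c x)) (ℕ.m<m+n _ (s≤s z≤n)))
    where
    eq : ∀ c x → 1 ℕ.+ (2 ℕ.+ c) ℕ.* x ℕ.* x ≡ x ℕ.* x ℕ.+ x ℕ.* x ℕ.+ suc (c ℕ.* x ℕ.* x)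
    eq = ℕ.solve-∀

  A : ℕ → ℕ → ℤ
  A c n = + α c n

  B : ℕ → ℤ
  B c = + (2 ℕ.+ c)

  A-rec : ∀ c n → A c (2 ℕ.+ n) ≡ B c * A c (1 ℕ.+ n) - A c n
  A-rec c n = trans (eq (A c (2 ℕ.+ n)) (A c n)) (cong (_- A c n) (trans (cong +_ (α-rec c n)) (pos-* (2 ℕ.+ c) (α c (suc n)))))
    where
    eq : ∀ x y → x ≡ (x + y) - y
    eq = solve-∀

  Recurrent : ℤ → ℤ → (ℕ → ℤ) → Set
  Recurrent m b f = ∀ n → f (2 ℕ.+ n) ≈ b * f (1 ℕ.+ n) - f n [ m ]

  -- Every comparison of sequences goes through this: change of the parameter c, antiperiodicity
  -- modulo the trace, and the identification of powers with Lucas values.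
  recurrent-unique : ∀ {m} b f g → Recurrent m b f → Recurrent m b g →
                     f 0 ≈ g 0 [ m ] → f 1 ≈ g 1 [ m ] → ∀ n → f n ≈ g n [ m ]
  recurrent-unique b f g rf rg p q zero          = p
  recurrent-unique b f g rf rg p q (suc zero)    = q
  recurrent-unique b f g rf rg p q (suc (suc n)) =
    ≈-trans (rf n) (≈-trans (≈-- (≈-* (≈-refl {x = b}) (recurrent-unique b f g rf rg p q (suc n)))
                                 (recurrent-unique b f g rf rg p q n)) (≈-sym (rg n)))

  A-recurrent : ∀ {m} c → Recurrent m (B c) (A c)
  A-recurrent c n = ≈-reflexive (A-rec c n)

  A-≈ : ∀ {m} c c′ → + c ≈ + c′ [ m ] → ∀ n → A c n ≈ A c′ n [ m ]
  A-≈ c c′ p = recurrent-unique (B c′) (A c) (A c′)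
    (λ n → ≈-trans (A-recurrent c n) (≈-- (≈-* (≈-+ (≈-refl {x = + 2}) p) (≈-refl {x = A c (suc n)})) (≈-refl {x = A c n})))
    (A-recurrent c′) ≈-refl ≈-refl

  A-≈-index : ∀ c n → A c n ≈ + n [ + c ]
  A-≈-index c n = ≈-trans (A-≈ c 0 (∣⇒≈0 ∣-refl) n) (≈-reflexive (cong +_ (α0 n)))

  -- The corner entry of M^(n+k) = M^n M^k for the companion matrix M of the recurrence.
  A-+ : ∀ c n k → A c (n ℕ.+ suc k) ≡ A c (suc n) * A c (suc k) - A c n * A c k
  A-+ c zero    k = eq (A c (suc k)) (A c k)
    where
    eq : ∀ x y → x ≡ 1ℤ * x - 0ℤ * y
    eq = solve-∀
  A-+ c (suc n) k = begin
    A c (suc (n ℕ.+ suc k))                          ≡⟨ cong (A c) (sym (ℕ.+-suc n (suc k))) ⟩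
    A c (n ℕ.+ suc (suc k))                          ≡⟨ A-+ c n (suc k) ⟩
    A c (suc n) * A c (2 ℕ.+ k) - A c n * A c (suc k)
      ≡⟨ cong (λ t → A c (suc n) * t - A c n * A c (suc k)) (A-rec c k) ⟩
    A c (suc n) * (B c * A c (suc k) - A c k) - A c n * A c (suc k)
      ≡⟨ eq (B c) (A c n) (A c (suc n)) (A c k) (A c (suc k)) ⟩
    (B c * A c (suc n) - A c n) * A c (suc k) - A c (suc n) * A c k
      ≡⟨ cong (λ t → t * A c (suc k) - A c (suc n) * A c k) (sym (A-rec c n)) ⟩
    A c (2 ℕ.+ n) * A c (suc k) - A c (suc n) * A c k ∎
    where
    open ≡-Reasoning
    eq : ∀ b n n′ k k′ → n′ * (b * k′ - k) - n * k′ ≡ (b * n′ - n) * k′ - n′ * k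
    eq = solve-∀

  A-step : ∀ c n k → A c (n ℕ.+ suc k) ≈ - A c k * A c n [ A c (suc k) ]
  A-step c n k = mk (divides (A c (suc n)) (trans (cong (_- (- A c k * A c n)) (A-+ c n k)) (eq (A c n) (A c (suc n)) (A c k) (A c (suc k)))))
    where
    eq : ∀ n n′ k k′ → (n′ * k′ - n * k) - - k * n ≡ n′ * k′
    eq = solve-∀

  A-steps : ∀ c n k l → A c (n ℕ.+ l ℕ.* suc k) ≈ (- A c k) ^ l * A c n [ A c (suc k) ]
  A-steps c n k zero    = ≈-reflexive (trans (cong (A c) (ℕ.+-identityʳ n)) (sym (*-identityˡ (A c n))))
  A-steps c n k (suc l) =
    ≈-trans (≈-reflexive (cong (A c) (sym (ℕ.+-assoc n (suc k) (l ℕ.* suc k)))))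
    (≈-trans (A-steps c (n ℕ.+ suc k) k l)
    (≈-trans (≈-* (≈-refl {x = (- A c k) ^ l}) (A-step c n k))
    (≈-reflexive (eq ((- A c k) ^ l) (- A c k) (A c n)))))
    where
    eq : ∀ p b n → p * (b * n) ≡ b * p * n
    eq = solve-∀

  ≈-square : ∀ {m x y} → x ≈ y [ m ] → x * m ≈ y * m [ m * m ]
  ≈-square {m} {x} {y} (mk (divides q e)) = mk (divides q (trans (eq₁ x y m) (trans (cong (_* m) e) (*-assoc q m m))))
    where
    eq₁ : ∀ x y m → x * m - y * m ≡ (x - y) * m
    eq₁ = solve-∀

  -- In the addition formula one summand carries the factor α(k+1), so knowing its cofactor modulo
  -- α(k+1), from `A-steps`, determines that summand modulo the square; the other summand is the
  -- induction hypothesis.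
  A-multiple : ∀ c k l → A c (suc l ℕ.* suc k) ≈ + suc l * (- A c k) ^ l * A c (suc k) [ A c (suc k) * A c (suc k) ]
  A-multiple c k zero    = ≈-reflexive (trans (cong (A c) (ℕ.+-identityʳ (suc k))) (sym (*-identityˡ _)))
  A-multiple c k (suc l) =
    ≈-trans (≈-reflexive (trans (cong (A c) (ℕ.+-comm (suc k) (suc l ℕ.* suc k))) (A-+ c (suc l ℕ.* suc k) k)))
    (≈-trans (≈-- (≈-square (A-steps c 1 k (suc l))) (≈-* (A-multiple c k l) (≈-refl {x = A c k})))
    (≈-reflexive (eq (+ suc l) ((- A c k) ^ l) (A c k) (A c (suc k)))))
    where
    eq : ∀ l p k k′ → - k * p * 1ℤ * k′ - l * p * k′ * k ≡ (1ℤ + l) * (- k * p) * k′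
    eq = solve-∀

  α-coprime : ∀ c n → C.Coprime (α c (suc n)) (α c n)
  α-coprime c n {d} (p , q) = ℕ.∣1⇒≡1 (ℕ.∣m+n∣m⇒∣n {d} {(2 ℕ.+ c) ℕ.* α c (suc n) ℕ.* α c n} {1}
    (subst (d ℕ.∣_) (trans (α-pell c n) (ℕ.+-comm 1 _)) (ℕ.∣m∣n⇒∣m+n (ℕ.∣m⇒∣m*n _ p) (ℕ.∣m⇒∣m*n _ q)))
    (ℕ.∣n⇒∣m*n ((2 ℕ.+ c) ℕ.* α c (suc n)) q))

  cancel-power : ∀ {u v} → C.Coprime u v → ∀ l {x} → + u ∣ (- + v) ^ l * x → + u ∣ x
  cancel-power cop zero    {x} d = subst (_ ∣_) (*-identityˡ x) d
  cancel-power {u} {v} cop (suc l) {x} d = cancel-power cop l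
    (∣ᵤ⇒∣ (C.coprime-divisor cop (subst (u ℕ.∣_) eq (∣⇒∣ᵤ d))))
    where
    eq : ∣ - + v * (- + v) ^ l * x ∣ ≡ v ℕ.* ∣ (- + v) ^ l * x ∣
    eq = trans (cong ∣_∣ (*-assoc (- + v) ((- + v) ^ l) x)) (trans (abs-* (- + v) ((- + v) ^ l * x)) (cong (ℕ._* ∣ (- + v) ^ l * x ∣) (∣-i∣≡∣i∣ (+ v))))

  -- Let u = α(k+1) and m = j + l(k+1) with j ≤ k. As u divides α(m), it divides α(j) < u, so j = 0.
  -- Modulo u² the value α(m) is then l(-α(k))^(l-1) u; after cancelling u and the power, which is
  -- coprime to u, there remains u ∣ l.
  α²∣⇒∣index : ∀ c k m → α c (suc k) ℕ.* α c (suc k) ℕ.∣ α c m → α c (suc k) ℕ.∣ m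
  α²∣⇒∣index c k m d = helper l (ℕ.m≡m%n+[m/n]*n m (suc k))
    where
    u = α c (suc k)
    j = m ℕ.% suc k
    l = m ℕ./ suc k
    instance
      u≢0 : NonZero u
      u≢0 = ℕ.>-nonZero (ℕ.≤-trans (s≤s z≤n) (n≤α c (suc k)))
      u≢0ℤ : Data.Integer.NonZero (+ u)
      u≢0ℤ = ℕ.>-nonZero (ℕ.≤-trans (s≤s z≤n) (n≤α c (suc k)))
    cop = α-coprime c k
    helper : ∀ l → m ≡ j ℕ.+ l ℕ.* suc k → u ℕ.∣ m
    helper l eq = subst (u ℕ.∣_) (sym m≡) (result l (subst (λ z → u ℕ.* u ℕ.∣ α c z) m≡ d))
      where
      u∣αj : u ℕ.∣ α c j
      u∣αj = ∣⇒∣ℕ (cancel-power cop l (≈0⇒∣ (≈-trans (≈-sym (A-steps c j k l))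
               (∣⇒≈0 (∣ℕ⇒∣ (ℕ.∣-trans (ℕ.m∣m*n u) (subst (λ z → u ℕ.* u ℕ.∣ α c z) eq d)))))))
      j≡0 : j ≡ 0
      j≡0 = ℕ.n≤0⇒n≡0 (subst (j ℕ.≤_) (∣∧<⇒≡0 u∣αj (α-mono-< c (ℕ.m%n<n m (suc k)))) (n≤α c j))
      m≡ : m ≡ l ℕ.* suc k
      m≡ = trans eq (cong (ℕ._+ l ℕ.* suc k) j≡0)
      result : ∀ l → u ℕ.* u ℕ.∣ α c (l ℕ.* suc k) → u ℕ.∣ l ℕ.* suc k
      result zero    d = u ℕ.∣0
      result (suc l) d = ℕ.∣m⇒∣m*n {u} {suc l} (suc k) (∣⇒∣ℕ (cancel-power cop l {+ suc l}
        (*-cancelʳ-∣ (+ u) {+ u} {(- A c k) ^ l * + suc l} (subst (+ u * + u ∣_) (cong (_* + u) (*-comm (+ suc l) ((- A c k) ^ l)))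
          (≈0⇒∣ (≈-trans (≈-sym (A-multiple c k l)) (∣⇒≈0 (subst (_∣ A c (suc l ℕ.* suc k)) (pos-* u u) (∣ℕ⇒∣ d)))))))))

  -- Taking the factor l + 1 in `A-multiple` equal to u = α(k+1) supplies the second factor u.
  α²∣α : ∀ c k → α c (suc k) ℕ.* α c (suc k) ℕ.∣ α c (α c (suc k) ℕ.* suc k)
  α²∣α c k with α c (suc k) in e
  ... | zero  = ⊥-elim (ℕ.<⇒≱ (ℕ.≤-trans (s≤s z≤n) (n≤α c (suc k))) (ℕ.≤-reflexive e))
  ... | suc l = ∣⇒∣ℕ (≈0⇒∣ (≈-trans
      (subst (λ t → A c (suc l ℕ.* suc k) ≈ + suc l * (- A c k) ^ l * t [ + (suc l ℕ.* suc l) ]) (cong +_ e)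
        (subst (λ t → A c (suc l ℕ.* suc k) ≈ + suc l * (- A c k) ^ l * A c (suc k) [ t ])
          (trans (cong (λ t → + t * + t) e) (sym (pos-* (suc l) (suc l)))) (A-multiple c k l)))
      (∣⇒≈0 (divides ((- A c k) ^ l) (trans (eq (+ suc l) ((- A c k) ^ l)) (cong ((- A c k) ^ l *_) (sym (pos-* (suc l) (suc l)))))))))
    where
    eq : ∀ u p → u * p * u ≡ p * (u * u)
    eq = solve-∀

  -- v is the trace of ω^m, where ω² = (c+2)ω - 1, so ω^2m = vω^m - 1 is -1 modulo v.
  module Reflection (c m′ : ℕ) (v : ℤ) (v≡ : v ≡ A c (2 ℕ.+ m′) - A c m′) where
    m = suc m′

    -- Values are symmetric about m modulo v. The case i = 1 is the definition of v; afterwards the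
    -- recurrence is read forwards in i and backwards in j.
    reflect : ∀ i j → i ℕ.+ j ≡ m → A c (i ℕ.+ m) ≈ A c j [ v ]
    reflect zero          j refl = ≈-refl
    reflect (suc zero)    j refl = mk (subst (_∣ A c (2 ℕ.+ m′) - A c m′) (sym v≡) ∣-refl)
    reflect (suc (suc i)) j eq   =
      ≈-trans (A-recurrent c (i ℕ.+ m))
      (≈-trans (≈-- (≈-* (≈-refl {x = B c}) (reflect (suc i) (suc j) (trans (cong suc (ℕ.+-suc i j)) eq)))
                    (reflect i (suc (suc j)) (trans (ℕ.+-suc i (suc j)) (trans (cong suc (ℕ.+-suc i j)) eq))))
      (≈-reflexive (trans (cong (λ t → B c * A c (suc j) - t) (A-rec c j)) (eq′ (B c * A c (suc j)) (A c j)))))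
      where
      eq′ : ∀ x y → x - (x - y) ≡ y
      eq′ = solve-∀

    antiperiod : ∀ n → A c (n ℕ.+ (m ℕ.+ m)) ≈ - A c n [ v ]
    antiperiod = recurrent-unique (B c) (λ n → A c (n ℕ.+ (m ℕ.+ m))) (λ n → - A c n) (λ n → A-recurrent c (n ℕ.+ (m ℕ.+ m)))
      (λ n → ≈-reflexive (trans (cong -_ (A-rec c n)) (eq (B c) (A c (suc n)) (A c n))))
      -- The initial values: α(2m) ≡ α(0) = 0, whence α(2m+1) ≡ b·0 - α(1) = -1.
      (reflect m 0 (ℕ.+-identityʳ m))
      (≈-trans (A-recurrent c (m′ ℕ.+ m))
        (≈-trans (≈-- (≈-* (≈-refl {x = B c}) (reflect m 0 (ℕ.+-identityʳ m))) (reflect m′ 1 (ℕ.+-comm m′ 1)))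
                 (≈-reflexive (cong (_- 1ℤ) (*-zeroʳ (B c))))))
      where
      eq : ∀ b x y → - (b * x - y) ≡ b * - x - - y
      eq = solve-∀

    antiperiods : ∀ l n → (A c (n ℕ.+ l ℕ.* (m ℕ.+ m)) ≈ A c n [ v ]) ⊎ (A c (n ℕ.+ l ℕ.* (m ℕ.+ m)) ≈ - A c n [ v ])
    antiperiods zero    n = inj₁ (≈-reflexive (cong (A c) (ℕ.+-identityʳ n)))
    antiperiods (suc l) n = step (antiperiods l n)
      where
      M = m ℕ.+ m
      one-more : A c (n ℕ.+ (M ℕ.+ l ℕ.* M)) ≈ - A c (n ℕ.+ l ℕ.* M) [ v ]
      one-more = ≈-trans (≈-reflexive (cong (A c) (trans (cong (n ℕ.+_) (ℕ.+-comm M (l ℕ.* M))) (sym (ℕ.+-assoc n (l ℕ.* M) M)))))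
                         (antiperiod (n ℕ.+ l ℕ.* M))
      step : (A c (n ℕ.+ l ℕ.* M) ≈ A c n [ v ]) ⊎ (A c (n ℕ.+ l ℕ.* M) ≈ - A c n [ v ]) →
             (A c (n ℕ.+ (M ℕ.+ l ℕ.* M)) ≈ A c n [ v ]) ⊎ (A c (n ℕ.+ (M ℕ.+ l ℕ.* M)) ≈ - A c n [ v ])
      step (inj₁ p) = inj₂ (≈-trans one-more (≈-neg p))
      step (inj₂ p) = inj₁ (≈-trans one-more (≈-trans (≈-neg p) (≈-reflexive (neg-involutive (A c n)))))

    -- Let r be n modulo 2m; then j is r or 2m - r, whichever is at most m. The sign of the value
    -- depends on the parity of the quotient and the sign of the index on the reflection, so the two
    -- are independent.
    fold : ∀ n → ∃ λ j → (j ℕ.≤ m)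
         × ((A c n ≈ A c j [ v ]) ⊎ (A c n ≈ - A c j [ v ]))
         × ((+ n ≈ + j [ + m ]) ⊎ (+ n ≈ - + j [ + m ]))
    fold n with ℕ.≤-total r m
      where r = n ℕ.% (m ℕ.+ m)
    ... | inj₁ r≤m = r , r≤m , subst (λ z → (A c z ≈ A c r [ v ]) ⊎ (A c z ≈ - A c r [ v ])) (sym n≡) (antiperiods l r) , inj₁ n≈
      where
      r = n ℕ.% (m ℕ.+ m)
      l = n ℕ./ (m ℕ.+ m)
      n≡ = ℕ.m≡m%n+[m/n]*n n (m ℕ.+ m)
      n≈ : + n ≈ + r [ + m ]
      n≈ = ≡+*⇒≈ (l ℕ.* 2) (trans n≡ (cong (r ℕ.+_) (eq l m)))
        where
        eq : ∀ l m → l ℕ.* (m ℕ.+ m) ≡ m ℕ.* (l ℕ.* 2)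
        eq = ℕ.solve-∀
    ... | inj₂ m≤r with ℕ.m≤n⇒∃[o]m+o≡n m≤r | ℕ.m≤n⇒∃[o]m+o≡n (ℕ.<⇒≤ (ℕ.m%n<n n (m ℕ.+ m)))
    ... | i , m+i≡r | j , r+j≡2m = j , subst (j ℕ.≤_) i+j≡m (ℕ.m≤n+m j i) , signs (antiperiods l r) , inj₂ n≈
      where
      r = n ℕ.% (m ℕ.+ m)
      l = n ℕ./ (m ℕ.+ m)
      n≡ = ℕ.m≡m%n+[m/n]*n n (m ℕ.+ m)
      i+j≡m : i ℕ.+ j ≡ m
      i+j≡m = ℕ.+-cancelˡ-≡ m _ _ (trans (sym (ℕ.+-assoc m i j)) (trans (cong (ℕ._+ j) m+i≡r) r+j≡2m))
      Ar≈ : A c r ≈ A c j [ v ]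
      Ar≈ = ≈-trans (≈-reflexive (cong (A c) (trans (sym m+i≡r) (ℕ.+-comm m i)))) (reflect i j i+j≡m)
      signs : (A c (r ℕ.+ l ℕ.* (m ℕ.+ m)) ≈ A c r [ v ]) ⊎ (A c (r ℕ.+ l ℕ.* (m ℕ.+ m)) ≈ - A c r [ v ]) →
              (A c n ≈ A c j [ v ]) ⊎ (A c n ≈ - A c j [ v ])
      signs (inj₁ p) = inj₁ (≈-trans (≈-reflexive (cong (A c) n≡)) (≈-trans p Ar≈))
      signs (inj₂ p) = inj₂ (≈-trans (≈-reflexive (cong (A c) n≡)) (≈-trans p (≈-neg Ar≈)))
      n+j≡ : n ℕ.+ j ≡ m ℕ.* (l ℕ.* 2 ℕ.+ 2)
      n+j≡ = trans (cong (ℕ._+ j) n≡) (trans (eq₁ r (l ℕ.* (m ℕ.+ m)) j) (trans (cong (ℕ._+ l ℕ.* (m ℕ.+ m)) r+j≡2m) (eq₂ l m)))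
        where
        eq₁ : ∀ r x j → r ℕ.+ x ℕ.+ j ≡ r ℕ.+ j ℕ.+ x
        eq₁ = ℕ.solve-∀
        eq₂ : ∀ l m → m ℕ.+ m ℕ.+ l ℕ.* (m ℕ.+ m) ≡ m ℕ.* (l ℕ.* 2 ℕ.+ 2)
        eq₂ = ℕ.solve-∀
      n≈ : + n ≈ - + j [ + m ]
      n≈ = mk (∣ᵤ⇒∣ (subst (m ℕ.∣_) (trans (sym n+j≡) (cong ∣_∣ (eq (+ n) (+ j)))) (ℕ.m∣m*n _)))
        where
        eq : ∀ n j → n + j ≡ n - - j
        eq = solve-∀

-- The relation α_b(k) = a is Diophantine.

module LucasDiophantine where
  open Formulas
  open Congruences
  open LucasSequence
  open import Data.Nat as ℕ using (ℕ; zero; suc; s≤s; z≤n; NonZero)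
  import Data.Nat.Properties as ℕ
  import Data.Nat.Divisibility as ℕ
  import Data.Nat.DivMod as ℕ
  import Data.Nat.Coprimality as C
  import Data.Nat.Tactic.RingSolver as ℕ
  open import Data.Integer hiding (suc; pred; NonZero)
  open import Data.Integer.Properties
  open import Data.Integer.Divisibility.Signed
  open import Data.Integer.Tactic.RingSolver using (solve-∀)
  open import Data.Fin using (zero; suc; #_)
  open import Data.Vec using (Vec; []; _∷_; map)
  open import Data.Product using (∃; _×_; _,_)
  open import Data.Sum using (_⊎_; inj₁; inj₂)
  open import Data.Empty using (⊥; ⊥-elim)
  open import Relation.Nullary using (yes; no; ¬_)
  open import Relation.Binary.PropositionalEquality
  open import Data.Nat.Primality using (prime[2]; prime⇒irreducible)

  -- With the minus sign m divides x + y < m, so both numbers vanish. This is how the unknown signs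
  -- from `fold` are removed.
  ±-unique : ∀ {m x y} → x ℕ.+ y ℕ.< m → (+ x ≈ + y [ + m ]) ⊎ (+ x ≈ - + y [ + m ]) → x ≡ y
  ±-unique {m} {x} {y} l (inj₁ p) = ≈∧<⇒≡ (ℕ.≤-<-trans (ℕ.m≤m+n x y) l) (ℕ.≤-<-trans (ℕ.m≤n+m y x) l) p
  ±-unique {m} {x} {y} l (inj₂ (mk p)) = trans (ℕ.m+n≡0⇒m≡0 x x+y≡0) (sym (ℕ.m+n≡0⇒n≡0 x x+y≡0))
    where
    eq : ∀ x y → x - - y ≡ x + y
    eq = solve-∀
    x+y≡0 : x ℕ.+ y ≡ 0
    x+y≡0 = ∣∧<⇒≡0 (∣⇒∣ℕ (subst (+ m ∣_) (eq (+ x) (+ y)) p)) l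

  -- Matiyasevich's system for a = α_b(k), b = c + 4: its solutions have u = α_b(k′),
  -- s = α_b(m) with u ∣ m, and x = α_w(n) where w = hu + 2 is b modulo v and 2 modulo u.
  -- Thus x determines n up to sign modulo 2m through v, and x ≡ n modulo u.
  AlphaSys : (c k a u t s r e v g h x y : ℕ) → Set
  AlphaSys c k a u t s r e v g h x y =
    (u ℕ.* u ℕ.+ t ℕ.* t ≡ 1 ℕ.+ (4 ℕ.+ c) ℕ.* u ℕ.* t) × (t ℕ.< u) ×
    (s ℕ.* s ℕ.+ r ℕ.* r ≡ 1 ℕ.+ (4 ℕ.+ c) ℕ.* s ℕ.* r) × (r ℕ.< s) ×
    (s ≡ e ℕ.* (u ℕ.* u)) ×
    (v ℕ.+ (r ℕ.+ r) ≡ (4 ℕ.+ c) ℕ.* s) ×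
    ((2 ℕ.+ c) ℕ.+ v ℕ.* g ≡ h ℕ.* u) ×
    (x ℕ.* x ℕ.+ y ℕ.* y ≡ 1 ℕ.+ (2 ℕ.+ h ℕ.* u) ℕ.* x ℕ.* y) ×
    (a ℕ.+ a ℕ.< u) × (+ x ≈ + a [ + v ]) ×
    (k ℕ.+ k ℕ.< u) × (+ x ≈ + k [ + u ])

  -- Modulo v, a ≡ x ≡ α_w(n) ≡ α_b(n) ≡ ±α_b(j), and a and α_b(j) are at most s while v > 2s, so a
  -- = α_b(j). Modulo u, which divides m, k ≡ x ≡ n ≡ ±j, and j ≤ α_b(j) = a together with 2a, 2k <
  -- u gives k + j < u, so k = j.
  alpha-core : ∀ {c k a u s r e v g h x} k′ m′ n j →
    u ≡ α (2 ℕ.+ c) (suc k′) → s ≡ α (2 ℕ.+ c) (suc m′) → r ≡ α (2 ℕ.+ c) m′ → x ≡ α (h ℕ.* u) n →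
    r ℕ.< s → s ≡ e ℕ.* (u ℕ.* u) → v ℕ.+ (r ℕ.+ r) ≡ (4 ℕ.+ c) ℕ.* s → (2 ℕ.+ c) ℕ.+ v ℕ.* g ≡ h ℕ.* u →
    a ℕ.+ a ℕ.< u → + x ≈ + a [ + v ] → k ℕ.+ k ℕ.< u → + x ≈ + k [ + u ] →
    j ℕ.≤ suc m′ →
    (A (2 ℕ.+ c) n ≈ A (2 ℕ.+ c) j [ + v ]) ⊎ (A (2 ℕ.+ c) n ≈ - A (2 ℕ.+ c) j [ + v ]) →
    (+ n ≈ + j [ + suc m′ ]) ⊎ (+ n ≈ - + j [ + suc m′ ]) →
    α (2 ℕ.+ c) k ≡ a
  alpha-core {c} {k} {a} {u} {s} {r} {e} {v} {g} {h} {x} k′ m′ n j u≡α s≡α r≡α x≡α r<s s≡ v≡ C′≡ a<u x≈a k<u x≈k j≤m An≈ n≈ =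
    trans (cong (α C) k≡j) (sym a≡)
    where
    C = 2 ℕ.+ c
    u∣m : u ℕ.∣ suc m′
    u∣m = subst (ℕ._∣ suc m′) (sym u≡α) (α²∣⇒∣index C k′ (suc m′)
            (subst₂ (λ u s → u ℕ.* u ℕ.∣ s) u≡α s≡α (ℕ.divides e s≡)))
    x≈An : + x ≈ A C n [ + v ]
    x≈An = ≈-trans (≈-reflexive (cong +_ x≡α)) (A-≈ (h ℕ.* u) C (≡+*⇒≈ g (sym C′≡)) n)
    x≈n : + x ≈ + n [ + u ]
    x≈n = ≈-trans (≈-reflexive (cong +_ x≡α)) (≈-weaken (∣ℕ⇒∣ (ℕ.n∣m*n h)) (A-≈-index (h ℕ.* u) n))
    instance
      s≢0 : NonZero s
      s≢0 = ℕ.>-nonZero (ℕ.≤-<-trans z≤n r<s)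
    -- Here b ≥ 4 is used: v = bs - 2r > 4s - 2s.
    2s<v : s ℕ.+ s ℕ.< v
    2s<v = ℕ.+-cancelʳ-< (r ℕ.+ r) (s ℕ.+ s) v (begin-strict
      s ℕ.+ s ℕ.+ (r ℕ.+ r)     <⟨ ℕ.+-monoʳ-< (s ℕ.+ s) (ℕ.+-mono-< r<s r<s) ⟩
      s ℕ.+ s ℕ.+ (s ℕ.+ s)     ≤⟨ ℕ.m≤m+n _ (c ℕ.* s) ⟩
      s ℕ.+ s ℕ.+ (s ℕ.+ s) ℕ.+ c ℕ.* s ≡⟨ eq c s ⟩
      (4 ℕ.+ c) ℕ.* s           ≡⟨ sym v≡ ⟩
      v ℕ.+ (r ℕ.+ r)           ∎)
      where
      open ℕ.≤-Reasoning
      eq : ∀ c s → s ℕ.+ s ℕ.+ (s ℕ.+ s) ℕ.+ c ℕ.* s ≡ (4 ℕ.+ c) ℕ.* s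
      eq = ℕ.solve-∀
    a≤s : a ℕ.≤ s
    a≤s = ℕ.≤-trans (ℕ.m≤m+n a a) (ℕ.≤-trans (ℕ.<⇒≤ a<u) (ℕ.∣⇒≤ (ℕ.∣-trans (ℕ.m∣m*n u) (ℕ.divides e s≡))))
    a≡ : a ≡ α C j
    a≡ = ±-unique (ℕ.≤-<-trans (ℕ.+-mono-≤ a≤s (subst (α C j ℕ.≤_) (sym s≡α) (α-mono C j≤m))) 2s<v)
      (Data.Sum.map (≈-trans (≈-trans (≈-sym x≈a) x≈An)) (≈-trans (≈-trans (≈-sym x≈a) x≈An)) An≈)
    j≤a : j ℕ.≤ a
    j≤a = subst (j ℕ.≤_) (sym a≡) (n≤α C j)
    k+j<u : k ℕ.+ j ℕ.< u
    k+j<u with ℕ.≤-total k j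
    ... | inj₁ k≤j = ℕ.≤-<-trans (ℕ.+-mono-≤ (ℕ.≤-trans k≤j j≤a) j≤a) a<u
    ... | inj₂ j≤k = ℕ.≤-<-trans (ℕ.+-monoʳ-≤ k j≤k) k<u
    k≡j : k ≡ j
    k≡j = ±-unique k+j<u (Data.Sum.map lower lower n≈)
      where
      lower : ∀ {z} → + n ≈ z [ + suc m′ ] → + k ≈ z [ + u ]
      lower p = ≈-trans (≈-trans (≈-sym x≈k) x≈n) (≈-weaken (∣ℕ⇒∣ u∣m) p)

  -- The system knows only the consecutive values s and r, so the trace α(m+1) - α(m-1) enters it as
  -- bs - 2r.
  trace-α : ∀ C m′ {s r v} → s ≡ α C (suc m′) → r ≡ α C m′ → v ℕ.+ (r ℕ.+ r) ≡ (2 ℕ.+ C) ℕ.* s →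
            + v ≡ A C (2 ℕ.+ m′) - A C m′
  trace-α C m′ {s} {r} {v} s≡α r≡α v≡ =
    trans (eq (+ v) (+ r)) (trans (cong (λ t → t - + r - + r) (cong +_ v+2r≡))
    (trans (eq′ (A C (2 ℕ.+ m′)) (+ r)) (cong (λ r → A C (2 ℕ.+ m′) - + r) r≡α)))
    where
    v+2r≡ : v ℕ.+ (r ℕ.+ r) ≡ α C (2 ℕ.+ m′) ℕ.+ r
    v+2r≡ = trans v≡ (trans (cong ((2 ℕ.+ C) ℕ.*_) s≡α) (trans (sym (α-rec C m′)) (cong (α C (2 ℕ.+ m′) ℕ.+_) (sym r≡α))))
    eq : ∀ v r → v ≡ (v + (r + r)) - r - r
    eq = solve-∀
    eq′ : ∀ w r → (w + r) - r - r ≡ w - r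
    eq′ = solve-∀

  alpha-sound : ∀ c k a u t s r e v g h x y → AlphaSys c k a u t s r e v g h x y → α (2 ℕ.+ c) k ≡ a
  alpha-sound c k a u t s r e v g h x y (pu , t<u , ps , r<s , s≡ , v≡ , C′≡ , px , a<u , x≈a , k<u , x≈k) =
    with-solutions (pell-descent (2 ℕ.+ c) u t t<u pu) (pell-descent (2 ℕ.+ c) s r r<s ps) (pell-solution (h ℕ.* u) x y px)
    where
    with-solutions : (∃ λ k′ → (u ≡ α (2 ℕ.+ c) (suc k′)) × (t ≡ α (2 ℕ.+ c) k′)) →
                     (∃ λ m′ → (s ≡ α (2 ℕ.+ c) (suc m′)) × (r ≡ α (2 ℕ.+ c) m′)) →
                     (∃ λ n → x ≡ α (h ℕ.* u) n) → α (2 ℕ.+ c) k ≡ a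
    with-solutions (k′ , u≡α , _) (m′ , s≡α , r≡α) (n , x≡α) =
      let (j , j≤m , An≈ , n≈) = Reflection.fold (2 ℕ.+ c) m′ (+ v) (trace-α (2 ℕ.+ c) m′ s≡α r≡α v≡) n
      in alpha-core {e = e} {g = g} {h = h} k′ m′ n j u≡α s≡α r≡α x≡α r<s s≡ v≡ C′≡ a<u x≈a k<u x≈k j≤m An≈ n≈

  -- Two consecutive values are coprime, so at least one of them is odd.
  odd-α : ∀ c n → ∃ λ k → (n ℕ.≤ k) × ¬ (2 ℕ.∣ α c (suc k))
  odd-α c n with 2 ℕ.∣? α c (suc n)
  ... | no  odd  = n , ℕ.≤-refl , odd
  ... | yes even = suc n , ℕ.n≤1+n n , λ even′ → case-2≡1 (α-coprime c (suc n) (even′ , even))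
    where
    case-2≡1 : 2 ≡ 1 → ⊥
    case-2≡1 ()

  -- A common divisor d of u and v divides s, hence 2r; it is coprime to r because r and s are
  -- consecutive, so d ∣ 2, and u is odd.
  alpha-coprime : ∀ C k′ m′ v → ¬ (2 ℕ.∣ α C (suc k′)) → α C (suc k′) ℕ.∣ α C (suc m′) →
                  v ℕ.+ (α C m′ ℕ.+ α C m′) ≡ (2 ℕ.+ C) ℕ.* α C (suc m′) → C.Coprime (α C (suc k′)) v
  alpha-coprime C k′ m′ v odd u∣s v≡ {d} (d∣u , d∣v) = conclude (prime⇒irreducible prime[2] d∣2)
    where
    d∣s : d ℕ.∣ α C (suc m′)
    d∣s = ℕ.∣-trans d∣u u∣s
    2*r : ∀ r → r ℕ.+ r ≡ r ℕ.* 2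
    2*r = ℕ.solve-∀
    d∣2r : d ℕ.∣ α C m′ ℕ.* 2
    d∣2r = subst (d ℕ.∣_) (2*r (α C m′)) (ℕ.∣m+n∣m⇒∣n (subst (d ℕ.∣_) (sym v≡) (ℕ.∣n⇒∣m*n (2 ℕ.+ C) d∣s)) d∣v)
    d∣2 : d ℕ.∣ 2
    d∣2 = C.coprime-divisor (λ (p , q) → α-coprime C m′ (ℕ.∣-trans p d∣s , q)) d∣2r
    conclude : d ≡ 1 ⊎ d ≡ 2 → d ≡ 1
    conclude (inj₁ d≡1) = d≡1
    conclude (inj₂ d≡2) = ⊥-elim (odd (subst (ℕ._∣ α C (suc k′)) d≡2 d∣u))

  AlphaSol : (c k a : ℕ) → Set
  AlphaSol c k a = ∃ λ u → ∃ λ t → ∃ λ s → ∃ λ r → ∃ λ e → ∃ λ v → ∃ λ g → ∃ λ h → ∃ λ x → ∃ λ y →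
    AlphaSys c k a u t s r e v g h x y

  -- The index of u is taken beyond 2a + 2k, so that u exceeds 2a and 2k, and such that u is odd.
  -- Then m = u(k′+1) makes u² divide α(m), and as u and v are coprime a multiple of v can be added
  -- to c + 2 to reach a multiple hu of u.
  alpha-complete : ∀ c k → AlphaSol c k (α (2 ℕ.+ c) k)
  alpha-complete c k = choose-u (odd-α C (a ℕ.+ a ℕ.+ (k ℕ.+ k)))
    where
    C = 2 ℕ.+ c
    a = α C k
    comm : ∀ b x y → b ℕ.* x ℕ.* y ≡ b ℕ.* y ℕ.* x
    comm = ℕ.solve-∀
    swapped-pell : ∀ C′ → α C′ k ℕ.* α C′ k ℕ.+ α C′ (suc k) ℕ.* α C′ (suc k) ≡ 1 ℕ.+ (2 ℕ.+ C′) ℕ.* α C′ k ℕ.* α C′ (suc k)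
    swapped-pell C′ = trans (ℕ.+-comm (α C′ k ℕ.* α C′ k) _)
      (trans (α-pell C′ k) (cong suc (comm (2 ℕ.+ C′) (α C′ (suc k)) (α C′ k))))
    module _ (k′ : ℕ) (n≤k′ : a ℕ.+ a ℕ.+ (k ℕ.+ k) ℕ.≤ k′) (odd : ¬ (2 ℕ.∣ α C (suc k′))) where
      u = α C (suc k′)
      instance
        u≢0 : NonZero u
        u≢0 = ℕ.>-nonZero (ℕ.≤-<-trans z≤n (α<α C k′))
      finish : ∀ m′ v e g h → α C (suc m′) ≡ e ℕ.* (u ℕ.* u) →
               v ℕ.+ (α C m′ ℕ.+ α C m′) ≡ (4 ℕ.+ c) ℕ.* α C (suc m′) →
               C ℕ.+ v ℕ.* g ≡ h ℕ.* u → AlphaSol c k a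
      finish m′ v e g h s≡ v≡ C′≡ =
        u , α C k′ , α C (suc m′) , α C m′ , e , v , g , h , α (h ℕ.* u) k , α (h ℕ.* u) (suc k) ,
        α-pell C k′ , α<α C k′ , α-pell C m′ , α<α C m′ , s≡ , v≡ , C′≡ , swapped-pell (h ℕ.* u) ,
        ℕ.≤-trans (s≤s (ℕ.≤-trans (ℕ.m≤m+n (a ℕ.+ a) (k ℕ.+ k)) n≤k′)) (n≤α C (suc k′)) ,
        A-≈ (h ℕ.* u) C (≡+*⇒≈ g (sym C′≡)) k ,
        ℕ.≤-trans (s≤s (ℕ.≤-trans (ℕ.m≤n+m (k ℕ.+ k) (a ℕ.+ a)) n≤k′)) (n≤α C (suc k′)) ,
        ≈-weaken (∣ℕ⇒∣ (ℕ.n∣m*n h)) (A-≈-index (h ℕ.* u) k)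
      choose-w : ∀ m′ v → α C (suc k′) ℕ.* α C (suc k′) ℕ.∣ α C (suc m′) →
                 v ℕ.+ (α C m′ ℕ.+ α C m′) ≡ (4 ℕ.+ c) ℕ.* α C (suc m′) → AlphaSol c k a
      choose-w m′ v (ℕ.divides e s≡) v≡ =
        let u∣s = ℕ.∣-trans (ℕ.m∣m*n u) (ℕ.divides e s≡)
            (g , p) = solve-linear u v (alpha-coprime C k′ m′ v odd u∣s v≡) (+ C)
        in with-quotient g (∣⇒∣ℕ {u} {C ℕ.+ v ℕ.* g} (≈0⇒∣ p))
        where
        with-quotient : ∀ g → u ℕ.∣ C ℕ.+ v ℕ.* g → AlphaSol c k a
        with-quotient g (ℕ.divides h C′≡) = finish m′ v e g h s≡ v≡ C′≡
      choose-m : ∀ m → m ≡ u ℕ.* suc k′ → AlphaSol c k a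
      choose-m zero     eq = ⊥-elim (ℕ.≢-nonZero⁻¹ (u ℕ.* suc k′) {{ℕ.m*n≢0 u (suc k′)}} (sym eq))
      -- The trace α(m+1) - α(m-1), written as the sum of two consecutive differences.
      choose-m (suc m′) eq = choose-w m′ (δ C (suc m′) ℕ.+ δ C m′)
        (subst (λ z → u ℕ.* u ℕ.∣ α C z) (sym eq) (α²∣α C k′))
        (trans (regroup (δ C (suc m′)) (δ C m′) (α C m′)) (α-rec C m′))
        where
        regroup : ∀ d′ d a → d′ ℕ.+ d ℕ.+ (a ℕ.+ a) ≡ a ℕ.+ d ℕ.+ d′ ℕ.+ a
        regroup = ℕ.solve-∀
    choose-u : (∃ λ k′ → (a ℕ.+ a ℕ.+ (k ℕ.+ k) ℕ.≤ k′) × ¬ (2 ℕ.∣ α C (suc k′))) → AlphaSol c k a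
    choose-u (k′ , n≤k′ , odd) = choose-m k′ n≤k′ odd (α C (suc k′) ℕ.* suc k′) refl

  AlphaR : Vec ℕ 3 → Set
  AlphaR (c ∷ k ∷ a ∷ []) = α (2 ℕ.+ c) k ≡ a

  alphaD : Dio AlphaR
  alphaD = mapD
    (λ { (c ∷ k ∷ a ∷ []) (u , t , s , r , e , v , g , h , x , y , sys) → alpha-sound c k a u t s r e v g h x y sys })
    (λ { (c ∷ k ∷ a ∷ []) refl → alpha-complete c k })
    (exD (exD (exD (exD (exD (exD (exD (exD (exD (exD
      (eqD (u ⊗ u ⊕ t ⊗ t) (𝟙 ⊕ (num 4 ⊕ c) ⊗ u ⊗ t) ∧D ltD t u ∧D
       eqD (s ⊗ s ⊕ r ⊗ r) (𝟙 ⊕ (num 4 ⊕ c) ⊗ s ⊗ r) ∧D ltD r s ∧D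
       eqD s (e ⊗ (u ⊗ u)) ∧D
       eqD (v ⊕ (r ⊕ r)) ((num 4 ⊕ c) ⊗ s) ∧D
       eqD (num 2 ⊕ c ⊕ v ⊗ g) (h ⊗ u) ∧D
       eqD (x ⊗ x ⊕ y ⊗ y) (𝟙 ⊕ (num 2 ⊕ h ⊗ u) ⊗ x ⊗ y) ∧D
       ltD (a ⊕ a) u ∧D subD modD (v ∷ x ∷ a ∷ []) ∧D
       ltD (k ⊕ k) u ∧D subD modD (u ∷ x ∷ k ∷ []))))))))))))
    where
    y x h g v e r s t u c k a : Tm 13
    y = var (# 0)
    x = var (# 1)
    h = var (# 2)
    g = var (# 3)
    v = var (# 4)
    e = var (# 5)
    r = var (# 6)
    s = var (# 7)
    t = var (# 8)
    u = var (# 9)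
    c = var (# 10)
    k = var (# 11)
    a = var (# 12)

-- Exponentiation is Diophantine.

module Powers where
  open Formulas
  open Congruences
  open LucasSequence
  open LucasDiophantine
  open import Data.Nat as ℕ using (ℕ; zero; suc; s≤s; z≤n)
  import Data.Nat.Properties as ℕ
  import Data.Nat.Divisibility as ℕ
  import Data.Nat.DivMod as ℕ
  import Data.Nat.Tactic.RingSolver as ℕ
  open import Data.Integer hiding (suc; pred; NonZero)
  open import Data.Integer.Properties
  open import Data.Integer.Divisibility.Signed
  open import Data.Integer.Tactic.RingSolver using (solve-∀)
  open import Data.Fin using (zero; suc; #_)
  open import Data.Vec using (Vec; []; _∷_)
  open import Data.Product using (∃; _×_; _,_)
  open import Relation.Binary.PropositionalEquality

  α-growth : ∀ c q n → q ℕ.≤ c → q ℕ.^ n ℕ.≤ α c (suc n)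
  α-growth c q zero    q≤c = s≤s z≤n
  α-growth c q (suc n) q≤c = ℕ.≤-trans (ℕ.*-mono-≤ q≤c (α-growth c q n q≤c))
    (ℕ.≤-trans (ℕ.m≤n+m (c ℕ.* α c (suc n)) (δ c n)) (ℕ.m≤n+m (δ c (suc n)) (α c (suc n))))

  -- Since ω ↦ q is a ring map modulo m = bq - q² - 1, where b = a + q + 4, the power q^n
  -- is the image of ω^n; a will be chosen so large that q^n < m.
  module _ (q a m : ℕ) (m≡ : suc m ≡ q ℕ.* (4 ℕ.+ a)) where
    private
      c = 2 ℕ.+ (a ℕ.+ q)
      d = + (4 ℕ.+ a)
      f g : ℕ → ℤ
      f n = + (q ℕ.^ n)
      g n = A c (suc n) - d * A c n
      b≡ : B c ≡ d + + q
      b≡ = refl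
      m≡ℤ : + m ≡ + q * d - 1ℤ
      m≡ℤ = trans (eq (+ m)) (cong (_- 1ℤ) (trans (cong +_ m≡) (pos-* q (4 ℕ.+ a))))
        where
        eq : ∀ m → m ≡ (1ℤ + m) - 1ℤ
        eq = solve-∀
      f-rec : Recurrent (+ m) (B c) f
      f-rec n = mk (divides (- f n) (trans (cong₂ (λ s t → s - (B c * t - f n)) f₂ (pos-* q (q ℕ.^ n)))
          (trans (cong (λ b → + q * (+ q * f n) - (b * (+ q * f n) - f n)) b≡)
          (trans (eq (+ q) d (f n)) (cong (- f n *_) (sym m≡ℤ))))))
        where
        f₂ : f (2 ℕ.+ n) ≡ + q * (+ q * f n)
        f₂ = trans (pos-* q (q ℕ.* q ℕ.^ n)) (cong (+ q *_) (pos-* q (q ℕ.^ n)))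
        eq : ∀ q d p → q * (q * p) - ((d + q) * (q * p) - p) ≡ - p * (q * d - 1ℤ)
        eq = solve-∀
      g-rec : Recurrent (+ m) (B c) g
      g-rec n = ≈-reflexive (trans (cong₂ (λ s t → s - d * t) (A-rec c (suc n)) (A-rec c n))
                  (eq (B c) d (A c (2 ℕ.+ n)) (A c (1 ℕ.+ n)) (A c n)))
        where
        eq : ∀ b d x y z → (b * x - y) - d * (b * y - z) ≡ b * (x - d * y) - (y - d * z)
        eq = solve-∀
      f≈g : ∀ n → f n ≈ g n [ + m ]
      f≈g = recurrent-unique (B c) f g f-rec g-rec (≈-reflexive (eq₀ d)) (≈-reflexive f1≡g1)
        where
        eq₀ : ∀ d → 1ℤ ≡ 1ℤ - d * 0ℤ
        eq₀ = solve-∀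
        eq₁ : ∀ q d → q ≡ (d + q) * 1ℤ - 0ℤ - d * 1ℤ
        eq₁ = solve-∀
        f1≡g1 : f 1 ≡ g 1
        f1≡g1 = trans (cong +_ (ℕ.*-identityʳ q)) (trans (eq₁ (+ q) d) (cong (_- d * 1ℤ) (sym (A-rec c 0))))

    -- From ω^n = α(n+1) - (b - ω)α(n), the image of ω^n is α(n+1) - dα(n) with d = b - q = 4 + a.
    -- The product is moved to the left so that only sums of naturals occur.
    power-≈ : ∀ n → + (q ℕ.^ n ℕ.+ (4 ℕ.+ a) ℕ.* α c n) ≈ + α c (suc n) [ + m ]
    power-≈ n = ≈-trans (≈-+ (f≈g n) (≈-reflexive {x = + ((4 ℕ.+ a) ℕ.* α c n)} (pos-* (4 ℕ.+ a) (α c n))))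
                        (≈-reflexive (eq (A c (suc n)) (d * A c n)))
      where
      eq : ∀ x y → x - y + y ≡ x
      eq = solve-∀

    power-unique : ∀ n p → p ℕ.< m → q ℕ.^ n ℕ.< m → + (p ℕ.+ (4 ℕ.+ a) ℕ.* α c n) ≈ + α c (suc n) [ + m ] → q ℕ.^ n ≡ p
    power-unique n p p<m q<m e = ≈∧<⇒≡ q<m p<m
      (≈-trans (≈-reflexive (eq (+ (q ℕ.^ n)) z)) (≈-trans (≈-- (≈-trans (power-≈ n) (≈-sym e)) (≈-refl {x = z})) (≈-reflexive (sym (eq (+ p) z)))))
      where
      z = + ((4 ℕ.+ a) ℕ.* α c n)
      eq : ∀ x z → x ≡ x + z - z
      eq = solve-∀

  -- A lower bound for m that grows like the power is needed before powers are available; the Lucas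
  -- value a, already Diophantine, provides it by `α-growth`.
  power<m : ∀ q a m n → suc m ≡ suc q ℕ.* (4 ℕ.+ a) → a ≡ α (2 ℕ.+ q) (suc n) → suc q ℕ.^ n ℕ.< m
  power<m q a m n m≡ refl = ℕ.≤-pred (begin
    2 ℕ.+ suc q ℕ.^ n     ≤⟨ ℕ.+-monoʳ-≤ 2 (α-growth (2 ℕ.+ q) (suc q) n (ℕ.n≤1+n (suc q))) ⟩
    2 ℕ.+ a               ≤⟨ ℕ.m≤n+m (2 ℕ.+ a) 2 ⟩
    4 ℕ.+ a               ≤⟨ ℕ.m≤m+n (4 ℕ.+ a) (q ℕ.* (4 ℕ.+ a)) ⟩
    suc q ℕ.* (4 ℕ.+ a)   ≡⟨ sym m≡ ⟩
    suc m                 ∎)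
    where open ℕ.≤-Reasoning

  -- The base is shifted by one because the modulus, with m + 1 = base · (4 + a), exists only for a
  -- positive base.
  PowR : Vec ℕ 3 → Set
  PowR (q ∷ n ∷ p ∷ []) = suc q ℕ.^ n ≡ p

  powD : Dio PowR
  powD = mapD
    (λ { (q ∷ n ∷ p ∷ []) (a , x , y , m , a≡ , refl , refl , m≡ , p<m , e) →
         power-unique (suc q) a m m≡ n p p<m (power<m q a m n m≡ (sym a≡)) e })
    (λ { (q ∷ n ∷ p ∷ []) refl → complete′ q n (α (2 ℕ.+ q) (suc n)) refl })
    (exD (exD (exD (exD
      (subD alphaD (q ∷ 𝟙 ⊕ n ∷ a ∷ []) ∧D
       subD alphaD (a ⊕ (𝟙 ⊕ q) ∷ n ∷ x ∷ []) ∧D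
       subD alphaD (a ⊕ (𝟙 ⊕ q) ∷ 𝟙 ⊕ n ∷ y ∷ []) ∧D
       eqD (𝟙 ⊕ m) ((𝟙 ⊕ q) ⊗ (num 4 ⊕ a)) ∧D
       ltD p m ∧D
       subD modD (m ∷ p ⊕ (num 4 ⊕ a) ⊗ x ∷ y ∷ []))))))
    where
    m y x a q n p : Tm 7
    m = var (# 0)
    y = var (# 1)
    x = var (# 2)
    a = var (# 3)
    q = var (# 4)
    n = var (# 5)
    p = var (# 6)
    complete′ : ∀ q n a → a ≡ α (2 ℕ.+ q) (suc n) → ∃ λ a → ∃ λ x → ∃ λ y → ∃ λ m →
      (α (2 ℕ.+ q) (suc n) ≡ a) × (α (2 ℕ.+ (a ℕ.+ suc q)) n ≡ x) × (α (2 ℕ.+ (a ℕ.+ suc q)) (suc n) ≡ y) ×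
      (suc m ≡ suc q ℕ.* (4 ℕ.+ a)) × (suc q ℕ.^ n ℕ.< m) × (+ (suc q ℕ.^ n ℕ.+ (4 ℕ.+ a) ℕ.* x) ≈ + y [ + m ])
    complete′ q n a a≡ = a , _ , _ , 3 ℕ.+ a ℕ.+ q ℕ.* (4 ℕ.+ a) , sym a≡ , refl , refl , refl ,
      power<m q a _ n refl a≡ , power-≈ (suc q) a _ refl n

-- Binomial coefficients and factorials are Diophantine.

module Binomials where
  open Formulas
  open Congruences
  open Powers
  open import Data.Nat
  open import Data.Nat.Properties
  open import Data.Nat.Combinatorics using (_C_; nCk+nC[k+1]≡[n+1]C[k+1]; nCn≡1; nCk≡nC[n∸k]; k>n⇒nCk≡0)
  open import Data.Nat.Tactic.RingSolver using (solve-∀)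
  open import Data.Fin using (zero; suc; #_)
  open import Data.Vec using (Vec; []; _∷_)
  open import Data.Product using (∃; _×_; _,_)
  open import Data.Empty using (⊥-elim)
  open import Relation.Binary.Definitions using (tri<; tri≈; tri>)
  open import Relation.Binary.PropositionalEquality

  C-zero : ∀ n → n C 0 ≡ 1
  C-zero n = trans (nCk≡nC[n∸k] {n = n} z≤n) (nCn≡1 n)

  C-pascal : ∀ n k → suc n C suc k ≡ n C k + n C suc k
  C-pascal n k = sym (nCk+nC[k+1]≡[n+1]C[k+1] n k)

  C≤2^ : ∀ n k → n C k ≤ 2 ^ n
  C≤2^ n       zero    = ≤-trans (≤-reflexive (C-zero n)) (m^n>0 2 n)
  C≤2^ zero    (suc k) = ≤-trans (≤-reflexive (k>n⇒nCk≡0 {0} {suc k} (s≤s z≤n))) z≤n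
  C≤2^ (suc n) (suc k) = ≤-trans (≤-reflexive (C-pascal n k))
    (≤-trans (+-mono-≤ (C≤2^ n k) (C≤2^ n (suc k))) (≤-reflexive (cong (2 ^ n +_) (sym (+-identityʳ (2 ^ n))))))

  -- The falling factorial n(n-1)...(n-k+1).
  fall : ℕ → ℕ → ℕ
  fall n       zero    = 1
  fall zero    (suc k) = 0
  fall (suc n) (suc k) = suc n * fall n k

  -- This is fall(n, k+1) = (n - k) fall(n, k) without subtraction; for k > n both falling
  -- factorials vanish, so no case distinction is required.
  fall-rec : ∀ n k → fall n (suc k) + k * fall n k ≡ n * fall n k
  fall-rec zero    zero    = refl
  fall-rec zero    (suc k) = *-zeroʳ k
  fall-rec (suc n) zero    = +-identityʳ _
  fall-rec (suc n) (suc k) = trans (eq₁ (suc n) (fall n (suc k)) k (fall n k))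
    (trans (cong (λ t → suc n * (t + fall n k)) (fall-rec n k)) (eq₂ n (fall n k)))
    where
    eq₁ : ∀ s x k y → s * x + suc k * (s * y) ≡ s * (x + k * y + y)
    eq₁ = solve-∀
    eq₂ : ∀ n y → suc n * (n * y + y) ≡ suc n * (suc n * y)
    eq₂ = solve-∀

  C*! : ∀ n k → (n C k) * k ! ≡ fall n k
  C*! n       zero    = trans (*-identityʳ _) (C-zero n)
  C*! zero    (suc k) = cong (_* suc k !) (k>n⇒nCk≡0 {0} {suc k} (s≤s z≤n))
  C*! (suc n) (suc k) = begin
    (suc n C suc k) * (suc k * k !)                     ≡⟨ cong (_* (suc k * k !)) (C-pascal n k) ⟩
    (n C k + n C suc k) * (suc k * k !)               ≡⟨ eq₁ (n C k) (n C suc k) (suc k) (k !) ⟩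
    suc k * ((n C k) * k !) + (n C suc k) * (suc k * k !) ≡⟨ cong₂ (λ s t → suc k * s + t) (C*! n k) (C*! n (suc k)) ⟩
    suc k * fall n k + fall n (suc k)                 ≡⟨ eq₂ k (fall n k) (fall n (suc k)) ⟩
    fall n k + (fall n (suc k) + k * fall n k)        ≡⟨ cong (fall n k +_) (fall-rec n k) ⟩
    suc n * fall n k                                  ∎
    where
    open ≡-Reasoning
    eq₁ : ∀ a b s f → (a + b) * (s * f) ≡ s * (a * f) + b * (s * f)
    eq₁ = solve-∀
    eq₂ : ∀ k x y → suc k * x + y ≡ x + (y + k * x)
    eq₂ = solve-∀

  -- C(n,k) is the k-th digit of (1 + X)^n in base X = 2^n + 1; low X n k collects the digits below it.
  low : ℕ → ℕ → ℕ → ℕ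
  low X n zero    = 0
  low X n (suc k) = low X n k + (n C k) * X ^ k

  low-pascal : ∀ X n k → low X (suc n) (suc k) ≡ low X n (suc k) + X * low X n k
  low-pascal X n zero = begin
    (suc n C 0) * 1      ≡⟨ cong (_* 1) (trans (C-zero (suc n)) (sym (C-zero n))) ⟩
    (n C 0) * 1          ≡⟨ sym (+-identityʳ ((n C 0) * 1)) ⟩
    (n C 0) * 1 + 0      ≡⟨ cong ((n C 0) * 1 +_) (sym (*-zeroʳ X)) ⟩
    (n C 0) * 1 + X * 0  ∎
    where open ≡-Reasoning
  low-pascal X n (suc k) = begin
    low X (suc n) (suc k) + (suc n C suc k) * X ^ suc k
      ≡⟨ cong₂ (λ s t → s + t * X ^ suc k) (low-pascal X n k) (C-pascal n k) ⟩
    low X n (suc k) + X * low X n k + (n C k + n C suc k) * (X * X ^ k)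
      ≡⟨ eq (low X n (suc k)) X (low X n k) (n C k) (n C suc k) (X ^ k) ⟩
    low X n (suc k) + (n C suc k) * (X * X ^ k) + X * (low X n k + (n C k) * X ^ k) ∎
    where
    open ≡-Reasoning
    eq : ∀ l X m a b p → l + X * m + (a + b) * (X * p) ≡ l + b * (X * p) + X * (m + a * p)
    eq = solve-∀

  low-zero : ∀ X k → low X 0 (suc k) ≡ 1
  low-zero X zero    = cong (_* 1) (C-zero 0)
  low-zero X (suc k) = trans (cong₂ (λ s t → s + t * X ^ suc k) (low-zero X k) (k>n⇒nCk≡0 {0} {suc k} (s≤s z≤n))) refl

  binomial-expansion : ∀ X n k → ∃ λ h → suc X ^ n ≡ h * X ^ k + low X n k
  binomial-expansion X n       zero    = suc X ^ n , sym (trans (+-identityʳ _) (*-identityʳ _))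
  binomial-expansion X zero    (suc k) = 0 , sym (low-zero X k)
  binomial-expansion X (suc n) (suc k) =
    let (h , p) = binomial-expansion X n (suc k)
        (h′ , q) = binomial-expansion X n k
    in h + h′ , (begin
      suc X ^ n + X * suc X ^ n                                   ≡⟨ cong₂ (λ s t → s + X * t) p q ⟩
      h * (X * X ^ k) + low X n (suc k) + X * (h′ * X ^ k + low X n k)
        ≡⟨ eq h X (X ^ k) (low X n (suc k)) h′ (low X n k) ⟩
      (h + h′) * (X * X ^ k) + (low X n (suc k) + X * low X n k)  ≡⟨ cong ((h + h′) * (X * X ^ k) +_) (sym (low-pascal X n k)) ⟩
      (h + h′) * (X * X ^ k) + low X (suc n) (suc k)              ∎)
    where
    open ≡-Reasoning
    eq : ∀ h X p l h′ m → h * (X * p) + l + X * (h′ * p + m) ≡ (h + h′) * (X * p) + (l + X * m)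
    eq = solve-∀

  low<X^ : ∀ X n → (∀ k → n C k < X) → ∀ k → low X n k < X ^ k
  low<X^ X n C<X zero    = s≤s z≤n
  low<X^ X n C<X (suc k) = ≤-trans (+-monoˡ-≤ ((n C k) * X ^ k) (low<X^ X n C<X k)) (*-monoˡ-≤ (X ^ k) (C<X k))

  <-lexicographic : ∀ Z {a b c d} → b < Z → a < c → a * Z + b < c * Z + d
  <-lexicographic Z {a} {b} {c} {d} b<Z a<c = ≤-trans (+-monoʳ-< (a * Z) b<Z)
    (≤-trans (≤-reflexive (+-comm (a * Z) Z)) (≤-trans (*-monoˡ-≤ Z a<c) (m≤m+n (c * Z) d)))

  quotient-unique : ∀ {Z a b c d} → b < Z → d < Z → a * Z + b ≡ c * Z + d → a ≡ c
  quotient-unique {Z} {a} {b} {c} {d} b<Z d<Z e with <-cmp a c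
  ... | tri≈ _ p _ = p
  ... | tri< p _ _ = ⊥-elim (<-irrefl e (<-lexicographic Z b<Z p))
  ... | tri> _ _ p = ⊥-elim (<-irrefl (sym e) (<-lexicographic Z d<Z p))

  remainder-unique : ∀ {Z a b c d} → b < Z → d < Z → a * Z + b ≡ c * Z + d → b ≡ d
  remainder-unique {Z} {a} {b} {c} {d} p q e with refl ← quotient-unique {Z} {a} {b} {c} {d} p q e = +-cancelˡ-≡ (a * Z) _ _ e

  binomial-digit : ∀ X n k → ∃ λ h → suc X ^ n ≡ (h * X + n C k) * X ^ k + low X n k
  binomial-digit X n k = let (h , e) = binomial-expansion X n (suc k) in
    h , trans e (eq h X (X ^ k) (low X n k) (n C k))
    where
    eq : ∀ h X p l c → h * (X * p) + (l + c * p) ≡ (h * X + c) * p + l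
    eq = solve-∀

  BinR : Vec ℕ 3 → Set
  BinR (n ∷ k ∷ c ∷ []) = n C k ≡ c

  binD : Dio BinR
  binD = mapD
    (λ { (n ∷ k ∷ c ∷ []) (t , Z , P , h , l , refl , refl , refl , e , l<Z , c<X) → digit-unique n k c h l e l<Z c<X })
    (λ { (n ∷ k ∷ c ∷ []) refl → let (h , e) = binomial-digit (suc (2 ^ n)) n k in
         2 ^ n , _ , _ , h , low (suc (2 ^ n)) n k , refl , refl , refl , e , low<X^ _ n (λ k → s≤s (C≤2^ n k)) k , s≤s (C≤2^ n k) })
    (exD (exD (exD (exD (exD
      (subD powD (𝟙 ∷ n ∷ t ∷ []) ∧D
       subD powD (t ∷ k ∷ Z ∷ []) ∧D
       subD powD (𝟙 ⊕ t ∷ n ∷ P ∷ []) ∧D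
       eqD P ((h ⊗ (𝟙 ⊕ t) ⊕ c) ⊗ Z ⊕ l) ∧D ltD l Z ∧D ltD c (𝟙 ⊕ t)))))))
    where
    l h P Z t n k c : Tm 8
    l = var (# 0)
    h = var (# 1)
    P = var (# 2)
    Z = var (# 3)
    t = var (# 4)
    n = var (# 5)
    k = var (# 6)
    c = var (# 7)
    digit-unique : ∀ n k c h l → suc (suc (2 ^ n)) ^ n ≡ (h * suc (2 ^ n) + c) * suc (2 ^ n) ^ k + l →
                   l < suc (2 ^ n) ^ k → c < suc (2 ^ n) → n C k ≡ c
    digit-unique n k c h l e l<Z c<X = let (h′ , e′) = binomial-digit (suc (2 ^ n)) n k in
      remainder-unique {suc (2 ^ n)} {h′} {n C k} {h} {c} (s≤s (C≤2^ n k)) c<X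
        (quotient-unique {suc (2 ^ n) ^ k} (low<X^ _ n (λ k → s≤s (C≤2^ n k)) k) l<Z (trans (sym e′) e))

  -- k! is the integer part of r^k / C(r,k) for large r.
  fall≤^ : ∀ n k → fall n k ≤ n ^ k
  fall≤^ n       zero    = ≤-refl
  fall≤^ zero    (suc k) = z≤n
  fall≤^ (suc n) (suc k) = *-monoʳ-≤ (suc n) (≤-trans (fall≤^ n k) (^-monoˡ-≤ k (n≤1+n n)))

  -- The estimate fall(r, k) ≥ (1 - k²/r) r^k, multiplied by r.
  ^≤fall : ∀ r k → r * r ^ k ≤ r * fall r k + k * k * r ^ k
  ^≤fall r zero    = m≤m+n (r * 1) 0
  ^≤fall r (suc k) = begin
    r * (r * r ^ k)                                             ≤⟨ *-monoʳ-≤ r (^≤fall r k) ⟩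
    r * (r * fall r k + k * k * r ^ k)                          ≡⟨ cong (λ t → r * (t + k * k * r ^ k)) (sym (fall-rec r k)) ⟩
    r * (fall r (suc k) + k * fall r k + k * k * r ^ k)         ≤⟨ *-monoʳ-≤ r (+-monoˡ-≤ (k * k * r ^ k) (+-monoʳ-≤ (fall r (suc k)) (*-monoʳ-≤ k (fall≤^ r k)))) ⟩
    r * (fall r (suc k) + k * r ^ k + k * k * r ^ k)            ≤⟨ m≤m+n _ ((k + 1) * (r * r ^ k)) ⟩
    r * (fall r (suc k) + k * r ^ k + k * k * r ^ k) + (k + 1) * (r * r ^ k) ≡⟨ eq r (fall r (suc k)) k (r ^ k) ⟩
    r * fall r (suc k) + suc k * suc k * (r * r ^ k)            ∎
    where
    open ≤-Reasoning
    eq : ∀ r f k p → r * (f + k * p + k * k * p) + (k + 1) * (r * p) ≡ r * f + suc k * suc k * (r * p)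
    eq = solve-∀

  -- Otherwise, multiplying by k! gives (k! + 1) fall(r, k) ≤ k! r^k, and with `^≤fall` this forces
  -- r ≤ (k! + 1)k². As fall(r, k) = k! C(r, k), the conclusion says that the remainder of r^k is
  -- smaller than the divisor C(r, k).
  ^<fall+C : ∀ r k → suc (k !) * (k * k) < r → r ^ k < fall r k + r C k
  ^<fall+C r k G<r = ≰⇒> λ le → <⇒≱ G<r (*-cancelʳ-≤ r (suc (k !) * (k * k)) (r ^ k) {{m^n≢0 r k {{>-nonZero (≤-<-trans z≤n G<r)}} }}
    (+-cancelˡ-≤ (k ! * (r * r ^ k)) _ _ (begin
      k ! * (r * r ^ k) + r * r ^ k                        ≡⟨ +-comm (k ! * (r * r ^ k)) _ ⟩
      suc (k !) * (r * r ^ k)                              ≤⟨ *-monoʳ-≤ (suc (k !)) (^≤fall r k) ⟩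
      suc (k !) * (r * fall r k + k * k * r ^ k)           ≡⟨ eq₁ (k !) r (fall r k) (k * k) (r ^ k) ⟩
      r * (k ! * fall r k + fall r k) + suc (k !) * (k * k) * r ^ k
        ≡⟨ cong (λ t → r * (k ! * fall r k + t) + suc (k !) * (k * k) * r ^ k) (trans (sym (C*! r k)) (*-comm (r C k) (k !))) ⟩
      r * (k ! * fall r k + k ! * (r C k)) + suc (k !) * (k * k) * r ^ k
        ≡⟨ cong (_+ suc (k !) * (k * k) * r ^ k) (eq₂ r (k !) (fall r k) (r C k)) ⟩
      k ! * (r * (fall r k + r C k)) + suc (k !) * (k * k) * r ^ k
        ≤⟨ +-monoˡ-≤ (suc (k !) * (k * k) * r ^ k) (*-monoʳ-≤ (k !) (*-monoʳ-≤ r le)) ⟩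
      k ! * (r * r ^ k) + suc (k !) * (k * k) * r ^ k      ∎)))
    where
    open ≤-Reasoning
    eq₁ : ∀ f r a s p → suc f * (r * a + s * p) ≡ r * (f * a + a) + suc f * s * p
    eq₁ = solve-∀
    eq₂ : ∀ r f a c → r * (f * a + f * c) ≡ f * (r * (a + c))
    eq₂ = solve-∀

  -- How large r must be depends on k!, which is not yet Diophantine; the power (k+1)^k replaces it
  -- as an upper bound.
  !≤^ : ∀ k → k ! ≤ suc k ^ k
  !≤^ zero    = ≤-refl
  !≤^ (suc k) = *-mono-≤ (n≤1+n (suc k)) (≤-trans (!≤^ k) (^-monoˡ-≤ k (n≤1+n (suc k))))

  FacR : Vec ℕ 2 → Set
  FacR (k ∷ f ∷ []) = k ! ≡ f

  facD : Dio FacR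
  facD = mapD
    (λ { (k ∷ f ∷ []) (e , b , P , l , refl , refl , refl , P≡ , l<b) →
         let (d , ^≡ , d<C) = division k in quotient-unique d<C l<b (trans (sym ^≡) P≡) })
    (λ { (k ∷ f ∷ []) refl → let (d , ^≡ , d<C) = division k in
         suc k ^ k , _ , _ , d , refl , refl , refl , ^≡ , d<C })
    (exD (exD (exD (exD
      (subD powD (k ∷ k ∷ e ∷ []) ∧D
       subD binD (𝟙 ⊕ (𝟙 ⊕ e) ⊗ (k ⊗ k) ∷ k ∷ b ∷ []) ∧D
       subD powD ((𝟙 ⊕ e) ⊗ (k ⊗ k) ∷ k ∷ P ∷ []) ∧D
       eqD P (f ⊗ b ⊕ l) ∧D ltD l b)))))
    where
    l P b e k f : Tm 6
    l = var (# 0)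
    P = var (# 1)
    b = var (# 2)
    e = var (# 3)
    k = var (# 4)
    f = var (# 5)
    division : ∀ k → let r = suc (suc (suc k ^ k) * (k * k)) in ∃ λ d → (r ^ k ≡ k ! * (r C k) + d) × (d < r C k)
    division k = let (d , e) = m≤n⇒∃[o]m+o≡n (fall≤^ r k) in
        d , trans (sym e) (cong (_+ d) (trans (sym (C*! r k)) (*-comm (r C k) (k !)))) ,
        +-cancelˡ-< (fall r k) d (r C k) (subst (_< fall r k + r C k) (sym e) (^<fall+C r k (s≤s (*-monoˡ-≤ (k * k) (s≤s (!≤^ k))))))
      where
      r = suc (suc (suc k ^ k) * (k * k))

-- Chinese remainders and the moduli for bounded quantifiers.

module Remainders where
  open Congruences
  open Binomials
  open import Data.Nat
  open import Data.Nat.Properties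
  open import Data.Nat.Divisibility
  open import Data.Nat.DivMod using (m*[n/m]≡n)
  open import Data.Nat.Coprimality using (Coprime; coprime-divisor) renaming (sym to coprime-sym)
  open import Data.Nat.Combinatorics using (_C_)
  open import Data.Nat.Primality using (Prime; euclidsLemma; prime⇒nonTrivial)
  open import Data.Nat.Primality.Factorisation using (factorise; PrimeFactorisation)
  open import Data.Nat.Tactic.RingSolver using (solve-∀)
  open import Data.Integer using (ℤ; +_)
  import Data.Integer as ℤ
  import Data.Integer.Properties as ℤ
  import Data.Integer.Divisibility.Signed as ℤ
  import Data.Integer.Tactic.RingSolver as ℤ
  open import Data.List using ([]; _∷_)
  open import Data.List.Relation.Unary.All using (_∷_)
  open import Data.Product using (∃; _×_; _,_; proj₁; proj₂)
  open import Data.Sum using (_⊎_; inj₁; inj₂)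
  open import Data.Empty using (⊥; ⊥-elim)
  open import Relation.Nullary using (yes; no; ¬_)
  open import Relation.Binary.PropositionalEquality

  prod : (ℕ → ℕ) → ℕ → ℕ
  prod m zero    = 1
  prod m (suc n) = prod m n * m n

  PairwiseCoprime : (ℕ → ℕ) → ℕ → Set
  PairwiseCoprime m n = ∀ i j → i < j → j < n → Coprime (m i) (m j)

  coprime-* : ∀ {a b x} → Coprime a x → Coprime b x → Coprime (a * b) x
  coprime-* ca cb (d∣ab , d∣x) = cb (coprime-divisor (λ (p , q) → ca (q , ∣-trans p d∣x)) d∣ab , d∣x)

  coprime-prod : ∀ m n {x} → (∀ i → i < n → Coprime (m i) x) → Coprime (prod m n) x
  coprime-prod m zero    c (d∣1 , _) = ∣1⇒≡1 d∣1
  coprime-prod m (suc n) c = coprime-* (coprime-prod m n (λ i i<n → c i (m<n⇒m<1+n i<n))) (c n (n<1+n n))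

  ∣prod : ∀ m n i → i < n → m i ∣ prod m n
  ∣prod m (suc n) i i<1+n with m<1+n⇒m<n∨m≡n i<1+n
  ... | inj₁ i<n  = ∣m⇒∣m*n (m n) (∣prod m n i i<n)
  ... | inj₂ refl = ∣n⇒∣m*n (prod m n) ∣-refl

  coprime-∣* : ∀ {a b x} → Coprime a b → a ∣ x → b ∣ x → a * b ∣ x
  coprime-∣* {a} {b} c (divides q refl) b∣x with coprime-divisor (coprime-sym c) (subst (b ∣_) (*-comm q a) b∣x)
  ... | divides r refl = divides r (trans (*-assoc r b a) (cong (r *_) (*-comm b a)))

  prod-∣ : ∀ m n {x} → PairwiseCoprime m n → (∀ i → i < n → m i ∣ x) → prod m n ∣ x
  prod-∣ m zero    pc d = 1∣ _
  prod-∣ m (suc n) pc d = coprime-∣*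
    (coprime-prod m n (λ i i<n → pc i n i<n (n<1+n n)))
    (prod-∣ m n (λ i j i<j j<n → pc i j i<j (m<n⇒m<1+n j<n)) (λ i i<n → d i (m<n⇒m<1+n i<n)))
    (d n (n<1+n n))

  prod-≈ : ∀ m n {x y} → PairwiseCoprime m n → (∀ i → i < n → x ≈ y [ + m i ]) → x ≈ y [ + prod m n ]
  prod-≈ m n pc d = mk (ℤ.∣ᵤ⇒∣ (prod-∣ m n pc (λ i i<n → ℤ.∣⇒∣ᵤ (dvd (d i i<n)))))

  -- One modulus at a time: adding a multiple of the product of the earlier moduli preserves their
  -- congruences, and `solve-linear` finds the multiple that meets the new one.
  chinese-remainder : ∀ m n → PairwiseCoprime m n → (∀ i → i < n → NonZero (m i)) → (r : ℕ → ℕ) →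
                      ∃ λ x → ∀ i → i < n → + x ≈ + r i [ + m i ]
  chinese-remainder m zero    pc nz r = 0 , λ _ ()
  chinese-remainder m (suc n) pc nz r =
    extend (chinese-remainder m n (λ i j i<j j<n → pc i j i<j (m<n⇒m<1+n j<n)) (λ i i<n → nz i (m<n⇒m<1+n i<n)) r)
    where
    P = prod m n
    extend : (∃ λ x → ∀ i → i < n → + x ≈ + r i [ + m i ]) → ∃ λ x → ∀ i → i < suc n → + x ≈ + r i [ + m i ]
    extend (x , x≈) = correct (solve-linear (m n) P {{nz n (n<1+n n)}}
        (coprime-sym (coprime-prod m n (λ i i<n → pc i n i<n (n<1+n n)))) (+ x ℤ.- + r n))
      where
      correct : (∃ λ e → (+ x ℤ.- + r n) ℤ.+ + (P * e) ≈ ℤ.0ℤ [ + m n ]) →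
                ∃ λ x → ∀ i → i < suc n → + x ≈ + r i [ + m i ]
      correct (e , p) = x + P * e , λ i i<1+n → check i (m<1+n⇒m<n∨m≡n i<1+n)
        where
        eq : ∀ x r t → (x ℤ.- r) ℤ.+ t ≡ (x ℤ.+ t) ℤ.- r
        eq = ℤ.solve-∀
        check : ∀ i → i < n ⊎ i ≡ n → + (x + P * e) ≈ + r i [ + m i ]
        check i (inj₁ i<n) = ≈-trans (≈-+ (x≈ i i<n) (∣⇒≈0 {+ m i} {+ (P * e)} (∣ℕ⇒∣ (∣m⇒∣m*n e (∣prod m n i i<n)))))
                                     (≈-reflexive (ℤ.+-identityʳ (+ r i)))
        check i (inj₂ refl) = mk (subst (+ m i ℤ.∣_) (eq (+ x) (+ r i) (+ (P * e))) (≈0⇒∣ p))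

  ∣! : ∀ {j K} → 1 ≤ j → j ≤ K → j ∣ K !
  ∣! {suc j} _ j≤K = ∣-trans (m∣m*n (j !)) (m≤n⇒m!∣n! j≤K)

  n≤n! : ∀ n → n ≤ n !
  n≤n! zero    = z≤n
  n≤n! (suc n) = ∣⇒≤ {{suc n !≢0}} (∣! (s≤s z≤n) ≤-refl)

  -- Finite choice. The value 0 beyond n makes the result a function on ℕ, the form in which
  -- residues and sequences are coded.
  choose : ∀ {P : ℕ → ℕ → Set} n → (∀ i → i < n → ∃ (P i)) → ∃ λ (f : ℕ → ℕ) → ∀ i → i < n → P i (f i)
  choose {P} n g = f , f-ok
    where
    f : ℕ → ℕ
    f i with i <? n
    ... | yes i<n = proj₁ (g i i<n)
    ... | no  _   = 0
    f-ok : ∀ i → i < n → P i (f i)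
    f-ok i i<n with i <? n
    ... | yes p = proj₂ (g i p)
    ... | no ¬p = ⊥-elim (¬p i<n)

  uniform-bound : ∀ {P : ℕ → ℕ → Set} → (∀ {i u u′} → u ≤ u′ → P i u → P i u′) →
                  ∀ n → (∀ i → i < n → ∃ (P i)) → ∃ λ u → ∀ i → i < n → P i u
  uniform-bound mono zero    g = 0 , λ _ ()
  uniform-bound {P} mono (suc n) g =
    let (u , p) = uniform-bound {P} mono n (λ i i<n → g i (m<n⇒m<1+n i<n))
        (w , q) = g n (n<1+n n)
    in u + w , λ i i<1+n → pick u w p q i (m<1+n⇒m<n∨m≡n i<1+n)
    where
    pick : ∀ u w → (∀ i → i < n → P i u) → P n w → ∀ i → i < n ⊎ i ≡ n → P i (u + w)
    pick u w p q i (inj₁ i<n)  = mono (m≤m+n u w) (p i i<n)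
    pick u w p q i (inj₂ refl) = mono (m≤n+m w u) q

  prime-factor : ∀ n → 2 ≤ n → ∃ λ p → Prime p × p ∣ n
  prime-factor n@(suc _) 2≤n = first (factorise n)
    where
    first : PrimeFactorisation n → ∃ λ p → Prime p × p ∣ n
    first record { factors = [] ; isFactorisation = e } = ⊥-elim (<-irrefl (sym e) 2≤n)
    first record { factors = p ∷ ps ; isFactorisation = e ; factorsPrime = pp ∷ _ } = p , pp , subst (p ∣_) (sym e) (m∣m*n _)

  fall-suc : ∀ a k → + fall a (suc k) ≡ (+ a ℤ.- + k) ℤ.* + fall a k
  fall-suc a k = trans (eq₁ (+ fall a (suc k)) (+ k) (+ fall a k))
    (trans (cong (ℤ._- + k ℤ.* + fall a k) (trans (cong (λ t → + fall a (suc k) ℤ.+ t) (sym (ℤ.pos-* k (fall a k)))) (trans (cong +_ (fall-rec a k)) (ℤ.pos-* a (fall a k)))))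
    (eq₂ (+ a) (+ k) (+ fall a k)))
    where
    eq₁ : ∀ f k g → f ≡ (f ℤ.+ k ℤ.* g) ℤ.- k ℤ.* g
    eq₁ = ℤ.solve-∀
    eq₂ : ∀ a k g → a ℤ.* g ℤ.- k ℤ.* g ≡ (a ℤ.- k) ℤ.* g
    eq₂ = ℤ.solve-∀

  -- Here p must be prime: it divides one of the factors a - j. The converse `≈⇒∣fall` holds for
  -- every modulus; the pair turns "a codes a number below k" into a divisibility.
  ∣fall⇒≈ : ∀ {p} a k → Prime p → p ∣ fall a k → ∃ λ j → j < k × + a ≈ + j [ + p ]
  ∣fall⇒≈ {p} a zero    pp p∣1 with () ← subst NonTrivial (∣1⇒≡1 p∣1) (prime⇒nonTrivial pp)
  ∣fall⇒≈ {p} a (suc k) pp p∣f with euclidsLemma ℤ.∣ + a ℤ.- + k ∣ (fall a k) pp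
      (subst (p ∣_) (trans (cong ℤ.∣_∣ (fall-suc a k)) (ℤ.abs-* (+ a ℤ.- + k) (+ fall a k))) p∣f)
  ... | inj₁ p∣a-k = k , n<1+n k , mk (ℤ.∣ᵤ⇒∣ p∣a-k)
  ... | inj₂ p∣f′  = let (j , j<k , e) = ∣fall⇒≈ a k pp p∣f′ in j , m<n⇒m<1+n j<k , e

  ≈⇒∣fall : ∀ {m} a k {j} → j < k → + a ≈ + j [ + m ] → m ∣ fall a k
  ≈⇒∣fall {m} a (suc k) {j} j<1+k e = ℤ.∣⇒∣ᵤ {+ m} (subst (+ m ℤ.∣_) (sym (fall-suc a k)) (go (m<1+n⇒m<n∨m≡n j<1+k)))
    where
    go : j < k ⊎ j ≡ k → + m ℤ.∣ (+ a ℤ.- + k) ℤ.* + fall a k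
    go (inj₁ j<k)  = ℤ.∣n⇒∣m*n (+ a ℤ.- + k) (∣ℕ⇒∣ (≈⇒∣fall a k j<k e))
    go (inj₂ refl) = ℤ.∣m⇒∣m*n (+ fall a k) (dvd e)

  -- The moduli: if F = K! and q + 1 = F², then for n ≤ K the binomial
  -- coefficient C(q,n) is the product of m i = (q - i)/(i + 1) = F (F/(i+1)) - 1.
  module Moduli (K F q n : ℕ) (F≡ : F ≡ K !) (q≡ : F * F ≡ suc q) (n≤K : n ≤ K) (3≤K : 3 ≤ K) where
    m : ℕ → ℕ
    m i = pred (F * (F / suc i))

    F≢0 : NonZero F
    F≢0 = subst NonZero (sym F≡) (K !≢0)

    3≤F : 3 ≤ F
    3≤F = ≤-trans 3≤K (≤-trans (n≤n! K) (≤-reflexive (sym F≡)))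

    ∣F : ∀ {j} → 1 ≤ j → j ≤ K → j ∣ F
    ∣F 1≤j j≤K = subst (_ ∣_) (sym F≡) (∣! 1≤j j≤K)

    F/≢0 : ∀ i → i < n → NonZero (F / suc i)
    F/≢0 i i<n = ≢-nonZero λ e → ≢-nonZero⁻¹ F {{F≢0}} (trans (sym (m*[n/m]≡n (∣F (s≤s z≤n) (≤-trans i<n n≤K)))) (trans (cong (suc i *_) e) (*-zeroʳ (suc i))))

    suc-m : ∀ i → i < n → suc (m i) ≡ F * (F / suc i)
    suc-m i i<n = suc-pred _ {{m*n≢0 F (F / suc i) {{F≢0}} {{F/≢0 i i<n}} }}

    m-index : ∀ i → i < n → suc i * m i + i ≡ q
    m-index i i<n = suc-injective (begin
      suc (suc i * m i + i)       ≡⟨ eq i (m i) ⟩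
      suc i * suc (m i)           ≡⟨ cong (suc i *_) (suc-m i i<n) ⟩
      suc i * (F * (F / suc i))   ≡⟨ eq′ (suc i) F (F / suc i) ⟩
      F * (suc i * (F / suc i))   ≡⟨ cong (F *_) (m*[n/m]≡n (∣F (s≤s z≤n) (≤-trans i<n n≤K))) ⟩
      F * F                       ≡⟨ q≡ ⟩
      suc q                       ∎)
      where
      open ≡-Reasoning
      eq : ∀ i m → suc (suc i * m + i) ≡ suc i * suc m
      eq = solve-∀
      eq′ : ∀ s F g → s * (F * g) ≡ F * (s * g)
      eq′ = solve-∀

    m≥2 : ∀ i → i < n → 2 ≤ m i
    m≥2 i i<n = ≤-pred (≤-trans 3≤F (≤-trans (m≤m*n F (F / suc i) {{F/≢0 i i<n}}) (≤-reflexive (sym (suc-m i i<n)))))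

    q≈i : ∀ i → i < n → + q ≈ + i [ + m i ]
    q≈i i i<n = ≡+*⇒≈ (suc i) (trans (sym (m-index i i<n))
      (trans (+-comm (suc i * m i) i) (cong (λ t → i + t) (*-comm (suc i) (m i)))))

    -- Because m i + 1 is a multiple of F. Both pairwise coprimality and the absence of prime
    -- factors up to K come from this.
    rough : ∀ i → i < n → ∀ {d} → d ∣ m i → d ∣ F → d ≡ 1
    rough i i<n {d} d∣m d∣F = ∣1⇒≡1 (∣m+n∣m⇒∣n (subst (d ∣_) (trans (sym (suc-m i i<n)) (+-comm 1 (m i))) (∣m⇒∣m*n (F / suc i) d∣F)) d∣m)

    -- Since (i+1) m i = q - i, a common divisor of m i and m j divides j - i, which lies between 1
    -- and K and so divides F = K!.
    m-pairwise : PairwiseCoprime m n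
    m-pairwise i j i<j j<n {d} (d∣mi , d∣mj) = go (m≤n⇒∃[o]m+o≡n i<j)
      where
      go : (∃ λ o → suc i + o ≡ j) → d ≡ 1
      go (o , refl) = rough j j<n d∣mj (∣-trans d∣o (∣F (s≤s z≤n) (≤-trans (s≤s (m≤n+m o i)) (≤-trans (n≤1+n _) (≤-trans j<n n≤K)))))
        where
        eq : ∀ i o x → x + suc (i + o) ≡ x + suc o + i
        eq = solve-∀
        d∣o : d ∣ suc o
        d∣o = ∣m+n∣m⇒∣n (subst (d ∣_) (+-cancelʳ-≡ i _ _ (trans (m-index i (<-trans i<j j<n)) (trans (sym (m-index j j<n)) (eq i o (suc j * m j))))) (∣n⇒∣m*n (suc i) d∣mi)) (∣n⇒∣m*n (suc j) d∣mj)

    m-coprime-! : ∀ i → i < n → ∀ {k} → k ≤ K → Coprime (m i) (k !)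
    m-coprime-! i i<n k≤K (d∣m , d∣k!) = rough i i<n d∣m (∣-trans d∣k! (subst (_ ∣_) (sym F≡) (m≤n⇒m!∣n! k≤K)))

    -- The falling factorial of q is the product of the numbers q - i = (i+1) m i; the factors i + 1
    -- make up n!.
    C≡prod : q C n ≡ prod m n
    C≡prod = *-cancelʳ-≡ (q C n) (prod m n) (n !) {{n !≢0}} (trans (C*! q n) (trans (go n ≤-refl) (*-comm (n !) (prod m n))))
      where
      eq : ∀ s m n f → (s * m + n) * f ≡ s * m * f + n * f
      eq = solve-∀
      eq′ : ∀ s m f p → s * m * (f * p) ≡ s * f * (p * m)
      eq′ = solve-∀
      go : ∀ k → k ≤ n → fall q k ≡ k ! * prod m k
      go zero    _   = refl
      go (suc k) k<n = +-cancelʳ-≡ (k * fall q k) _ _ (begin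
        fall q (suc k) + k * fall q k                ≡⟨ fall-rec q k ⟩
        q * fall q k                                 ≡⟨ cong (_* fall q k) (sym (m-index k k<n)) ⟩
        (suc k * m k + k) * fall q k                 ≡⟨ eq (suc k) (m k) k (fall q k) ⟩
        suc k * m k * fall q k + k * fall q k        ≡⟨ cong (λ t → suc k * m k * t + k * fall q k) (go k (<⇒≤ k<n)) ⟩
        suc k * m k * (k ! * prod m k) + k * fall q k ≡⟨ cong (_+ k * fall q k) (eq′ (suc k) (m k) (k !) (prod m k)) ⟩
        suc k * k ! * (prod m k * m k) + k * fall q k ∎)
        where open ≡-Reasoning

    large-prime : ∀ i → i < n → ∃ λ p → Prime p × (p ∣ q C n) × (K < p) × (+ q ≈ + i [ + p ])
    large-prime i i<n = go (prime-factor (m i) (m≥2 i i<n))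
      where
      go : (∃ λ p → Prime p × p ∣ m i) → ∃ λ p → Prime p × (p ∣ q C n) × (K < p) × (+ q ≈ + i [ + p ])
      go (p , pp , p∣m) = p , pp , subst (p ∣_) (sym C≡prod) (∣-trans p∣m (∣prod m n i i<n)) ,
          ≰⇒> (λ p≤K → absurd pp (rough i i<n p∣m (∣F (nonTrivial⇒nz pp) p≤K))) , ≈-weaken (∣ℕ⇒∣ p∣m) (q≈i i i<n)
        where
        absurd : ∀ {p} → Prime p → p ≡ 1 → ⊥
        absurd pp refl with () ← prime⇒nonTrivial pp
        nonTrivial⇒nz : ∀ {p} → Prime p → 1 ≤ p
        nonTrivial⇒nz {suc p} _ = s≤s z≤n
        nonTrivial⇒nz {zero} pp with () ← prime⇒nonTrivial pp

-- Elimination of bounded universal quantifiers.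

module BoundedQuantifier where
  open Formulas
  open Congruences
  open Binomials
  open Remainders
  open import Data.Nat
  open import Data.Nat.Properties
  open import Data.Nat.Divisibility
  open import Data.Nat.Coprimality using (Coprime; coprime-divisor)
  open import Data.Nat.Combinatorics using (_C_)
  open import Data.Nat.Primality using (Prime)
  open import Data.Integer using (ℤ; +_)
  import Data.Integer as ℤ
  import Data.Integer.Properties as ℤ
  import Data.Integer.Divisibility.Signed as ℤ
  open import Data.Fin using (zero; suc; #_; _↑ʳ_)
  open import Data.Vec using (Vec; []; _∷_; lookup; replicate; sum)
  open import Data.Vec.Properties using (lookup-replicate; map-replicate)
  open import Data.Product using (∃; _×_; _,_; proj₁; proj₂)
  open import Relation.Binary.PropositionalEquality

  ⟦⟧-≈ : ∀ {k m} (t : Tm k) {v w} → (∀ i → + lookup v i ≈ + lookup w i [ m ]) → + ⟦ t ⟧ v ≈ + ⟦ t ⟧ w [ m ]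
  ⟦⟧-≈ (var i) e = e i
  ⟦⟧-≈ 𝟘       e = ≈-refl
  ⟦⟧-≈ 𝟙       e = ≈-refl
  ⟦⟧-≈ (s ⊕ t) e = ≈-+ (⟦⟧-≈ s e) (⟦⟧-≈ t e)
  ⟦⟧-≈ (s ⊗ t) {v} {w} e = ≈-trans (≈-reflexive (ℤ.pos-* (⟦ s ⟧ v) (⟦ t ⟧ v)))
    (≈-trans (≈-* (⟦⟧-≈ s e) (⟦⟧-≈ t e)) (≈-reflexive (sym (ℤ.pos-* (⟦ s ⟧ w) (⟦ t ⟧ w)))))

  ⟦⟧-mono : ∀ {k} (t : Tm k) {v w} → (∀ i → lookup v i ≤ lookup w i) → ⟦ t ⟧ v ≤ ⟦ t ⟧ w
  ⟦⟧-mono (var i) e = e i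
  ⟦⟧-mono 𝟘       e = ≤-refl
  ⟦⟧-mono 𝟙       e = ≤-refl
  ⟦⟧-mono (s ⊕ t) e = +-mono-≤ (⟦⟧-mono s e) (⟦⟧-mono t e)
  ⟦⟧-mono (s ⊗ t) e = *-mono-≤ (⟦⟧-mono s e) (⟦⟧-mono t e)

  diag : ∀ {k l} → Tm k → Tm l → Tm l
  diag {k} t x = subT (replicate k x) t

  ⟦diag⟧ : ∀ {k l} (t : Tm k) (x : Tm l) v → ⟦ diag t x ⟧ v ≡ ⟦ t ⟧ (replicate k (⟦ x ⟧ v))
  ⟦diag⟧ {k} t x v = trans (⟦subT⟧ (replicate k x) v t) (cong ⟦ t ⟧ (map-replicate (λ t → ⟦ t ⟧ v) x k))

  -- A polynomial in x bounding every atomic term of φ when all variables are at most x.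
  bound : ∀ {k l} → Fo k → Tm l → Tm l
  bound (s ≐ t) x = diag s x ⊕ diag t x
  bound (φ ∧ ψ) x = bound φ x ⊕ bound ψ x
  bound (ex φ)  x = bound φ x

  -- Star M u φ v interprets φ for all i below n at once: v codes one value for
  -- each modulus dividing M, and M ∣ C(a , u + 1) says that all values coded by a are ≤ u.
  Star : ∀ {k} → ℕ → ℕ → Fo k → Vec ℕ k → Set
  Star M u (s ≐ t) v = + ⟦ s ⟧ v ≈ + ⟦ t ⟧ v [ + M ]
  Star M u (φ ∧ ψ) v = Star M u φ v × Star M u ψ v
  Star M u (ex φ)  v = ∃ λ a → (+ M ℤ.∣ + (a C suc u)) × Star M u φ (a ∷ v)

  StarR : ∀ {k} → Fo k → Vec ℕ (2 + k) → Set
  StarR φ (M ∷ u ∷ v) = Star M u φ v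

  divBinD : ∀ {k} (M a b : Tm k) → Dio (λ v → + ⟦ M ⟧ v ℤ.∣ + (⟦ a ⟧ v C ⟦ b ⟧ v))
  divBinD M a b = mapD
    (λ v (c , c≡ , e) → ≈0⇒∣ (subst₂ (λ m z → + z ≈ ℤ.0ℤ [ + m ]) (⟦wk⟧ M) (trans (sym c≡) (cong₂ _C_ (⟦wk⟧ a) (⟦wk⟧ b))) e))
    (λ v d → ⟦ a ⟧ v C ⟦ b ⟧ v , cong₂ _C_ (⟦wk⟧ a) (⟦wk⟧ b) , subst (λ m → + (⟦ a ⟧ v C ⟦ b ⟧ v) ≈ ℤ.0ℤ [ + m ]) (sym (⟦wk⟧ M)) (∣⇒≈0 d))
    (exD (subD binD (renT suc a ∷ renT suc b ∷ var zero ∷ []) ∧D subD modD (renT suc M ∷ var zero ∷ 𝟘 ∷ [])))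

  starD : ∀ {k} (φ : Fo k) → Dio (StarR φ)
  starD {k} (s ≐ t) = mapD
    (λ { (M ∷ u ∷ v) e → subst₂ (λ x y → + x ≈ + y [ + M ]) (wk v s) (wk v t) e })
    (λ { (M ∷ u ∷ v) e → subst₂ (λ x y → + x ≈ + y [ + M ]) (sym (wk v s)) (sym (wk v t)) e })
    (subD modD (var zero ∷ renT (2 ↑ʳ_) s ∷ renT (2 ↑ʳ_) t ∷ []))
    where
    wk : ∀ v t {x y} → ⟦ renT (2 ↑ʳ_) t ⟧ (x ∷ y ∷ v) ≡ ⟦ t ⟧ v
    wk v t = ⟦renT⟧ (2 ↑ʳ_) (λ _ → refl) t
  starD (φ ∧ ψ) = mapD (λ { (M ∷ u ∷ v) p → p }) (λ { (M ∷ u ∷ v) p → p }) (starD φ ∧D starD ψ)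
  starD {k} (ex φ) = mapD
    (λ { (M ∷ u ∷ v) (a , d , p) → a , d , subst (λ v → Star M u φ (a ∷ v)) (rest v) p })
    (λ { (M ∷ u ∷ v) (a , d , p) → a , d , subst (λ v → Star M u φ (a ∷ v)) (sym (rest v)) p })
    (exD (divBinD (var (# 1)) (var (# 0)) (𝟙 ⊕ var (# 2)) ∧D
          subD (starD φ) (var (# 1) ∷ var (# 2) ∷ var (# 0) ∷ vars (3 ↑ʳ_))))
    where
    rest : ∀ v {x y z} → evals (vars (3 ↑ʳ_)) (x ∷ y ∷ z ∷ v) ≡ v
    rest v = evals-vars (3 ↑ʳ_) v (λ _ → refl)

  bd : ∀ {k} → Fo k → ℕ → ℕ
  bd {k} (s ≐ t) u = ⟦ s ⟧ (replicate k u) + ⟦ t ⟧ (replicate k u)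
  bd (φ ∧ ψ) u = bd φ u + bd ψ u
  bd (ex φ)  u = bd φ u

  ⟦bound⟧ : ∀ {k l} (φ : Fo k) (x : Tm l) v → ⟦ bound φ x ⟧ v ≡ bd φ (⟦ x ⟧ v)
  ⟦bound⟧ (s ≐ t) x v = cong₂ _+_ (⟦diag⟧ s x v) (⟦diag⟧ t x v)
  ⟦bound⟧ (φ ∧ ψ) x v = cong₂ _+_ (⟦bound⟧ φ x v) (⟦bound⟧ ψ x v)
  ⟦bound⟧ (ex φ)  x v = ⟦bound⟧ φ x v

  -- Modulo p the codes v are the true values z, all at most u. Both sides of an equation are at
  -- most `bd φ u`, which is below p, so congruence is equality. A coded witness decodes to some j ≤
  -- u because p divides a falling factorial.
  star-sound : ∀ {k} (φ : Fo k) {p M u} → Prime p → p ∣ M → bd φ u < p →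
               ∀ v z → (∀ i → + lookup v i ≈ + lookup z i [ + p ]) → (∀ i → lookup z i ≤ u) →
               Star M u φ v → z ⊨ φ
  star-sound {k} (s ≐ t) {p} {M} {u} pp p∣M bd<p v z v≈z z≤u e = ≈∧<⇒≡
      (≤-<-trans (≤-trans (small s) (m≤m+n _ _)) bd<p) (≤-<-trans (≤-trans (small t) (m≤n+m _ _)) bd<p)
      (≈-trans (≈-sym (⟦⟧-≈ s v≈z)) (≈-trans (≈-weaken (∣ℕ⇒∣ p∣M) e) (⟦⟧-≈ t v≈z)))
    where
    small : ∀ t → ⟦ t ⟧ z ≤ ⟦ t ⟧ (replicate k u)
    small t = ⟦⟧-mono t (λ i → ≤-trans (z≤u i) (≤-reflexive (sym (lookup-replicate i u))))
  star-sound (φ ∧ ψ) {u = u} pp p∣M bd<p v z v≈z z≤u (a , b) =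
    star-sound φ pp p∣M (≤-<-trans (m≤m+n (bd φ u) (bd ψ u)) bd<p) v z v≈z z≤u a ,
    star-sound ψ pp p∣M (≤-<-trans (m≤n+m (bd ψ u) (bd φ u)) bd<p) v z v≈z z≤u b
  star-sound (ex φ) {p} {M} {u} pp p∣M bd<p v z v≈z z≤u (a , M∣C , st) =
    let (j , j<1+u , a≈j) = ∣fall⇒≈ a (suc u) pp (subst (p ∣_) (C*! a (suc u)) (∣m⇒∣m*n (suc u !) (∣-trans p∣M (∣⇒∣ℕ M∣C))))
    in j , star-sound φ pp p∣M bd<p (a ∷ v) (j ∷ z)
             (λ { zero → a≈j ; (suc i) → v≈z i }) (λ { zero → ≤-pred j<1+u ; (suc i) → z≤u i }) st

  -- Satisfaction with all witnesses at most u. It is monotone in u, so the finitely many instances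
  -- i < n share one bound.
  _⊨[_]_ : ∀ {k} → Vec ℕ k → ℕ → Fo k → Set
  v ⊨[ u ] (s ≐ t) = ⟦ s ⟧ v ≡ ⟦ t ⟧ v
  v ⊨[ u ] (φ ∧ ψ) = (v ⊨[ u ] φ) × (v ⊨[ u ] ψ)
  v ⊨[ u ] (ex φ)  = ∃ λ x → x ≤ u × ((x ∷ v) ⊨[ u ] φ)

  ⊨[]-mono : ∀ {k} (φ : Fo k) {v u u′} → u ≤ u′ → v ⊨[ u ] φ → v ⊨[ u′ ] φ
  ⊨[]-mono (s ≐ t) u≤u′ p           = p
  ⊨[]-mono (φ ∧ ψ) u≤u′ (p , q)     = ⊨[]-mono φ u≤u′ p , ⊨[]-mono ψ u≤u′ q
  ⊨[]-mono (ex φ)  u≤u′ (x , l , p) = x , ≤-trans l u≤u′ , ⊨[]-mono φ u≤u′ p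

  ⊨⇒⊨[] : ∀ {k} (φ : Fo k) {v} → v ⊨ φ → ∃ λ u → v ⊨[ u ] φ
  ⊨⇒⊨[] (s ≐ t) p = 0 , p
  ⊨⇒⊨[] (φ ∧ ψ) (p , q) = let (u , p′) = ⊨⇒⊨[] φ p ; (w , q′) = ⊨⇒⊨[] ψ q in
    u + w , ⊨[]-mono φ (m≤m+n u w) p′ , ⊨[]-mono ψ (m≤n+m w u) q′
  ⊨⇒⊨[] (ex φ) (x , p) = let (u , p′) = ⊨⇒⊨[] φ p in u + x , x , m≤n+m x u , ⊨[]-mono φ (m≤m+n u x) p′

  -- Each quantifier is coded by Chinese remainders. Coprimality of m i and (u+1)! passes from m i ∣
  -- fall(a, u+1) to m i ∣ C(a, u+1), and divisibility by every m i gives divisibility by the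
  -- product.
  star-complete : ∀ {k} (φ : Fo k) m n u → PairwiseCoprime m n → (∀ i → i < n → NonZero (m i)) →
                  (∀ i → i < n → Coprime (m i) (suc u !)) →
                  ∀ v (z : ℕ → Vec ℕ k) → (∀ i → i < n → ∀ l → + lookup v l ≈ + lookup (z i) l [ + m i ]) →
                  (∀ i → i < n → z i ⊨[ u ] φ) → Star (prod m n) u φ v
  star-complete (s ≐ t) m n u pc nz cop v z v≈z p = prod-≈ m n pc λ i i<n →
    ≈-trans (⟦⟧-≈ s (v≈z i i<n)) (≈-trans (≈-reflexive (cong +_ (p i i<n))) (≈-sym (⟦⟧-≈ t (v≈z i i<n))))
  star-complete (φ ∧ ψ) m n u pc nz cop v z v≈z p =
    star-complete φ m n u pc nz cop v z v≈z (λ i i<n → proj₁ (p i i<n)) ,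
    star-complete ψ m n u pc nz cop v z v≈z (λ i i<n → proj₂ (p i i<n))
  star-complete (ex φ) m n u pc nz cop v z v≈z p = code (choose n p)
    where
    code : (∃ λ f → ∀ i → i < n → f i ≤ u × ((f i ∷ z i) ⊨[ u ] φ)) → Star (prod m n) u (ex φ) v
    code (f , f-ok) = with-code (chinese-remainder m n pc nz f)
      where
      with-code : (∃ λ a → ∀ i → i < n → + a ≈ + f i [ + m i ]) → Star (prod m n) u (ex φ) v
      with-code (a , a≈) = a , ∣ℕ⇒∣ (prod-∣ m n pc small) ,
          star-complete φ m n u pc nz cop (a ∷ v) (λ i → f i ∷ z i)
            (λ { i i<n zero → a≈ i i<n ; i i<n (suc l) → v≈z i i<n l }) (λ i i<n → proj₂ (f-ok i i<n))
        where
        small : ∀ i → i < n → m i ∣ a C suc u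
        small i i<n = coprime-divisor (cop i i<n) (subst (m i ∣_) (trans (sym (C*! a (suc u))) (*-comm (a C suc u) (suc u !)))
          (≈⇒∣fall a (suc u) (s≤s (proj₁ (f-ok i i<n))) (a≈ i i<n)))

  sumT : ∀ {k l} → Vec (Tm l) k → Tm l
  sumT []      = 𝟘
  sumT (t ∷ σ) = t ⊕ sumT σ

  ⟦sumT⟧ : ∀ {k l} (σ : Vec (Tm l) k) v → ⟦ sumT σ ⟧ v ≡ sum (evals σ v)
  ⟦sumT⟧ []      v = refl
  ⟦sumT⟧ (t ∷ σ) v = cong (λ s → ⟦ t ⟧ v + s) (⟦sumT⟧ σ v)

  lookup≤sum : ∀ {k} (v : Vec ℕ k) i → lookup v i ≤ sum v
  lookup≤sum (x ∷ v) zero    = m≤m+n x (sum v)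
  lookup≤sum (x ∷ v) (suc i) = ≤-trans (lookup≤sum v i) (m≤n+m (sum v) x)

  -- u bounds the index and all parameters. K = 3 + u + `bd φ u` serves four purposes: K ≥ 3 makes
  -- every modulus at least 2, K ≥ u ≥ n makes i + 1 divide K!, K ≥ u + 1 makes the moduli coprime
  -- to (u+1)!, and primes above K exceed `bd φ u`.
  BallSys : ∀ {k} → Fo (suc k) → (n : ℕ) → Vec ℕ k → (u F q M : ℕ) → Set
  BallSys φ n v u F q M = (n + sum v ≤ u) × ((3 + (u + bd φ u)) ! ≡ F) × (F * F ≡ suc q) × (q C n ≡ M) × Star M u φ (q ∷ v)

  ball-sound : ∀ {k} (φ : Fo (suc k)) n v u F q M → BallSys φ n v u F q M → ∀ i → i < n → (i ∷ v) ⊨ φ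
  ball-sound φ n v u F q M (n≤u , refl , q≡ , refl , st) i i<n = go (large-prime i i<n)
    where
    open Moduli (3 + (u + bd φ u)) F q n refl q≡
      (≤-trans (≤-trans (m≤m+n n (sum v)) n≤u) (≤-trans (m≤m+n u (bd φ u)) (m≤n+m (u + bd φ u) 3)))
      (m≤m+n 3 (u + bd φ u)) using (large-prime)
    go : (∃ λ p → Prime p × (p ∣ q C n) × (3 + (u + bd φ u) < p) × (+ q ≈ + i [ + p ])) → (i ∷ v) ⊨ φ
    go (p , pp , p∣C , K<p , q≈i) = star-sound φ pp p∣C
      (≤-<-trans (≤-trans (m≤n+m (bd φ u) u) (m≤n+m (u + bd φ u) 3)) K<p) (q ∷ v) (i ∷ v)
      -- q is the code of the index i itself; the parameters do not vary with i and are their own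
      -- codes.
      (λ { zero → q≈i ; (suc _) → ≈-refl })
      (λ { zero → ≤-trans (<⇒≤ i<n) (≤-trans (m≤m+n n (sum v)) n≤u)
         ; (suc l) → ≤-trans (lookup≤sum v l) (≤-trans (m≤n+m (sum v) n) n≤u) }) st

  ball-complete : ∀ {k} (φ : Fo (suc k)) n v → (∀ i → i < n → (i ∷ v) ⊨ φ) →
                  ∃ λ u → ∃ λ F → ∃ λ q → ∃ λ M → BallSys φ n v u F q M
  ball-complete φ n v p = with-bound (uniform-bound (⊨[]-mono φ) n (λ i i<n → ⊨⇒⊨[] φ (p i i<n)))
    where
    with-bound : (∃ λ w → ∀ i → i < n → (i ∷ v) ⊨[ w ] φ) → ∃ λ u → ∃ λ F → ∃ λ q → ∃ λ M → BallSys φ n v u F q M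
    with-bound (w , p′) = u , K ! , pred (K ! * K !) , _ , m≤m+n (n + sum v) w , refl , q≡ , refl ,
        with-moduli (K !) (pred (K ! * K !)) refl q≡
      where
      u = n + sum v + w
      K = 3 + (u + bd φ u)
      q≡ : K ! * K ! ≡ suc (pred (K ! * K !))
      q≡ = sym (suc-pred (K ! * K !) {{m*n≢0 (K !) (K !) {{K !≢0}} {{K !≢0}} }})
      with-moduli : ∀ F q → F ≡ K ! → F * F ≡ suc q → Star (q C n) u φ (q ∷ v)
      with-moduli F q F≡ q≡ = subst (λ M → Star M u φ (q ∷ v)) (sym C≡prod)
        (star-complete φ m n u m-pairwise (λ i i<n → >-nonZero (≤-trans (s≤s z≤n) (m≥2 i i<n)))
          (λ i i<n → m-coprime-! i i<n (s≤s (≤-trans (m≤m+n u (bd φ u)) (m≤n+m (u + bd φ u) 2))))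
          (q ∷ v) (λ i → i ∷ v) (λ { i i<n zero → q≈i i i<n ; i i<n (suc l) → ≈-refl })
          (λ i i<n → ⊨[]-mono φ (m≤n+m w (n + sum v)) (p′ i i<n)))
        where
        open Moduli K F q n F≡ q≡
          (≤-trans (≤-trans (m≤m+n n (sum v)) (m≤m+n (n + sum v) w)) (≤-trans (m≤m+n u (bd φ u)) (m≤n+m (u + bd φ u) 3)))
          (m≤m+n 3 (u + bd φ u))

  BallR : ∀ {k} → (Vec ℕ (suc k) → Set) → Vec ℕ (suc k) → Set
  BallR R (n ∷ v) = ∀ i → i < n → R (i ∷ v)

  ballD : ∀ {k} {R : Vec ℕ (suc k) → Set} → Dio R → Dio (BallR R)
  ballD {k} {R} d = mapD
    (λ { (n ∷ v) (u , F , q , M , n≤u , F≡ , q≡ , M≡ , st) i i<n → sound d (i ∷ v)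
         (ball-sound φ n v u F q M (subst (λ s → n + s ≤ u) (sums v) n≤u , trans (cong (λ b → (3 + (u + b)) !) (sym (bounds v))) F≡ , q≡ , M≡ ,
            subst (λ v → Star M u φ (q ∷ v)) (rest v) st) i i<n) })
    (λ { (n ∷ v) p → let (u , F , q , M , n≤u , F≡ , q≡ , M≡ , st) = ball-complete φ n v (λ i i<n → complete d (i ∷ v) (p i i<n)) in
         u , F , q , M , subst (λ s → n + s ≤ u) (sym (sums v)) n≤u , trans (cong (λ b → (3 + (u + b)) !) (bounds v)) F≡ , q≡ , M≡ ,
            subst (λ v → Star M u φ (q ∷ v)) (sym (rest v)) st })
    (exD (exD (exD (exD
      (leD (var (# 4) ⊕ sumT others) u ∧D
       subD facD (num 3 ⊕ (u ⊕ bound φ u) ∷ F ∷ []) ∧D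
       eqD (F ⊗ F) (𝟙 ⊕ q) ∧D
       subD binD (q ∷ var (# 4) ∷ M ∷ []) ∧D
       subD (starD φ) (M ∷ u ∷ q ∷ others))))))
    where
    φ = fo d
    M q F u : Tm (5 + k)
    M = var (# 0)
    q = var (# 1)
    F = var (# 2)
    u = var (# 3)
    others : Vec (Tm (5 + k)) k
    others = vars (5 ↑ʳ_)
    rest : ∀ v {a b c d e} → evals others (a ∷ b ∷ c ∷ d ∷ e ∷ v) ≡ v
    rest v = evals-vars (5 ↑ʳ_) v (λ _ → refl)
    sums : ∀ v {a b c d e} → ⟦ sumT others ⟧ (a ∷ b ∷ c ∷ d ∷ e ∷ v) ≡ sum v
    sums v = trans (⟦sumT⟧ others _) (cong sum (rest v))
    bounds : ∀ v {a b c d e} → ⟦ bound φ u ⟧ (a ∷ b ∷ c ∷ d ∷ e ∷ v) ≡ bd φ d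
    bounds v = ⟦bound⟧ φ u _

-- Graphs of partial recursive functions are Diophantine.

module RecursiveFunctions where
  open import Defs
  open Formulas
  open Congruences
  open Remainders
  open Binomials
  open BoundedQuantifier
  open import Data.Nat
  open import Data.Nat.Properties
  open import Data.Nat.Divisibility
  open import Data.Nat.DivMod using (_%_; _/_; m≡m%n+[m/n]*n; m%n<n)
  open import Data.Nat.Coprimality using (coprime-divisor)
  open import Data.Nat.Tactic.RingSolver using (solve-∀)
  open import Data.Integer using (+_)
  open import Data.Fin using (zero; suc; #_; _↑ʳ_; _↑ˡ_)
  open import Data.Vec using (Vec; []; _∷_; map; _++_)
  open import Data.Vec.Properties using (lookup-++ˡ; lookup-++ʳ)
  open import Data.Product using (∃; _×_; _,_; proj₂)
  open import Data.Sum using (inj₁; inj₂)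
  open import Function using (id)
  open import Relation.Binary.Definitions using (tri<; tri≈; tri>)
  open import Relation.Binary.PropositionalEquality

  mutual
    ⇓-det : ∀ {k} (c : PR k) {xs y y′} → c ⟨ xs ⟩⇓ y → c ⟨ xs ⟩⇓ y′ → y ≡ y′
    ⇓-det Zr         ev-Z       ev-Z       = refl
    ⇓-det Sc         ev-S       ev-S       = refl
    ⇓-det (Pj i)     ev-P       ev-P       = refl
    ⇓-det (Cmp g hs) (ev-C d e) (ev-C d′ e′) with refl ← ⇓*-det hs d d′ = ⇓-det g e e′
    ⇓-det (Rec f g)  (ev-R0 d)  (ev-R0 d′) = ⇓-det f d d′
    ⇓-det (Rec f g)  (ev-RS d e) (ev-RS d′ e′) with refl ← ⇓-det (Rec f g) d d′ = ⇓-det g e e′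
    ⇓-det (Mu g) {y = y} {y′} (ev-M d p) (ev-M d′ p′) with <-cmp y y′
    ... | tri≈ _ y≡y′ _ = y≡y′
    ... | tri< y<y′ _ _ with () ← ⇓-det g d (proj₂ (p′ y y<y′))
    ... | tri> _ _ y′<y with () ← ⇓-det g d′ (proj₂ (p y′ y′<y))

    ⇓*-det : ∀ {k l} (hs : Vec (PR k) l) {xs ys ys′} → hs ⟨ xs ⟩⇓* ys → hs ⟨ xs ⟩⇓* ys′ → ys ≡ ys′
    ⇓*-det []       ev-[]      ev-[]        = refl
    ⇓*-det (h ∷ hs) (ev-∷ d e) (ev-∷ d′ e′) = cong₂ _∷_ (⇓-det h d d′) (⇓*-det hs e e′)

  -- Gödel's β function: x is the remainder of a modulo 1 + (i+1)b.
  BetaR : Vec ℕ 4 → Set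
  BetaR (a ∷ b ∷ i ∷ x ∷ []) = ∃ λ q → (a ≡ q * suc (suc i * b) + x) × (x < suc (suc i * b))

  betaD : Dio BetaR
  betaD = mapD (λ { (a ∷ b ∷ i ∷ x ∷ []) p → p }) (λ { (a ∷ b ∷ i ∷ x ∷ []) p → p })
    (exD (eqD a (q ⊗ m ⊕ x) ∧D ltD x m))
    where
    q a b i x m : Tm 5
    q = var (# 0)
    a = var (# 1)
    b = var (# 2)
    i = var (# 3)
    x = var (# 4)
    m = 𝟙 ⊕ (𝟙 ⊕ i) ⊗ b

  β-functional : ∀ {a b i x x′} → BetaR (a ∷ b ∷ i ∷ x ∷ []) → BetaR (a ∷ b ∷ i ∷ x′ ∷ []) → x ≡ x′
  β-functional {b = b} {i} (q , e , l) (q′ , e′ , l′) =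
    remainder-unique {suc (suc i * b)} {q} {_} {q′} l l′ (trans (sym e) e′)

  -- With b = n!·u, where u bounds the sequence, every modulus exceeds u. A common divisor of two
  -- moduli is coprime to b and divides (j - i)b, so it divides j - i, hence n!, hence b, and is 1.
  β-exists : ∀ (s : ℕ → ℕ) n → ∃ λ a → ∃ λ b → ∀ i → i < n → BetaR (a ∷ b ∷ i ∷ s i ∷ [])
  β-exists s n = with-bound (uniform-bound {λ i u → s i ≤ u} (λ l p → ≤-trans p l) n (λ i _ → s i , ≤-refl))
    where
    with-bound : (∃ λ u → ∀ i → i < n → s i ≤ u) → ∃ λ a → ∃ λ b → ∀ i → i < n → BetaR (a ∷ b ∷ i ∷ s i ∷ [])
    with-bound (u , s≤u) = code (chinese-remainder m n pairwise (λ _ _ → _) s)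
      where
      b = n ! * u
      m : ℕ → ℕ
      m i = suc (suc i * b)
      s<m : ∀ i → i < n → s i < m i
      s<m i i<n = s≤s (≤-trans (s≤u i i<n) (≤-trans (m≤n*m u (n !) {{n !≢0}}) (m≤m+n b (i * b))))
      pairwise : PairwiseCoprime m n
      pairwise i j i<j j<n {d} (d∣mi , d∣mj) = go (m≤n⇒∃[o]m+o≡n i<j)
        where
        unit : ∀ {e} → e ∣ d → e ∣ b → e ≡ 1
        unit {e} e∣d e∣b = ∣1⇒≡1 (∣m+n∣m⇒∣n (subst (e ∣_) (+-comm 1 (suc i * b)) (∣-trans e∣d d∣mi)) (∣n⇒∣m*n (suc i) e∣b))
        eq : ∀ i o b → suc (suc (suc i + o) * b) ≡ suc (suc i * b) + b * suc o
        eq = solve-∀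
        go : (∃ λ o → suc i + o ≡ j) → d ≡ 1
        go (o , refl) = unit ∣-refl (∣-trans d∣o (∣m⇒∣m*n u (∣! (s≤s z≤n) (≤-trans (s≤s (m≤n+m o i)) (≤-trans (n≤1+n _) j<n)))))
          where
          d∣o : d ∣ suc o
          d∣o = coprime-divisor (λ (p , q) → unit p q) (∣m+n∣m⇒∣n (subst (d ∣_) (eq i o b) d∣mj) d∣mi)
      code : (∃ λ a → ∀ i → i < n → + a ≈ + s i [ + m i ]) → ∃ λ a → ∃ λ b → ∀ i → i < n → BetaR (a ∷ b ∷ i ∷ s i ∷ [])
      code (a , a≈) = a , b , λ i i<n → a / m i , decompose i i<n , s<m i i<n
        where
        decompose : ∀ i → i < n → a ≡ a / m i * m i + s i
        decompose i i<n = trans (m≡m%n+[m/n]*n a (m i)) (trans (+-comm (a % m i) _)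
          (cong (λ t → a / m i * m i + t) (≈∧<⇒≡ (m%n<n a (m i)) (s<m i i<n) (≈-trans (≈-sym (%-≈ a (m i))) (a≈ i i<n)))))

  GraphR : ∀ {k} → PR k → Vec ℕ (suc k) → Set
  GraphR c (y ∷ xs) = c ⟨ xs ⟩⇓ y

  module _ {k : ℕ} (f : PR k) (g : PR (2 + k)) where
    StepR : Vec ℕ (3 + k) → Set
    StepR (i ∷ a ∷ b ∷ xs) = ∃ λ r → ∃ λ r′ →
      BetaR (a ∷ b ∷ i ∷ r ∷ []) × BetaR (a ∷ b ∷ suc i ∷ r′ ∷ []) × (g ⟨ i ∷ r ∷ xs ⟩⇓ r′)

    RecR : ℕ → ℕ → Vec ℕ k → Set
    RecR y n xs = ∃ λ a → ∃ λ b → ∃ λ r →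
      BetaR (a ∷ b ∷ 0 ∷ r ∷ []) × (f ⟨ xs ⟩⇓ r) × (∀ i → i < n → StepR (i ∷ a ∷ b ∷ xs)) × BetaR (a ∷ b ∷ n ∷ y ∷ [])

    rec-sound : ∀ {y n xs} → RecR y n xs → Rec f g ⟨ n ∷ xs ⟩⇓ y
    rec-sound {y} {n} {xs} (a , b , r , β₀ , ev₀ , step , βₙ) = go n ≤-refl βₙ
      where
      go : ∀ i → i ≤ n → ∀ {r} → BetaR (a ∷ b ∷ i ∷ r ∷ []) → Rec f g ⟨ i ∷ xs ⟩⇓ r
      go zero    _   β with refl ← β-functional {a} {b} {0} β β₀ = ev-R0 ev₀
      go (suc i) i<n β with step i i<n
      ... | r , r′ , βᵢ , βᵢ′ , ev with refl ← β-functional {a} {b} {suc i} β βᵢ′ = ev-RS (go i (<⇒≤ i<n) βᵢ) ev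

    -- As f and g may be partial, the intermediate values are extracted from the derivation for n.
    earlier : ∀ {n xs y} → Rec f g ⟨ n ∷ xs ⟩⇓ y → ∀ i → i < suc n → ∃ λ r → Rec f g ⟨ i ∷ xs ⟩⇓ r
    earlier {n} d i i<1+n with m<1+n⇒m<n∨m≡n i<1+n
    ... | inj₂ refl = _ , d
    earlier (ev-RS d e) i i<1+n | inj₁ i<n = earlier d i i<n

    rec-complete : ∀ {y n xs} → Rec f g ⟨ n ∷ xs ⟩⇓ y → RecR y n xs
    rec-complete {y} {n} {xs} d = with-sequence (choose (suc n) (earlier d))
      where
      with-sequence : (∃ λ (s : ℕ → ℕ) → ∀ i → i < suc n → Rec f g ⟨ i ∷ xs ⟩⇓ s i) → RecR y n xs
      with-sequence (s , ev) = with-code (β-exists s (suc n))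
        where
        with-code : (∃ λ a → ∃ λ b → ∀ i → i < suc n → BetaR (a ∷ b ∷ i ∷ s i ∷ [])) → RecR y n xs
        with-code (a , b , β) = a , b , s 0 , β 0 (s≤s z≤n) , base (ev 0 (s≤s z≤n)) ,
            (λ i i<n → s i , s (suc i) , β i (m<n⇒m<1+n i<n) , β (suc i) (s≤s i<n) , step i (ev i (m<n⇒m<1+n i<n)) (ev (suc i) (s≤s i<n))) ,
            subst (λ z → BetaR (a ∷ b ∷ n ∷ z ∷ [])) (⇓-det (Rec f g) (ev n ≤-refl) d) (β n ≤-refl)
          where
          base : ∀ {r} → Rec f g ⟨ 0 ∷ xs ⟩⇓ r → f ⟨ xs ⟩⇓ r
          base (ev-R0 d) = d
          step : ∀ i {r r′} → Rec f g ⟨ i ∷ xs ⟩⇓ r → Rec f g ⟨ suc i ∷ xs ⟩⇓ r′ → g ⟨ i ∷ r ∷ xs ⟩⇓ r′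
          step i d (ev-RS d′ e) with refl ← ⇓-det (Rec f g) d d′ = e

  recD : ∀ {k} (f : PR k) (g : PR (2 + k)) → Dio (GraphR f) → Dio (GraphR g) → Dio (GraphR (Rec f g))
  recD {k} f g df dg = mapD
    (λ { (y ∷ n ∷ xs) (a , b , r , β₀ , ev₀ , steps , βₙ) → rec-sound f g
         (a , b , r , β₀ , subst (f ⟨_⟩⇓ r) (rest xs) ev₀ , (λ i i<n → subst (λ xs → StepR f g (i ∷ a ∷ b ∷ xs)) (rest xs) (steps i i<n)) , βₙ) })
    (λ { (y ∷ n ∷ xs) d → unpack y n xs (rec-complete f g d) })
    (exD (exD (exD
      (subD betaD (a ∷ b ∷ 𝟘 ∷ r ∷ []) ∧D
       subD df (r ∷ vars (5 ↑ʳ_)) ∧D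
       subD (ballD stepD) (n ∷ a ∷ b ∷ vars (5 ↑ʳ_)) ∧D
       subD betaD (a ∷ b ∷ n ∷ y ∷ [])))))
    where
    r b a y n : Tm (5 + k)
    r = var (# 0)
    b = var (# 1)
    a = var (# 2)
    y = var (# 3)
    n = var (# 4)
    rest : ∀ (xs : Vec ℕ k) {a b c d e} → evals (vars (5 ↑ʳ_)) (a ∷ b ∷ c ∷ d ∷ e ∷ xs) ≡ xs
    rest xs = evals-vars (5 ↑ʳ_) xs (λ _ → refl)
    unpack : ∀ y n xs → RecR f g y n xs → ∃ λ a → ∃ λ b → ∃ λ r →
      BetaR (a ∷ b ∷ 0 ∷ r ∷ []) × (f ⟨ evals (vars (5 ↑ʳ_)) (r ∷ b ∷ a ∷ y ∷ n ∷ xs) ⟩⇓ r) ×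
      (∀ i → i < n → StepR f g (i ∷ a ∷ b ∷ evals (vars (5 ↑ʳ_)) (r ∷ b ∷ a ∷ y ∷ n ∷ xs))) × BetaR (a ∷ b ∷ n ∷ y ∷ [])
    unpack y n xs (a , b , r , β₀ , ev₀ , steps , βₙ) =
      a , b , r , β₀ , subst (f ⟨_⟩⇓ r) (sym (rest xs)) ev₀ ,
      (λ i i<n → subst (λ xs → StepR f g (i ∷ a ∷ b ∷ xs)) (sym (rest xs)) (steps i i<n)) , βₙ
    stepD : Dio (StepR f g)
    stepD = mapD
      (λ { (i ∷ a ∷ b ∷ xs) (r , r′ , β , β′ , ev) → r , r′ , β , β′ , subst (λ xs → g ⟨ i ∷ r ∷ xs ⟩⇓ r′) (rest xs) ev })
      (λ { (i ∷ a ∷ b ∷ xs) (r , r′ , β , β′ , ev) → r , r′ , β , β′ , subst (λ xs → g ⟨ i ∷ r ∷ xs ⟩⇓ r′) (sym (rest xs)) ev })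
      (exD (exD
        (subD betaD (var (# 3) ∷ var (# 4) ∷ var (# 2) ∷ var (# 1) ∷ []) ∧D
         subD betaD (var (# 3) ∷ var (# 4) ∷ 𝟙 ⊕ var (# 2) ∷ var (# 0) ∷ []) ∧D
         subD dg (var (# 0) ∷ var (# 2) ∷ var (# 1) ∷ vars (5 ↑ʳ_)))))

  muD : ∀ {k} (g : PR (suc k)) → Dio (GraphR g) → Dio (GraphR (Mu g))
  muD {k} g dg = mapD
    (λ { (y ∷ xs) (ev , below) → ev-M (subst (g ⟨_⟩⇓ 0) (evals-vars id (y ∷ xs) (λ _ → refl)) ev) below })
    (λ { (y ∷ xs) (ev-M ev below) → subst (g ⟨_⟩⇓ 0) (sym (evals-vars id (y ∷ xs) (λ _ → refl))) ev , below })
    (subD dg (𝟘 ∷ vars id) ∧D ballD positiveD)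
    where
    PositiveR : Vec ℕ (suc k) → Set
    PositiveR zs = ∃ λ v → g ⟨ zs ⟩⇓ suc v
    positiveD : Dio PositiveR
    positiveD = mapD
      (λ zs (v , ev) → v , subst (g ⟨_⟩⇓ suc v) (evals-vars suc zs (λ _ → refl)) ev)
      (λ zs (v , ev) → v , subst (g ⟨_⟩⇓ suc v) (sym (evals-vars suc zs (λ _ → refl))) ev)
      (exD (subD dg (𝟙 ⊕ var zero ∷ vars suc)))

  mutual
    graphD : ∀ {k} (c : PR k) → Dio (GraphR c)
    graphD Zr        = mapD (λ { (y ∷ xs) refl → ev-Z }) (λ { (y ∷ xs) ev-Z → refl }) (eqD (var zero) 𝟘)
    graphD Sc        = mapD (λ { (y ∷ x ∷ []) refl → ev-S }) (λ { (y ∷ x ∷ []) ev-S → refl }) (eqD (var zero) (𝟙 ⊕ var (# 1)))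
    graphD (Pj i)    = mapD (λ { (y ∷ xs) refl → ev-P }) (λ { (y ∷ xs) ev-P → refl }) (eqD (var zero) (var (suc i)))
    graphD (Rec f g) = recD f g (graphD f) (graphD g)
    graphD (Mu g)    = muD g (graphD g)
    graphD {k} (Cmp {l = l} g hs) = mapD
      (λ { (y ∷ xs) (ys , evs , ev) → ev-C (subst (hs ⟨_⟩⇓* ys) (inputs xs) evs) (subst (GraphR g) (outputs ys y xs) ev) })
      (λ { (y ∷ xs) (ev-C {ys = ys} evs ev) → ys , subst (hs ⟨_⟩⇓* ys) (sym (inputs xs)) evs , subst (GraphR g) (sym (outputs ys y xs)) ev })
      (graphsD hs (vars suc) (subD (graphD g) (var (l ↑ʳ zero) ∷ vars (_↑ˡ suc k))))
      where
      inputs : ∀ xs {y} → evals (vars suc) (y ∷ xs) ≡ xs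
      inputs xs = evals-vars suc xs (λ _ → refl)
      outputs : ∀ (ys : Vec ℕ l) y (xs : Vec ℕ k) → evals (var (l ↑ʳ zero) ∷ vars (_↑ˡ suc k)) (ys ++ y ∷ xs) ≡ y ∷ ys
      outputs ys y xs = cong₂ _∷_ (lookup-++ʳ ys (y ∷ xs) zero) (evals-vars (_↑ˡ suc k) ys (lookup-++ˡ ys (y ∷ xs)))

    -- The intermediate values are quantified one at a time in front of v; σ locates the inputs in v
    -- and is weakened past the values already bound.
    graphsD : ∀ {k l j} (hs : Vec (PR k) l) (σ : Vec (Tm j) k) {R : Vec ℕ (l + j) → Set} → Dio R →
              Dio (λ v → ∃ λ ys → (hs ⟨ evals σ v ⟩⇓* ys) × R (ys ++ v))
    graphsD []       σ d = mapD (λ v r → [] , ev-[] , r) (λ { v ([] , _ , r) → r }) d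
    graphsD {l = suc l} (h ∷ hs) σ {R} d = mapD
      (λ { v (ys , evs , y , ev , r) → y ∷ ys , ev-∷ (subst (h ⟨_⟩⇓ y) (params v (y ∷ ys)) ev) evs , r })
      (λ { v (y ∷ ys , ev-∷ ev evs , r) → ys , evs , y , subst (h ⟨_⟩⇓ y) (sym (params v (y ∷ ys))) ev , r })
      (graphsD hs σ (exD (subD (graphD h) (var zero ∷ map (renT (suc l ↑ʳ_)) σ) ∧D d)))
      where
      params : ∀ v (ys : Vec ℕ (suc l)) → evals (map (renT (suc l ↑ʳ_)) σ) (ys ++ v) ≡ evals σ v
      params v ys = evals-ren (suc l ↑ʳ_) (lookup-++ʳ ys v) σ

-- Non-negative integers as sums of four rational squares.

module FourSquares where
  open Congruences
  open LucasDiophantine using (±-unique)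
  open import Data.Nat as ℕ using (ℕ; zero; suc; s≤s; z≤n; NonZero)
  import Data.Nat.Properties as ℕ
  import Data.Nat.Divisibility as ℕ
  import Data.Nat.DivMod as ℕ
  import Data.Nat.Tactic.RingSolver as ℕ
  open import Data.Nat.Induction using (<-wellFounded)
  open import Data.Nat.Primality using (Prime; prime?; euclidsLemma; ¬prime⇒composite; prime⇒nonTrivial)
  open import Data.Nat.Divisibility.Core using (hasNonTrivialDivisor)
  open import Induction.WellFounded using (Acc; acc)
  open import Data.Integer hiding (suc; pred; NonZero)
  open import Data.Integer.Properties
  open import Data.Integer.Divisibility.Signed
  open import Data.Integer.Tactic.RingSolver using (solve-∀)
  open import Data.Fin as Fin using (Fin; toℕ; fromℕ<; splitAt; join)
  open import Data.Fin.Properties using (pigeonhole; toℕ-fromℕ<; toℕ-injective; toℕ≤pred[n]; join-splitAt)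
  open import Data.Product using (∃; _×_; _,_)
  open import Data.Sum using (_⊎_; inj₁; inj₂)
  open import Data.Empty using (⊥; ⊥-elim)
  open import Relation.Nullary using (yes; no; ¬_)
  open import Relation.Binary.PropositionalEquality

  sq4 : ℤ → ℤ → ℤ → ℤ → ℤ
  sq4 a b c d = a * a + b * b + c * c + d * d

  record Sum4 (z : ℤ) : Set where
    constructor sum4
    field
      {a b c d} : ℤ
      equality  : z ≡ sq4 a b c d

  sum4-* : ∀ {y z} → Sum4 y → Sum4 z → Sum4 (y * z)
  sum4-* (sum4 {a} {b} {c} {d} p) (sum4 {e} {f} {g} {h} q) = sum4
    {a = a * e + b * f + c * g + d * h} {a * f - b * e + c * h - d * g}
    {a * g - b * h - c * e + d * f} {a * h + b * g - c * f - d * e}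
    (trans (cong₂ _*_ p q) (euler a b c d e f g h))
    where
    euler : ∀ a b c d e f g h → (a * a + b * b + c * c + d * d) * (e * e + f * f + g * g + h * h) ≡
      (a * e + b * f + c * g + d * h) * (a * e + b * f + c * g + d * h) +
      (a * f - b * e + c * h - d * g) * (a * f - b * e + c * h - d * g) +
      (a * g - b * h - c * e + d * f) * (a * g - b * h - c * e + d * f) +
      (a * h + b * g - c * f - d * e) * (a * h + b * g - c * f - d * e)
    euler = solve-∀

  -- n is a sum of four squares of rationals with common denominator v.
  record Rep (n : ℕ) : Set where
    constructor over
    field
      v   : ℕ
      v≢0 : NonZero v
      sum : Sum4 (+ n * (+ v * + v))

  rep-* : ∀ {m n} → Rep m → Rep n → Rep (m ℕ.* n)
  rep-* {m} {n} (over v v≢0 p) (over w w≢0 q) = over (v ℕ.* w) (ℕ.m*n≢0 v w {{v≢0}} {{w≢0}})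
    (subst Sum4 (sym (trans (cong₂ (λ s t → s * (t * t)) (pos-* m n) (pos-* v w)) (eq (+ m) (+ n) (+ v) (+ w)))) (sum4-* p q))
    where
    eq : ∀ m n v w → m * n * (v * w * (v * w)) ≡ (m * (v * v)) * (n * (w * w))
    eq = solve-∀

  -- Rational representations can be divided, so no descent is needed.
  rep-÷ : ∀ {m n} → NonZero m → Rep (m ℕ.* n) → Rep m → Rep n
  rep-÷ {m} {n} m≢0 (over v v≢0 p) (over w w≢0 q) =
    over (m ℕ.* (v ℕ.* w)) (ℕ.m*n≢0 m (v ℕ.* w) {{m≢0}} {{ℕ.m*n≢0 v w {{v≢0}} {{w≢0}} }})
    (subst Sum4 (sym (trans (cong (λ t → + n * (t * t)) (trans (pos-* m (v ℕ.* w)) (cong (+ m *_) (pos-* v w))))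
                      (trans (eq (+ m) (+ n) (+ v) (+ w)) (cong (λ t → t * (+ v * + v) * (+ m * (+ w * + w))) (sym (pos-* m n))))))
      (sum4-* p q))
    where
    eq : ∀ m n v w → n * (m * (v * w) * (m * (v * w))) ≡ m * n * (v * v) * (m * (w * w))
    eq = solve-∀

  rep-sum : ∀ {n} a b → n ≡ a ℕ.* a ℕ.+ b ℕ.* b ℕ.+ 1 → Rep n
  rep-sum a b refl = over 1 _ (sum4 {a = + a} {+ b} {1ℤ} {0ℤ}
    (trans (*-identityʳ (+ (a ℕ.* a ℕ.+ b ℕ.* b ℕ.+ 1)))
    (trans (cong₂ (λ s t → s + t + 1ℤ) (pos-* a a) (pos-* b b)) (sym (+-identityʳ (+ a * + a + + b * + b + 1ℤ))))))

  -- Lagrange's pigeonhole: for a, b ≤ h = ⌊p/2⌋ the squares a² and the numbers -1 - b² are 2(h+1) >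
  -- p in number, and each family is injective modulo p, so some a² + b² + 1 is divisible by p. The
  -- prime 2 needs no separate case.
  module PrimeMultiple {p : ℕ} (pp : Prime p) where
    instance
      p-nonTrivial : ℕ.NonTrivial p
      p-nonTrivial = prime⇒nonTrivial pp
      p≢0 : NonZero p
      p≢0 = ℕ.nonTrivial⇒nonZero p
    h = p ℕ./ 2
    2h≤p : h ℕ.+ h ℕ.≤ p
    2h≤p = subst₂ ℕ._≤_ (eq h) (sym (ℕ.m≡m%n+[m/n]*n p 2)) (ℕ.m≤n+m (h ℕ.* 2) (p ℕ.% 2))
      where
      eq : ∀ h → h ℕ.* 2 ≡ h ℕ.+ h
      eq = ℕ.solve-∀
    p<2h+2 : p ℕ.< suc h ℕ.+ suc h
    p<2h+2 = subst₂ ℕ._<_ (sym (ℕ.m≡m%n+[m/n]*n p 2)) (eq h) (ℕ.+-monoˡ-< (h ℕ.* 2) (ℕ.m%n<n p 2))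
      where
      eq : ∀ h → 2 ℕ.+ h ℕ.* 2 ≡ suc h ℕ.+ suc h
      eq = ℕ.solve-∀

    squares-distinct : ∀ a b → a ℕ.≤ h → b ℕ.≤ h → + a * + a ≈ + b * + b [ + p ] → a ≡ b
    squares-distinct a b a≤h b≤h (mk p∣) with a ℕ.≟ b
    ... | yes a≡b = a≡b
    ... | no  a≢b = ±-unique a+b<p factor
      where
      a+b<p : a ℕ.+ b ℕ.< p
      -- As a, b ≤ h and 2h ≤ p, equality a + b = p would force a = b = h.
      a+b<p = ℕ.≤∧≢⇒< (ℕ.≤-trans (ℕ.+-mono-≤ a≤h b≤h) 2h≤p) λ e →
        a≢b (trans (ℕ.≤-antisym a≤h (ℕ.+-cancelʳ-≤ b h a (ℕ.≤-trans (ℕ.+-monoʳ-≤ h b≤h) (ℕ.≤-trans 2h≤p (ℕ.≤-reflexive (sym e))))))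
                   (ℕ.≤-antisym (ℕ.+-cancelˡ-≤ a h b (ℕ.≤-trans (ℕ.+-monoˡ-≤ h a≤h) (ℕ.≤-trans 2h≤p (ℕ.≤-reflexive (sym e))))) b≤h))
      eq : ∀ a b → a * a - b * b ≡ (a - b) * (a - - b)
      eq = solve-∀
      factor : (+ a ≈ + b [ + p ]) ⊎ (+ a ≈ - + b [ + p ])
      factor with euclidsLemma ∣ + a - + b ∣ ∣ + a - - + b ∣ pp
                  (subst (p ℕ.∣_) (trans (cong ∣_∣ (eq (+ a) (+ b))) (abs-* (+ a - + b) (+ a - - + b))) (∣⇒∣ᵤ p∣))
      ... | inj₁ d = inj₁ (mk (∣ᵤ⇒∣ d))
      ... | inj₂ d = inj₂ (mk (∣ᵤ⇒∣ d))

    -- The factor p - 1 stands for -1, which keeps the values natural.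
    value : Fin (suc h) ⊎ Fin (suc h) → ℕ
    value (inj₁ a) = toℕ a ℕ.* toℕ a
    value (inj₂ b) = ℕ.pred p ℕ.* (1 ℕ.+ toℕ b ℕ.* toℕ b)

    value₁≈ : ∀ a → + value (inj₁ a) ≈ + toℕ a * + toℕ a [ + p ]
    value₁≈ a = ≈-reflexive (pos-* (toℕ a) (toℕ a))

    value₂≈ : ∀ b → + value (inj₂ b) ≈ - (1ℤ + + toℕ b * + toℕ b) [ + p ]
    value₂≈ b = ≈-trans (≈-reflexive (pos-* (ℕ.pred p) (1 ℕ.+ toℕ b ℕ.* toℕ b)))
      (≈-trans (≈-* -1≈ (≈-refl {x = + (1 ℕ.+ toℕ b ℕ.* toℕ b)}))
      (≈-reflexive (trans (-1*i≡-i _) (cong (λ t → - (1ℤ + t)) (pos-* (toℕ b) (toℕ b))))))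
      where
      eq : ∀ q → q - -1ℤ ≡ 1ℤ + q
      eq = solve-∀
      -1≈ : + ℕ.pred p ≈ -1ℤ [ + p ]
      -1≈ = mk (subst (+ p ∣_) (trans (cong +_ (sym (ℕ.suc-pred p))) (sym (eq (+ ℕ.pred p)))) ∣-refl)

    residue : Fin (suc h ℕ.+ suc h) → Fin p
    residue i = fromℕ< (ℕ.m%n<n (value (splitAt (suc h) i)) p)

    residue-≈ : ∀ i j → residue i ≡ residue j → + value (splitAt (suc h) i) ≈ + value (splitAt (suc h) j) [ + p ]
    residue-≈ i j e = ≈-trans (%-≈ _ p) (≈-trans (≈-reflexive (cong +_ (trans (sym (toℕ-fromℕ< _)) (trans (cong toℕ e) (toℕ-fromℕ< _))))) (≈-sym (%-≈ _ p)))

    Multiple : Set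
    Multiple = ∃ λ a → ∃ λ b → (a ℕ.≤ h) × (b ℕ.≤ h) × (p ℕ.∣ a ℕ.* a ℕ.+ b ℕ.* b ℕ.+ 1)

    mixed : ∀ (a b : Fin (suc h)) → + value (inj₁ a) ≈ + value (inj₂ b) [ + p ] → Multiple
    mixed a b e = toℕ a , toℕ b , toℕ≤pred[n] a , toℕ≤pred[n] b ,
      ∣⇒∣ℕ {p} (subst (+ p ∣_) p≡ (dvd (≈-trans (≈-sym (value₁≈ a)) (≈-trans e (value₂≈ b)))))
      where
      eq : ∀ x y → x - - (1ℤ + y) ≡ x + y + 1ℤ
      eq = solve-∀
      p≡ : + toℕ a * + toℕ a - - (1ℤ + + toℕ b * + toℕ b) ≡ + (toℕ a ℕ.* toℕ a ℕ.+ toℕ b ℕ.* toℕ b ℕ.+ 1)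
      p≡ = trans (eq (+ toℕ a * + toℕ a) (+ toℕ b * + toℕ b)) (cong₂ (λ s t → s + t + 1ℤ) (sym (pos-* (toℕ a) (toℕ a))) (sym (pos-* (toℕ b) (toℕ b))))

    collision : ∀ s t → s ≢ t → + value s ≈ + value t [ + p ] → Multiple
    collision (inj₁ a) (inj₁ b) s≢t e = ⊥-elim (s≢t (cong inj₁ (toℕ-injective
      (squares-distinct (toℕ a) (toℕ b) (toℕ≤pred[n] a) (toℕ≤pred[n] b) (≈-trans (≈-sym (value₁≈ a)) (≈-trans e (value₁≈ b)))))))
    collision (inj₁ a) (inj₂ b) s≢t e = mixed a b e
    collision (inj₂ a) (inj₁ b) s≢t e = mixed b a (≈-sym e)
    collision (inj₂ a) (inj₂ b) s≢t e = ⊥-elim (s≢t (cong inj₂ (toℕ-injective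
      (squares-distinct (toℕ a) (toℕ b) (toℕ≤pred[n] a) (toℕ≤pred[n] b) squares))))
      where
      eq : ∀ x → - (- (1ℤ + x)) - 1ℤ ≡ x
      eq = solve-∀
      squares : + toℕ a * + toℕ a ≈ + toℕ b * + toℕ b [ + p ]
      squares = ≈-trans (≈-reflexive (sym (eq (+ toℕ a * + toℕ a)))) (≈-trans (≈-- (≈-neg (≈-trans (≈-sym (value₂≈ a)) (≈-trans e (value₂≈ b)))) (≈-refl {x = 1ℤ})) (≈-reflexive (eq (+ toℕ b * + toℕ b))))

    multiple : Multiple
    multiple = from-collision (pigeonhole p<2h+2 residue)
      where
      from-collision : (∃ λ i → ∃ λ j → i Fin.< j × residue i ≡ residue j) → Multiple
      from-collision (i , j , i<j , e) = collision (splitAt (suc h) i) (splitAt (suc h) j)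
        (λ s≡t → ℕ.<-irrefl (cong toℕ (trans (sym (join-splitAt (suc h) (suc h) i)) (trans (cong (join (suc h) (suc h)) s≡t) (join-splitAt (suc h) (suc h) j)))) i<j)
        (residue-≈ i j e)

    -- For mp = a² + b² + 1 one has 2mp ≤ (2h)² + 2 ≤ p² + 2 < 2p², so m < p.
    small-multiple : ∃ λ m → NonZero m × (m ℕ.< p) × Rep (m ℕ.* p)
    small-multiple = go multiple
      where
      go : Multiple → ∃ λ m → NonZero m × (m ℕ.< p) × Rep (m ℕ.* p)
      go (a , b , a≤h , b≤h , ℕ.divides m e) = m , ℕ.≢-nonZero m≢0 , m<p , rep-sum a b (sym e)
        where
        m≢0 : m ≢ 0
        m≢0 refl with () ← trans (ℕ.+-comm 1 (a ℕ.* a ℕ.+ b ℕ.* b)) e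
        eq₁ : ∀ h → (h ℕ.* h ℕ.+ h ℕ.* h ℕ.+ 1) ℕ.+ (h ℕ.* h ℕ.+ h ℕ.* h ℕ.+ 1) ≡ (h ℕ.+ h) ℕ.* (h ℕ.+ h) ℕ.+ 2
        eq₁ = ℕ.solve-∀
        p≥2 : 2 ℕ.≤ p
        p≥2 = ℕ.nonTrivial⇒n>1 p
        double : m ℕ.* p ℕ.+ m ℕ.* p ℕ.< p ℕ.* p ℕ.+ p ℕ.* p
        double = begin-strict
          m ℕ.* p ℕ.+ m ℕ.* p                                     ≡⟨ cong (λ t → t ℕ.+ t) (sym e) ⟩
          (a ℕ.* a ℕ.+ b ℕ.* b ℕ.+ 1) ℕ.+ (a ℕ.* a ℕ.+ b ℕ.* b ℕ.+ 1) ≤⟨ ℕ.+-mono-≤ le le ⟩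
          (h ℕ.* h ℕ.+ h ℕ.* h ℕ.+ 1) ℕ.+ (h ℕ.* h ℕ.+ h ℕ.* h ℕ.+ 1) ≡⟨ eq₁ h ⟩
          (h ℕ.+ h) ℕ.* (h ℕ.+ h) ℕ.+ 2                           ≤⟨ ℕ.+-monoˡ-≤ 2 (ℕ.*-mono-≤ 2h≤p 2h≤p) ⟩
          p ℕ.* p ℕ.+ 2                                           <⟨ ℕ.+-monoʳ-< (p ℕ.* p) (ℕ.≤-trans (s≤s (s≤s (s≤s z≤n))) (ℕ.*-mono-≤ p≥2 p≥2)) ⟩
          p ℕ.* p ℕ.+ p ℕ.* p                                     ∎
          where
          open ℕ.≤-Reasoning
          le : a ℕ.* a ℕ.+ b ℕ.* b ℕ.+ 1 ℕ.≤ h ℕ.* h ℕ.+ h ℕ.* h ℕ.+ 1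
          le = ℕ.+-monoˡ-≤ 1 (ℕ.+-mono-≤ (ℕ.*-mono-≤ a≤h a≤h) (ℕ.*-mono-≤ b≤h b≤h))
        m<p : m ℕ.< p
        m<p = ℕ.≰⇒> λ p≤m → ℕ.<⇒≱ double (ℕ.+-mono-≤ (ℕ.*-monoˡ-≤ p p≤m) (ℕ.*-monoˡ-≤ p p≤m))

  -- Strong induction. A composite number is a product of smaller ones; for a prime p some mp with 0
  -- < m < p is representable, m is so by induction, and m can be divided out.
  rep : ∀ n → Rep n
  rep n = go n (<-wellFounded n)
    where
    go : ∀ n → Acc ℕ._<_ n → Rep n
    go 0 _ = over 1 _ (sum4 {a = 0ℤ} {0ℤ} {0ℤ} {0ℤ} refl)
    go 1 _ = over 1 _ (sum4 {a = 1ℤ} {0ℤ} {0ℤ} {0ℤ} refl)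
    go n@(suc (suc _)) (acc rec) with prime? n
    ... | yes pp = let (m , m≢0 , m<n , r) = PrimeMultiple.small-multiple pp in rep-÷ m≢0 r (go m (rec m<n))
    ... | no ¬pp with ¬prime⇒composite ¬pp
    ... | hasNonTrivialDivisor {divisor = d} d<n d∣n@(ℕ.divides q e) =
      subst Rep (sym e) (rep-* (go q (rec (ℕ.quotient-< d∣n))) (go d (rec d<n)))

  -- (2t+1)(3w+1) never vanishes, yet every non-zero v divides such a product:
  -- this expresses v ≠ 0 by an equation.
  nonzero-witness : ∀ v → NonZero v → ∃ λ s → ∃ λ t → ∃ λ w → + v * s ≡ (1ℤ + t + t) * (1ℤ + w + w + w)
  nonzero-witness v v≢0 = go v (<-wellFounded v) v≢0
    where
    go : ∀ v → Acc ℕ._<_ v → NonZero v → ∃ λ s → ∃ λ t → ∃ λ w → + v * s ≡ (1ℤ + t + t) * (1ℤ + w + w + w)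
    go v@(suc _) (acc rec) _ = halve (v ℕ.% 2) (v ℕ./ 2) (ℕ.m≡m%n+[m/n]*n v 2) (ℕ.m%n<n v 2)
      where
      eq₁ : ∀ h → (1ℤ + h * + 2) * 1ℤ ≡ (1ℤ + h + h) * (1ℤ + 0ℤ + 0ℤ + 0ℤ)
      eq₁ = solve-∀
      eq₂ : ∀ h s → h * + 2 * - s ≡ - + 2 * (h * s)
      eq₂ = solve-∀
      eq₃ : ∀ t w → - + 2 * ((1ℤ + t + t) * (1ℤ + w + w + w)) ≡
                    (1ℤ + t + t) * (1ℤ + (-1ℤ - w - w) + (-1ℤ - w - w) + (-1ℤ - w - w))
      eq₃ = solve-∀
      halve : ∀ r h → v ≡ r ℕ.+ h ℕ.* 2 → r ℕ.< 2 → ∃ λ s → ∃ λ t → ∃ λ w → + v * s ≡ (1ℤ + t + t) * (1ℤ + w + w + w)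
      halve 1 h e _ = 1ℤ , + h , 0ℤ , trans (cong (λ z → + z * 1ℤ) e) (trans (cong (λ z → (1ℤ + z) * 1ℤ) (pos-* h 2)) (eq₁ (+ h)))
      halve 0 h@(suc h′) e _ = double (go h (rec (subst (h ℕ.<_) (sym e) (ℕ.m<m*n h 2 (s≤s (s≤s z≤n))))) _)
        where
        double : (∃ λ s → ∃ λ t → ∃ λ w → + h * s ≡ (1ℤ + t + t) * (1ℤ + w + w + w)) →
                 ∃ λ s → ∃ λ t → ∃ λ w → + v * s ≡ (1ℤ + t + t) * (1ℤ + w + w + w)
        -- The factors 2 are collected in the second factor with the sign changed: -2(3w + 1) = 3(-1
        -- - 2w) + 1.
        double (s , t , w , p) = - s , t , -1ℤ - w - w ,
          trans (cong (λ z → + z * - s) e) (trans (cong (_* - s) (pos-* h 2)) (trans (eq₂ (+ h) s) (trans (cong (- + 2 *_) p) (eq₃ t w))))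
      halve (suc (suc _)) h e (s≤s (s≤s ()))

  NonNegZ : ℤ → Set
  NonNegZ x = ∃ λ v → ∃ λ a → ∃ λ b → ∃ λ c → ∃ λ d → ∃ λ s → ∃ λ t → ∃ λ w →
    (x * (v * v) ≡ sq4 a b c d) × (v * s ≡ (1ℤ + t + t) * (1ℤ + w + w + w))

  nonNegZ : ∀ n → NonNegZ (+ n)
  nonNegZ n = from-rep (rep n)
    where
    from-rep : Rep n → NonNegZ (+ n)
    from-rep (over v v≢0 (sum4 {a} {b} {c} {d} e)) = let (s , t , w , e′) = nonzero-witness v v≢0 in
      + v , a , b , c , d , s , t , w , e , e′

  square-abs : ∀ a → a * a ≡ + (∣ a ∣ ℕ.* ∣ a ∣)
  square-abs (+ n)    = sym (pos-* n n)
  square-abs -[1+ n ] = refl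

  nonNegZ⇒ℕ : ∀ x → NonNegZ x → ∃ λ n → x ≡ + n
  nonNegZ⇒ℕ (+ n) _ = n , refl
  nonNegZ⇒ℕ -[1+ n ] (v , a , b , c , d , s , t , w , e , e′) = ⊥-elim (impossible (∣ v ∣ ℕ.* ∣ v ∣) refl)
    where
    sum≡ : sq4 a b c d ≡ + (∣ a ∣ ℕ.* ∣ a ∣ ℕ.+ ∣ b ∣ ℕ.* ∣ b ∣ ℕ.+ ∣ c ∣ ℕ.* ∣ c ∣ ℕ.+ ∣ d ∣ ℕ.* ∣ d ∣)
    sum≡ = cong₂ _+_ (cong₂ _+_ (cong₂ _+_ (square-abs a) (square-abs b)) (square-abs c)) (square-abs d)
    ∤1 : ∀ k {x} → ¬ (1 ℕ.+ suc k ≡ 1) → 1ℤ ≡ x * + (1 ℕ.+ suc k) → ⊥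
    ∤1 k {x} k≢ e = k≢ (ℕ.∣1⇒≡1 (∣⇒∣ᵤ {+ (1 ℕ.+ suc k)} {1ℤ} (divides x e)))
    odd≢0 : ∀ t → 1ℤ + t + t ≢ 0ℤ
    odd≢0 t e = ∤1 0 { - t} (λ ()) (trans (eq t) (trans (cong (_+ - t * + 2) e) (+-identityˡ _)))
      where
      eq : ∀ t → 1ℤ ≡ 1ℤ + t + t + - t * + 2
      eq = solve-∀
    one-mod-3≢0 : ∀ w → 1ℤ + w + w + w ≢ 0ℤ
    one-mod-3≢0 w e = ∤1 1 { - w} (λ ()) (trans (eq w) (trans (cong (_+ - w * + 3) e) (+-identityˡ _)))
      where
      eq : ∀ t → 1ℤ ≡ 1ℤ + t + t + t + - t * + 3
      eq = solve-∀
    v≢0 : v ≢ 0ℤ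
    v≢0 refl with i*j≡0⇒i≡0∨j≡0 (1ℤ + t + t) (trans (sym e′) (*-zeroˡ s))
    ... | inj₁ z = odd≢0 t z
    ... | inj₂ z = one-mod-3≢0 w z
    impossible : ∀ k → k ≡ ∣ v ∣ ℕ.* ∣ v ∣ → ⊥
    impossible zero    k≡ with ℕ.m*n≡0⇒m≡0∨n≡0 ∣ v ∣ (sym k≡)
    ... | inj₁ z = v≢0 (∣i∣≡0⇒i≡0 z)
    ... | inj₂ z = v≢0 (∣i∣≡0⇒i≡0 z)
    impossible (suc k) k≡ with () ← trans (cong (-[1+ n ] *_) (sym (trans (square-abs v) (cong +_ (sym k≡))))) (trans e sum≡)

-- From formulas over ℤ to systems of ring equations.

module Compilation where
  open import Defs
  open Formulas
  open RecursiveFunctions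
  open FourSquares
  open import Data.Nat as ℕ using (ℕ; zero; suc; s≤s; z≤n; _≤_; _<_)
  import Data.Nat.Properties as ℕ
  import Data.Nat.Tactic.RingSolver as ℕ
  open import Data.Integer hiding (suc; pred; NonZero; _≤_; _<_)
  open import Data.Integer.Properties
  open import Data.Integer.Tactic.RingSolver using (solve-∀)
  open import Data.Fin using (Fin; zero; suc; #_; toℕ; fromℕ<)
  open import Data.Fin.Properties using (toℕ-fromℕ<)
  open import Data.Vec using (Vec; []; _∷_; lookup; map)
  open import Data.Vec.Properties using (lookup-map)
  open import Data.List as List using (List; []; _∷_; _++_)
  open import Data.List.Relation.Unary.All as All using (All; []; _∷_)
  import Data.List.Relation.Unary.All.Properties as All
  open import Data.Product using (∃; _×_; _,_)
  open import Data.Empty using (⊥-elim)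
  open import Relation.Nullary using (yes; no; ¬_)
  open import Relation.Binary.PropositionalEquality

  infix 4 _⊨ᶻ_

  ⟦_⟧ᶻ : ∀ {k} → Tm k → Vec ℤ k → ℤ
  ⟦ var i ⟧ᶻ v = lookup v i
  ⟦ 𝟘 ⟧ᶻ     v = 0ℤ
  ⟦ 𝟙 ⟧ᶻ     v = 1ℤ
  ⟦ s ⊕ t ⟧ᶻ v = ⟦ s ⟧ᶻ v + ⟦ t ⟧ᶻ v
  ⟦ s ⊗ t ⟧ᶻ v = ⟦ s ⟧ᶻ v * ⟦ t ⟧ᶻ v

  _⊨ᶻ_ : ∀ {k} → Vec ℤ k → Fo k → Set
  v ⊨ᶻ (s ≐ t) = ⟦ s ⟧ᶻ v ≡ ⟦ t ⟧ᶻ v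
  v ⊨ᶻ (φ ∧ ψ) = (v ⊨ᶻ φ) × (v ⊨ᶻ ψ)
  v ⊨ᶻ (ex φ)  = ∃ λ x → (x ∷ v) ⊨ᶻ φ

  ⟦⟧ᶻ-pos : ∀ {k} (t : Tm k) v → ⟦ t ⟧ᶻ (map +_ v) ≡ + ⟦ t ⟧ v
  ⟦⟧ᶻ-pos (var i) v = lookup-map i +_ v
  ⟦⟧ᶻ-pos 𝟘       v = refl
  ⟦⟧ᶻ-pos 𝟙       v = refl
  ⟦⟧ᶻ-pos (s ⊕ t) v = cong₂ _+_ (⟦⟧ᶻ-pos s v) (⟦⟧ᶻ-pos t v)
  ⟦⟧ᶻ-pos (s ⊗ t) v = trans (cong₂ _*_ (⟦⟧ᶻ-pos s v) (⟦⟧ᶻ-pos t v)) (sym (pos-* (⟦ s ⟧ v) (⟦ t ⟧ v)))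

  nonNegF : ∀ {k} → Fo (suc k)
  nonNegF {k} = ex (ex (ex (ex (ex (ex (ex (ex
      ((x ⊗ (v ⊗ v) ≐ a ⊗ a ⊕ b ⊗ b ⊕ c ⊗ c ⊕ d ⊗ d) ∧ (v ⊗ s ≐ (𝟙 ⊕ t ⊕ t) ⊗ (𝟙 ⊕ w ⊕ w ⊕ w))))))))))
    where
    w t s d c b a v x : Tm (9 ℕ.+ k)
    w = var (# 0)
    t = var (# 1)
    s = var (# 2)
    d = var (# 3)
    c = var (# 4)
    b = var (# 5)
    a = var (# 6)
    v = var (# 7)
    x = var (# 8)

  -- Only the quantifiers of φ are restricted to ℕ; the auxiliary variables inside `nonNegF` range
  -- over ℤ, and the free variable receives its own guard in `formula`.
  relativize : ∀ {k} → Fo k → Fo k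
  relativize (s ≐ t) = s ≐ t
  relativize (φ ∧ ψ) = relativize φ ∧ relativize ψ
  relativize (ex φ)  = ex (nonNegF ∧ relativize φ)

  relativize-complete : ∀ {k} (φ : Fo k) v → v ⊨ φ → map +_ v ⊨ᶻ relativize φ
  relativize-complete (s ≐ t) v e       = trans (⟦⟧ᶻ-pos s v) (trans (cong +_ e) (sym (⟦⟧ᶻ-pos t v)))
  relativize-complete (φ ∧ ψ) v (p , q) = relativize-complete φ v p , relativize-complete ψ v q
  relativize-complete (ex φ)  v (x , p) = + x , nonNegZ x , relativize-complete φ (x ∷ v) p

  relativize-sound : ∀ {k} (φ : Fo k) v → map +_ v ⊨ᶻ relativize φ → v ⊨ φ
  relativize-sound (s ≐ t) v e       = +-injective (trans (sym (⟦⟧ᶻ-pos s v)) (trans e (⟦⟧ᶻ-pos t v)))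
  relativize-sound (φ ∧ ψ) v (p , q) = relativize-sound φ v p , relativize-sound ψ v q
  relativize-sound (ex φ)  v (x , n , p) with nonNegZ⇒ℕ x n
  ... | y , refl = y , relativize-sound φ (y ∷ v) p

  -- Variables are numbered by ℕ during compilation, since the number of variables is known only at
  -- the end; `name` then moves them into `Fin`.
  data Eqn : Set where
    one     : ℕ → Eqn
    add mul : ℕ → ℕ → ℕ → Eqn

  HoldsN : (ℕ → ℤ) → Eqn → Set
  HoldsN σ (one i)     = σ i ≡ 1ℤ
  HoldsN σ (add i j k) = σ i + σ j ≡ σ k
  HoldsN σ (mul i j k) = σ i * σ j ≡ σ k

  Below : ℕ → Eqn → Set
  Below b (one i)     = i < b
  Below b (add i j k) = i < b × j < b × k < b
  Below b (mul i j k) = i < b × j < b × k < b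

  Below-mono : ∀ {b b′} → b ≤ b′ → ∀ {e} → Below b e → Below b′ e
  Below-mono l {one i}     p           = ℕ.<-≤-trans p l
  Below-mono l {add i j k} (p , q , r) = ℕ.<-≤-trans p l , ℕ.<-≤-trans q l , ℕ.<-≤-trans r l
  Below-mono l {mul i j k} (p , q , r) = ℕ.<-≤-trans p l , ℕ.<-≤-trans q l , ℕ.<-≤-trans r l

  Agree : ℕ → (ℕ → ℤ) → (ℕ → ℤ) → Set
  Agree b σ τ = ∀ i → i < b → τ i ≡ σ i

  HoldsN-agree : ∀ {b σ τ} → Agree b σ τ → ∀ {e} → Below b e → HoldsN σ e → HoldsN τ e
  HoldsN-agree g {one i}     p           h = trans (g i p) h
  HoldsN-agree g {add i j k} (p , q , r) h = trans (cong₂ _+_ (g i p) (g j q)) (trans h (sym (g k r)))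
  HoldsN-agree g {mul i j k} (p , q , r) h = trans (cong₂ _*_ (g i p) (g j q)) (trans h (sym (g k r)))

  all-agree : ∀ {b σ τ es} → Agree b σ τ → All (Below b) es → All (HoldsN σ) es → All (HoldsN τ) es
  all-agree g []       []       = []
  all-agree g (b ∷ bs) (h ∷ hs) = HoldsN-agree g b h ∷ all-agree g bs hs

  _[_↦_] : (ℕ → ℤ) → ℕ → ℤ → ℕ → ℤ
  (σ [ b ↦ z ]) i with i ℕ.≟ b
  ... | yes _ = z
  ... | no  _ = σ i

  update-at : ∀ σ b z → (σ [ b ↦ z ]) b ≡ z
  update-at σ b z with b ℕ.≟ b
  ... | yes _   = refl
  ... | no  b≢b = ⊥-elim (b≢b refl)

  update-below : ∀ σ b z → Agree b σ (σ [ b ↦ z ])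
  update-below σ b z i i<b with i ℕ.≟ b
  ... | yes i≡b = ⊥-elim (ℕ.<-irrefl i≡b i<b)
  ... | no  _   = refl

  -- Fresh names are handed out consecutively: a term compiled at x uses x up to x + size - 1, and a
  -- variable uses none. `resT` is the name that holds the value.
  sizeT : ∀ {k} → Tm k → ℕ
  sizeT (var i) = 0
  sizeT 𝟘       = 1
  sizeT 𝟙       = 1
  sizeT (s ⊕ t) = sizeT s ℕ.+ sizeT t ℕ.+ 1
  sizeT (s ⊗ t) = sizeT s ℕ.+ sizeT t ℕ.+ 1

  resT : ∀ {k} → Tm k → Vec ℕ k → ℕ → ℕ
  resT (var i) ρ x = lookup ρ i
  resT 𝟘       ρ x = x
  resT 𝟙       ρ x = x
  resT (s ⊕ t) ρ x = x ℕ.+ sizeT s ℕ.+ sizeT t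
  resT (s ⊗ t) ρ x = x ℕ.+ sizeT s ℕ.+ sizeT t

  eqsT : ∀ {k} → Tm k → Vec ℕ k → ℕ → List Eqn
  eqsT (var i) ρ x = []
  eqsT 𝟘       ρ x = add x x x ∷ []
  eqsT 𝟙       ρ x = one x ∷ []
  eqsT (s ⊕ t) ρ x = add (resT s ρ x) (resT t ρ (x ℕ.+ sizeT s)) (x ℕ.+ sizeT s ℕ.+ sizeT t) ∷
                     eqsT s ρ x ++ eqsT t ρ (x ℕ.+ sizeT s)
  eqsT (s ⊗ t) ρ x = mul (resT s ρ x) (resT t ρ (x ℕ.+ sizeT s)) (x ℕ.+ sizeT s ℕ.+ sizeT t) ∷
                     eqsT s ρ x ++ eqsT t ρ (x ℕ.+ sizeT s)

  sizeF : ∀ {k} → Fo k → ℕ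
  sizeF (s ≐ t) = sizeT s ℕ.+ sizeT t ℕ.+ 1
  sizeF (φ ∧ ψ) = sizeF φ ℕ.+ sizeF ψ
  sizeF (ex φ)  = suc (sizeF φ)

  eqsF : ∀ {k} → Fo k → Vec ℕ k → ℕ → List Eqn
  -- There is no equation x_i = x_j in E_n, so equality is written s + z = t, where z + z = z forces
  -- z = 0.
  eqsF (s ≐ t) ρ x = let z = x ℕ.+ sizeT s ℕ.+ sizeT t in
    add z z z ∷ add (resT s ρ x) z (resT t ρ (x ℕ.+ sizeT s)) ∷ eqsT s ρ x ++ eqsT t ρ (x ℕ.+ sizeT s)
  eqsF (φ ∧ ψ) ρ x = eqsF φ ρ x ++ eqsF ψ ρ (x ℕ.+ sizeF φ)
  eqsF (ex φ)  ρ x = eqsF φ (x ∷ ρ) (suc x)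

  i+i≡i⇒i≡0 : ∀ i → i + i ≡ i → i ≡ 0ℤ
  i+i≡i⇒i≡0 i e = trans (eq i) (trans (cong (_- i) e) (+-inverseʳ i))
    where
    eq : ∀ i → i ≡ i + i - i
    eq = solve-∀

  eqsT-sound : ∀ {k} (t : Tm k) ρ x σ → All (HoldsN σ) (eqsT t ρ x) → σ (resT t ρ x) ≡ ⟦ t ⟧ᶻ (map σ ρ)
  eqsT-sound (var i) ρ x σ _ = sym (lookup-map i σ ρ)
  eqsT-sound 𝟘 ρ x σ (h ∷ _) = i+i≡i⇒i≡0 (σ x) h
  eqsT-sound 𝟙 ρ x σ (h ∷ _) = h
  eqsT-sound (s ⊕ t) ρ x σ (h ∷ hs) = trans (sym h)
    (cong₂ _+_ (eqsT-sound s ρ x σ (All.++⁻ˡ (eqsT s ρ x) hs)) (eqsT-sound t ρ (x ℕ.+ sizeT s) σ (All.++⁻ʳ (eqsT s ρ x) hs)))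
  eqsT-sound (s ⊗ t) ρ x σ (h ∷ hs) = trans (sym h)
    (cong₂ _*_ (eqsT-sound s ρ x σ (All.++⁻ˡ (eqsT s ρ x) hs)) (eqsT-sound t ρ (x ℕ.+ sizeT s) σ (All.++⁻ʳ (eqsT s ρ x) hs)))

  eqsF-sound : ∀ {k} (φ : Fo k) ρ x σ → All (HoldsN σ) (eqsF φ ρ x) → map σ ρ ⊨ᶻ φ
  eqsF-sound (s ≐ t) ρ x σ (hz ∷ h ∷ hs) = trans (sym (eqsT-sound s ρ x σ (All.++⁻ˡ (eqsT s ρ x) hs)))
    (trans (sym (+-identityʳ _)) (trans (cong (λ z → σ (resT s ρ x) + z) (sym (i+i≡i⇒i≡0 _ hz)))
    (trans h (eqsT-sound t ρ (x ℕ.+ sizeT s) σ (All.++⁻ʳ (eqsT s ρ x) hs)))))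
  eqsF-sound (φ ∧ ψ) ρ x σ hs = eqsF-sound φ ρ x σ (All.++⁻ˡ (eqsF φ ρ x) hs) , eqsF-sound ψ ρ (x ℕ.+ sizeF φ) σ (All.++⁻ʳ (eqsF φ ρ x) hs)
  eqsF-sound (ex φ)  ρ x σ hs = σ x , eqsF-sound φ (x ∷ ρ) (suc x) σ hs

  Names : ∀ {k} → Vec ℕ k → ℕ → Set
  Names ρ x = ∀ i → lookup ρ i < x

  names-≤ : ∀ {k} {ρ : Vec ℕ k} {x y} → x ≤ y → Names ρ x → Names ρ y
  names-≤ l n i = ℕ.<-≤-trans (n i) l

  map-agree : ∀ {k} (ρ : Vec ℕ k) {x σ τ} → Names ρ x → Agree x σ τ → map τ ρ ≡ map σ ρ
  map-agree []      n g = refl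
  map-agree (i ∷ ρ) n g = cong₂ _∷_ (g i (n zero)) (map-agree ρ (λ i → n (suc i)) g)

  agree-trans : ∀ {x y σ τ υ} → x ≤ y → Agree x σ τ → Agree y τ υ → Agree x σ υ
  agree-trans l g h i i<x = trans (h i (ℕ.<-≤-trans i<x l)) (g i i<x)

  resT-below : ∀ {k} (t : Tm k) ρ x → Names ρ x → resT t ρ x < x ℕ.+ sizeT t
  resT-below (var i) ρ x n = subst (lookup ρ i <_) (sym (ℕ.+-identityʳ x)) (n i)
  resT-below 𝟘 ρ x n = ℕ.m<m+n x (s≤s z≤n)
  resT-below 𝟙 ρ x n = ℕ.m<m+n x (s≤s z≤n)
  resT-below (s ⊕ t) ρ x n = ℕ.≤-reflexive (eq x (sizeT s) (sizeT t))
    where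
    eq : ∀ x s t → suc (x ℕ.+ s ℕ.+ t) ≡ x ℕ.+ (s ℕ.+ t ℕ.+ 1)
    eq = ℕ.solve-∀
  resT-below (s ⊗ t) ρ x n = ℕ.≤-reflexive (eq x (sizeT s) (sizeT t))
    where
    eq : ∀ x s t → suc (x ℕ.+ s ℕ.+ t) ≡ x ℕ.+ (s ℕ.+ t ℕ.+ 1)
    eq = ℕ.solve-∀

  module _ {k : ℕ} (s t : Tm k) (ρ : Vec ℕ k) (x : ℕ) (n : Names ρ x) where
    private
      y = x ℕ.+ sizeT s
      z = y ℕ.+ sizeT t
    next≡ : suc z ≡ x ℕ.+ (sizeT s ℕ.+ sizeT t ℕ.+ 1)
    next≡ = eq x (sizeT s) (sizeT t)
      where
      eq : ∀ x s t → suc (x ℕ.+ s ℕ.+ t) ≡ x ℕ.+ (s ℕ.+ t ℕ.+ 1)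
      eq = ℕ.solve-∀
    left-below : resT s ρ x < z
    left-below = ℕ.<-≤-trans (resT-below s ρ x n) (ℕ.m≤m+n y (sizeT t))
    right-below : resT t ρ y < z
    right-below = resT-below t ρ y (names-≤ {ρ = ρ} (ℕ.m≤m+n x (sizeT s)) n)
    both-below : All (Below y) (eqsT s ρ x) → All (Below z) (eqsT t ρ y) → All (Below z) (eqsT s ρ x ++ eqsT t ρ y)
    both-below p q = All.++⁺ (All.map (λ {e} → Below-mono (ℕ.m≤m+n y (sizeT t)) {e}) p) q

  eqsT-below : ∀ {k} (t : Tm k) ρ x → Names ρ x → All (Below (x ℕ.+ sizeT t)) (eqsT t ρ x)
  eqsT-below (var i) ρ x n = []
  eqsT-below 𝟘 ρ x n = (l , l , l) ∷ []
    where l = ℕ.m<m+n x (s≤s z≤n)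
  eqsT-below 𝟙 ρ x n = ℕ.m<m+n x (s≤s z≤n) ∷ []
  eqsT-below (s ⊕ t) ρ x n = subst (λ b → All (Below b) (eqsT (s ⊕ t) ρ x)) (next≡ s t ρ x n)
    ((ℕ.m<n⇒m<1+n (left-below s t ρ x n) , ℕ.m<n⇒m<1+n (right-below s t ρ x n) , ℕ.n<1+n _) ∷
     All.map (λ {e} → Below-mono (ℕ.n≤1+n _) {e}) (both-below s t ρ x n (eqsT-below s ρ x n) (eqsT-below t ρ _ (names-≤ {ρ = ρ} (ℕ.m≤m+n x (sizeT s)) n))))
  eqsT-below (s ⊗ t) ρ x n = subst (λ b → All (Below b) (eqsT (s ⊗ t) ρ x)) (next≡ s t ρ x n)
    ((ℕ.m<n⇒m<1+n (left-below s t ρ x n) , ℕ.m<n⇒m<1+n (right-below s t ρ x n) , ℕ.n<1+n _) ∷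
     All.map (λ {e} → Below-mono (ℕ.n≤1+n _) {e}) (both-below s t ρ x n (eqsT-below s ρ x n) (eqsT-below t ρ _ (names-≤ {ρ = ρ} (ℕ.m≤m+n x (sizeT s)) n))))

  eqsF-below : ∀ {k} (φ : Fo k) ρ x → Names ρ x → All (Below (x ℕ.+ sizeF φ)) (eqsF φ ρ x)
  eqsF-below (s ≐ t) ρ x n = subst (λ b → All (Below b) (eqsF (s ≐ t) ρ x)) (next≡ s t ρ x n)
    ((ℕ.n<1+n _ , ℕ.n<1+n _ , ℕ.n<1+n _) ∷ (ℕ.m<n⇒m<1+n (left-below s t ρ x n) , ℕ.n<1+n _ , ℕ.m<n⇒m<1+n (right-below s t ρ x n)) ∷
     All.map (λ {e} → Below-mono (ℕ.n≤1+n _) {e}) (both-below s t ρ x n (eqsT-below s ρ x n) (eqsT-below t ρ _ (names-≤ {ρ = ρ} (ℕ.m≤m+n x (sizeT s)) n))))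
  eqsF-below (φ ∧ ψ) ρ x n = subst (λ b → All (Below b) (eqsF (φ ∧ ψ) ρ x)) (ℕ.+-assoc x (sizeF φ) (sizeF ψ))
    (All.++⁺ (All.map (λ {e} → Below-mono (ℕ.m≤m+n (x ℕ.+ sizeF φ) (sizeF ψ)) {e}) (eqsF-below φ ρ x n))
             (eqsF-below ψ ρ (x ℕ.+ sizeF φ) (names-≤ {ρ = ρ} (ℕ.m≤m+n x (sizeF φ)) n)))
  eqsF-below (ex φ) ρ x n = subst (λ b → All (Below b) (eqsF φ (x ∷ ρ) (suc x))) (sym (ℕ.+-suc x (sizeF φ)))
    (eqsF-below φ (x ∷ ρ) (suc x) (λ { zero → ℕ.n<1+n x ; (suc i) → ℕ.m<n⇒m<1+n (n i) }))

  -- Solutions are built from left to right: names from x on may be set, those below x keep their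
  -- values, so equations already satisfied stay so.
  Extends : (ℕ → ℤ) → ℕ → List Eqn → Set
  Extends σ x es = ∃ λ τ → Agree x σ τ × All (HoldsN τ) es

  eqsT-complete : ∀ {k} (t : Tm k) ρ x → Names ρ x → ∀ σ → Extends σ x (eqsT t ρ x)
  eqsT²-complete : ∀ {k} (s t : Tm k) ρ x → Names ρ x → ∀ σ → Extends σ x (eqsT s ρ x ++ eqsT t ρ (x ℕ.+ sizeT s))

  eqsT²-complete s t ρ x n σ =
    let (τ , g , h) = eqsT-complete s ρ x n σ
        (υ , g′ , h′) = eqsT-complete t ρ (x ℕ.+ sizeT s) (names-≤ {ρ = ρ} (ℕ.m≤m+n x (sizeT s)) n) τ
    in υ , agree-trans (ℕ.m≤m+n x (sizeT s)) g g′ , All.++⁺ (all-agree g′ (eqsT-below s ρ x n) h) h′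

  eqsT-complete (var i) ρ x n σ = σ , (λ _ _ → refl) , []
  eqsT-complete 𝟘 ρ x n σ = σ [ x ↦ 0ℤ ] , update-below σ x 0ℤ ,
    trans (cong₂ _+_ (update-at σ x 0ℤ) (update-at σ x 0ℤ)) (sym (update-at σ x 0ℤ)) ∷ []
  eqsT-complete 𝟙 ρ x n σ = σ [ x ↦ 1ℤ ] , update-below σ x 1ℤ , update-at σ x 1ℤ ∷ []
  eqsT-complete (s ⊕ t) ρ x n σ = with-parts (eqsT²-complete s t ρ x n σ)
    where
    z = x ℕ.+ sizeT s ℕ.+ sizeT t
    with-parts : Extends σ x (eqsT s ρ x ++ eqsT t ρ (x ℕ.+ sizeT s)) → Extends σ x (eqsT (s ⊕ t) ρ x)
    with-parts (τ , g , h) = τ [ z ↦ w ] ,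
        agree-trans (ℕ.≤-trans (ℕ.m≤m+n x (sizeT s)) (ℕ.m≤m+n _ (sizeT t))) g (update-below τ z w) ,
        trans (cong₂ _+_ (update-below τ z w _ (left-below s t ρ x n)) (update-below τ z w _ (right-below s t ρ x n))) (sym (update-at τ z w)) ∷
        all-agree (update-below τ z w) (both-below s t ρ x n (eqsT-below s ρ x n) (eqsT-below t ρ _ (names-≤ {ρ = ρ} (ℕ.m≤m+n x (sizeT s)) n))) h
      where
      w = τ (resT s ρ x) + τ (resT t ρ (x ℕ.+ sizeT s))
  eqsT-complete (s ⊗ t) ρ x n σ = with-parts (eqsT²-complete s t ρ x n σ)
    where
    z = x ℕ.+ sizeT s ℕ.+ sizeT t
    with-parts : Extends σ x (eqsT s ρ x ++ eqsT t ρ (x ℕ.+ sizeT s)) → Extends σ x (eqsT (s ⊗ t) ρ x)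
    with-parts (τ , g , h) = τ [ z ↦ w ] ,
        agree-trans (ℕ.≤-trans (ℕ.m≤m+n x (sizeT s)) (ℕ.m≤m+n _ (sizeT t))) g (update-below τ z w) ,
        trans (cong₂ _*_ (update-below τ z w _ (left-below s t ρ x n)) (update-below τ z w _ (right-below s t ρ x n))) (sym (update-at τ z w)) ∷
        all-agree (update-below τ z w) (both-below s t ρ x n (eqsT-below s ρ x n) (eqsT-below t ρ _ (names-≤ {ρ = ρ} (ℕ.m≤m+n x (sizeT s)) n))) h
      where
      w = τ (resT s ρ x) * τ (resT t ρ (x ℕ.+ sizeT s))

  eqsF-complete : ∀ {k} (φ : Fo k) ρ x → Names ρ x → ∀ σ → map σ ρ ⊨ᶻ φ → Extends σ x (eqsF φ ρ x)
  eqsF-complete (s ≐ t) ρ x n σ e = with-parts (eqsT²-complete s t ρ x n σ)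
    where
    z = x ℕ.+ sizeT s ℕ.+ sizeT t
    with-parts : Extends σ x (eqsT s ρ x ++ eqsT t ρ (x ℕ.+ sizeT s)) → Extends σ x (eqsF (s ≐ t) ρ x)
    with-parts (τ , g , h) = υ ,
        agree-trans (ℕ.≤-trans (ℕ.m≤m+n x (sizeT s)) (ℕ.m≤m+n _ (sizeT t))) g (update-below τ z 0ℤ) ,
        trans (cong₂ _+_ (update-at τ z 0ℤ) (update-at τ z 0ℤ)) (sym (update-at τ z 0ℤ)) ∷
        trans (cong₂ _+_ (update-below τ z 0ℤ _ (left-below s t ρ x n)) (update-at τ z 0ℤ))
          (trans (+-identityʳ _) (trans values (sym (update-below τ z 0ℤ _ (right-below s t ρ x n))))) ∷
        all-agree (update-below τ z 0ℤ) (both-below s t ρ x n (eqsT-below s ρ x n) (eqsT-below t ρ _ (names-≤ {ρ = ρ} (ℕ.m≤m+n x (sizeT s)) n))) h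
      where
      υ = τ [ z ↦ 0ℤ ]
      values : τ (resT s ρ x) ≡ τ (resT t ρ (x ℕ.+ sizeT s))
      values = trans (eqsT-sound s ρ x τ (All.++⁻ˡ (eqsT s ρ x) h))
        (trans (subst (λ v → ⟦ s ⟧ᶻ v ≡ ⟦ t ⟧ᶻ v) (sym (map-agree ρ n g)) e)
               (sym (eqsT-sound t ρ (x ℕ.+ sizeT s) τ (All.++⁻ʳ (eqsT s ρ x) h))))
  eqsF-complete (φ ∧ ψ) ρ x n σ (p , q) = with-left (eqsF-complete φ ρ x n σ p)
    where
    y = x ℕ.+ sizeF φ
    with-left : Extends σ x (eqsF φ ρ x) → Extends σ x (eqsF (φ ∧ ψ) ρ x)
    with-left (τ , g , h) = with-right (eqsF-complete ψ ρ y (names-≤ {ρ = ρ} (ℕ.m≤m+n x (sizeF φ)) n) τ (subst (_⊨ᶻ ψ) (sym (map-agree ρ n g)) q))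
      where
      with-right : Extends τ y (eqsF ψ ρ y) → Extends σ x (eqsF (φ ∧ ψ) ρ x)
      with-right (υ , g′ , h′) = υ , agree-trans (ℕ.m≤m+n x (sizeF φ)) g g′ , All.++⁺ (all-agree g′ (eqsF-below φ ρ x n) h) h′
  eqsF-complete (ex φ) ρ x n σ (z , p) = with-body (eqsF-complete φ (x ∷ ρ) (suc x)
      (λ { zero → ℕ.n<1+n x ; (suc i) → ℕ.m<n⇒m<1+n (n i) }) (σ [ x ↦ z ])
      (subst (_⊨ᶻ φ) (sym (cong₂ _∷_ (update-at σ x z) (map-agree ρ n (update-below σ x z)))) p))
    where
    with-body : Extends (σ [ x ↦ z ]) (suc x) (eqsF φ (x ∷ ρ) (suc x)) → Extends σ x (eqsF φ (x ∷ ρ) (suc x))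
    with-body (τ , g , h) = τ , agree-trans (ℕ.n≤1+n x) (update-below σ x z) g , h

  -- Names beyond n are sent to x₁; this never happens when the system fits.
  name : ∀ n → ℕ → Fin (suc n)
  name n i with i ℕ.<? suc n
  ... | yes i<n = fromℕ< i<n
  ... | no  _   = zero

  toℕ-name : ∀ n i → i < suc n → toℕ (name n i) ≡ i
  toℕ-name n i i<n with i ℕ.<? suc n
  ... | yes p = toℕ-fromℕ< p
  ... | no ¬p = ⊥-elim (¬p i<n)

  equation : ∀ n → Eqn → Equation (suc n)
  equation n (one i)     = one (name n i)
  equation n (add i j k) = add (name n i) (name n j) (name n k)
  equation n (mul i j k) = mul (name n i) (name n j) (name n k)

  solves-sound : ∀ n x es → Solves x (List.map (equation n) es) → All (HoldsN (λ i → x (name n i))) es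
  solves-sound n x []                []       = []
  solves-sound n x (one i ∷ es)      (h ∷ hs) = h ∷ solves-sound n x es hs
  solves-sound n x (add i j k ∷ es) (h ∷ hs) = h ∷ solves-sound n x es hs
  solves-sound n x (mul i j k ∷ es) (h ∷ hs) = h ∷ solves-sound n x es hs

  solves-complete : ∀ n σ es → All (Below (suc n)) es → All (HoldsN σ) es → Solves (λ i → σ (toℕ i)) (List.map (equation n) es)
  solves-complete n σ []               []                 []       = []
  solves-complete n σ (one i ∷ es)     (p ∷ bs)           (h ∷ hs) = trans (cong σ (toℕ-name n i p)) h ∷ solves-complete n σ es bs hs
  solves-complete n σ (add i j k ∷ es) ((p , q , r) ∷ bs) (h ∷ hs) =
    trans (cong₂ (λ i j → σ i + σ j) (toℕ-name n i p) (toℕ-name n j q)) (trans h (cong σ (sym (toℕ-name n k r)))) ∷ solves-complete n σ es bs hs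
  solves-complete n σ (mul i j k ∷ es) ((p , q , r) ∷ bs) (h ∷ hs) =
    trans (cong₂ (λ i j → σ i * σ j) (toℕ-name n i p) (toℕ-name n j q)) (trans h (cong σ (sym (toℕ-name n k r)))) ∷ solves-complete n σ es bs hs

  -- The argument is written as 8h + r, so that building it takes about n/4 variables.
  ValueR : PR 1 → ℕ → ℕ → Vec ℕ 1 → Set
  ValueR c h r (y ∷ []) = c ⟨ 8 ℕ.* h ℕ.+ r ∷ [] ⟩⇓ y

  valueD : ∀ c h r → Dio (ValueR c h r)
  valueD c h r = mapD
    (λ { (y ∷ []) (N , h′ , h≡ , N≡ , ev) → subst (λ N → c ⟨ N ∷ [] ⟩⇓ y)
           (trans N≡ (cong₂ (λ s t → 8 ℕ.* s ℕ.+ t) (trans h≡ (⟦num⟧ h (h′ ∷ N ∷ y ∷ []))) (⟦num⟧ r (h′ ∷ N ∷ y ∷ [])))) ev })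
    (λ { (y ∷ []) ev → 8 ℕ.* h ℕ.+ r , h , sym (⟦num⟧ h _) , cong (λ t → 8 ℕ.* h ℕ.+ t) (sym (⟦num⟧ r _)) , ev })
    -- The quantified variable for h lets its long numeral occur once; multiplication by the fixed
    -- numeral 8 costs a constant.
    (exD (exD (eqD (var (# 0)) (num h) ∧D eqD (var (# 1)) (num 8 ⊗ var (# 0) ⊕ num r) ∧D subD (graphD c) (var (# 2) ∷ var (# 1) ∷ []))))

  formula : PR 1 → ℕ → ℕ → Fo 1
  formula c h r = nonNegF ∧ relativize (fo (valueD c h r))

  -- Each unit takes two variables, one for 1 and one for the partial sum. With h about n/8 this is
  -- about n/4, whereas the numeral of n would take more than n.
  sizeT-num : ∀ {k} h → sizeT {k} (num h) ≡ 1 ℕ.+ h ℕ.* 2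
  sizeT-num zero    = refl
  sizeT-num (suc h) = trans (cong (λ t → suc (t ℕ.+ 1)) (sizeT-num h)) (eq h)
    where
    eq : ∀ h → suc (1 ℕ.+ h ℕ.* 2 ℕ.+ 1) ≡ 1 ℕ.+ suc h ℕ.* 2
    eq = ℕ.solve-∀

  -- h and r occur only in their two numerals, so the size is that for h = r = 0 plus the growth of
  -- these.
  size-formula : ∀ c h r → sizeF (formula c h r) ≡ sizeF (formula c 0 0) ℕ.+ (h ℕ.* 2 ℕ.+ r ℕ.* 2)
  size-formula c h r = trans (cong₂ shape {sizeT {3} (num h)} {1 ℕ.+ h ℕ.* 2} {sizeT {3} (num r)} {1 ℕ.+ r ℕ.* 2} (sizeT-num h) (sizeT-num r))
      (eq (sizeF (nonNegF {0})) (sizeF (nonNegF {1})) (sizeF (nonNegF {2})) (sizeT {3} (num 8 ⊗ var (# 0))) g (h ℕ.* 2) (r ℕ.* 2))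
    where
    g = sizeF (relativize (sub (var (# 2) ∷ var (# 1) ∷ []) (fo (graphD c))))
    shape : ℕ → ℕ → ℕ
    shape a b = sizeF (nonNegF {0}) ℕ.+ suc (sizeF (nonNegF {1}) ℕ.+ suc (sizeF (nonNegF {2}) ℕ.+
      ((a ℕ.+ 1) ℕ.+ ((sizeT {3} (num 8 ⊗ var (# 0)) ℕ.+ b ℕ.+ 1 ℕ.+ 1) ℕ.+ g))))
    eq : ∀ n₀ n₁ n₂ e g a b →
      n₀ ℕ.+ suc (n₁ ℕ.+ suc (n₂ ℕ.+ ((1 ℕ.+ a ℕ.+ 1) ℕ.+ ((e ℕ.+ (1 ℕ.+ b) ℕ.+ 1 ℕ.+ 1) ℕ.+ g)))) ≡
      (n₀ ℕ.+ suc (n₁ ℕ.+ suc (n₂ ℕ.+ ((1 ℕ.+ 1) ℕ.+ ((e ℕ.+ 1 ℕ.+ 1 ℕ.+ 1) ℕ.+ g))))) ℕ.+ (a ℕ.+ b)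
    eq = ℕ.solve-∀

-- The two algorithms and their correctness.

open import Defs
open Formulas
open RecursiveFunctions
open FourSquares
open Compilation
open import Data.Nat as ℕ using (ℕ; zero; suc; s≤s; z≤n; _≤_; _<_)
import Data.Nat.Properties as ℕ
import Data.Nat.DivMod as ℕ
import Data.Nat.Tactic.RingSolver as ℕ
open import Data.Integer using (ℤ; +_)
open import Data.Fin using (Fin; zero; suc; toℕ; fromℕ<)
open import Data.Vec using ([]; _∷_)
open import Data.List as List using ([]; _∷_)
open import Data.List.Relation.Unary.All as All using ([]; _∷_)
open import Data.Maybe using (Maybe; just)
open import Data.Product using (Σ; ∃; _×_; _,_)
open import Relation.Binary.PropositionalEquality

-- With S the size for h = r = 0, the system needs at most 1 + S + 2h + 14 variables: x₁, the fixed
-- part, and the numerals with r ≤ 7. Since 4h ≤ 8h ≤ n, the bound n ≥ 2(15 + S) makes twice this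
-- number at most 2n.
threshold : PR 1 → ℕ
threshold c = 2 ℕ.* (15 ℕ.+ sizeF (formula c 0 0))

formula-fits : ∀ c n h r → n ≡ r ℕ.+ h ℕ.* 8 → r < 8 → threshold c ≤ n → 1 ℕ.+ sizeF (formula c h r) ≤ n
formula-fits c n h r n≡ (s≤s r≤7) K≤n = ℕ.*-cancelˡ-≤ 2 (begin
  2 ℕ.* (1 ℕ.+ sizeF (formula c h r))                    ≡⟨ cong (λ t → 2 ℕ.* (1 ℕ.+ t)) (size-formula c h r) ⟩
  2 ℕ.* (1 ℕ.+ (S ℕ.+ (h ℕ.* 2 ℕ.+ r ℕ.* 2)))            ≤⟨ ℕ.*-monoʳ-≤ 2 (ℕ.+-monoʳ-≤ 1 (ℕ.+-monoʳ-≤ S (ℕ.+-monoʳ-≤ (h ℕ.* 2) (ℕ.*-monoˡ-≤ 2 r≤7)))) ⟩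
  2 ℕ.* (1 ℕ.+ (S ℕ.+ (h ℕ.* 2 ℕ.+ 14)))                 ≡⟨ eq S h ⟩
  2 ℕ.* (15 ℕ.+ S) ℕ.+ h ℕ.* 4                           ≤⟨ ℕ.+-mono-≤ K≤n (ℕ.≤-trans (ℕ.*-monoʳ-≤ h (ℕ.m≤m+n 4 4)) (ℕ.≤-trans (ℕ.m≤n+m (h ℕ.* 8) r) (ℕ.≤-reflexive (sym n≡)))) ⟩
  n ℕ.+ n                                                ≡⟨ cong (n ℕ.+_) (sym (ℕ.+-identityʳ n)) ⟩
  2 ℕ.* n                                                ∎)
  where
  open ℕ.≤-Reasoning
  S = sizeF (formula c 0 0)
  eq : ∀ S h → 2 ℕ.* (1 ℕ.+ (S ℕ.+ (h ℕ.* 2 ℕ.+ 14))) ≡ 2 ℕ.* (15 ℕ.+ S) ℕ.+ h ℕ.* 4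
  eq = ℕ.solve-∀

system : PR 1 → (n : ℕ) → System n
-- A default: the threshold is at least 30, so n = 0 is never requested.
system c zero    = []
system c (suc n) = List.map (equation n) (eqsF (formula c (suc n ℕ./ 8) (suc n ℕ.% 8)) (0 ∷ []) 1)

names₀ : Names (0 ∷ []) 1
names₀ zero = s≤s z≤n

8h+r≡ : ∀ n → 8 ℕ.* (n ℕ./ 8) ℕ.+ n ℕ.% 8 ≡ n
8h+r≡ n = trans (ℕ.+-comm (8 ℕ.* (n ℕ./ 8)) (n ℕ.% 8)) (trans (cong (n ℕ.% 8 ℕ.+_) (ℕ.*-comm 8 (n ℕ./ 8))) (sym (ℕ.m≡m%n+[m/n]*n n 8)))

system-consistent : ∀ c n y → threshold c ≤ n → c ⟨ n ∷ [] ⟩⇓ y → ∃ λ x → Solves x (system c n)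
system-consistent c (suc n) y K≤n ev = with-solution
    -- Names from 1 on are fresh, so the constant start assignment matters only at name 0, which is
    -- x₁ = y.
    (eqsF-complete φ (0 ∷ []) 1 names₀ (λ _ → + y)
      (nonNegZ y , relativize-complete (fo value) (y ∷ []) (complete value (y ∷ []) (subst (λ N → c ⟨ N ∷ [] ⟩⇓ y) (sym (8h+r≡ (suc n))) ev))))
  where
  value = valueD c (suc n ℕ./ 8) (suc n ℕ.% 8)
  φ = formula c (suc n ℕ./ 8) (suc n ℕ.% 8)
  with-solution : Extends (λ _ → + y) 1 (eqsF φ (0 ∷ []) 1) → ∃ λ x → Solves x (system c (suc n))
  with-solution (σ , _ , h) = (λ i → σ (toℕ i)) , solves-complete n σ (eqsF φ (0 ∷ []) 1)
    (All.map (λ {e} → Below-mono (formula-fits c (suc n) (suc n ℕ./ 8) (suc n ℕ.% 8) (ℕ.m≡m%n+[m/n]*n (suc n) 8) (ℕ.m%n<n (suc n) 8) K≤n) {e}) (eqsF-below φ (0 ∷ []) 1 names₀)) h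
system-consistent c zero y K≤n ev = (λ ()) , []

-- Pulling a solution back along `name` solves the ℕ-indexed equations. The leading `nonNegF` makes
-- x₁ a natural number z, the rest says that c evaluates to z at n, and evaluation is deterministic.
system-determines : ∀ c n y → c ⟨ n ∷ [] ⟩⇓ y → ∀ x → Solves x (system c n) → (p : 0 < n) → x (fromℕ< p) ≡ + y
system-determines c (suc n) y ev x s p = from-formula (eqsF-sound (formula c h r) (0 ∷ []) 1 _ (solves-sound n x _ s))
  where
  h = suc n ℕ./ 8
  r = suc n ℕ.% 8
  from-formula : (x zero ∷ []) ⊨ᶻ formula c h r → x zero ≡ + y
  from-formula (nn , rel) with nonNegZ⇒ℕ (x zero) nn
  ... | z , x≡ = trans x≡ (cong +_ (⇓-det c evz ev))
    where
    evz : c ⟨ suc n ∷ [] ⟩⇓ z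
    evz = subst (λ N → c ⟨ N ∷ [] ⟩⇓ z) (8h+r≡ (suc n)) (sound (valueD c h r) (z ∷ [])
            (relativize-sound (fo (valueD c h r)) (z ∷ []) (subst (λ t → (t ∷ []) ⊨ᶻ relativize (fo (valueD c h r))) x≡ rel)))

theorem1 : Σ (PR 1 → ℕ → Maybe ℕ) λ A →
    Σ (PR 1 → (n : ℕ) → ℕ → Maybe (System n)) λ B →
    (f : ℕ → ℕ) (c : PR 1) → Computes c f →
    Σ ℕ (λ fuel → Σ ℕ λ m → A c fuel ≡ just m)
    × ((fuel m : ℕ) → A c fuel ≡ just m →
    (1 ≤ m)
    × ((n : ℕ) → m ≤ n →
    Σ ℕ (λ fuel′ → Σ (System n) λ S → B c n fuel′ ≡ just S)
    × ((fuel′ : ℕ) (S : System n) → B c n fuel′ ≡ just S →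
    Σ (Fin n → ℤ) (λ x → Solves x S)
    × ((x : Fin n → ℤ) → Solves x S →
    (p : 0 < n) → x (fromℕ< p) ≡ + f n))))
-- Both algorithms are total functions, so fuel 0 witnesses halting.
theorem1 = (λ c _ → just (threshold c)) , (λ c n _ → just (system c n)) , λ f c comp →
  (0 , threshold c , refl) , λ { _ _ refl →
    s≤s z≤n , λ n K≤n →
      (0 , system c n , refl) , λ { _ _ refl →
        system-consistent c n (f n) K≤n (comp n) , system-determines c n (f n) (comp n) } }
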